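{- For every $F\in\mathbb{N}$ and $L\in[1,\infty)$ there are real constants $E,E',E'',E''',D,D',D''>0$ such that the following holds. Let $R$ be a commutative ring, let $(X,w)$ be a properly weighted $R$-oriented $d$-poset ($d\ge2$) such that $L(X)\le L$ and $F^{\max}_{0,2}(X),F^{\max}_{1,2}(X)\le F$, and let $\mathcal{F}$ be an $R$-sheaf on $X$. Let $\varepsilon,\varepsilon'\in\mathbb{R}_+$, $\alpha_0,\beta_0,\alpha_{ -1},\beta_{ -1},\alpha_{||},\beta_{||}\in[0,\infty)$ and suppose that: (1a) $\mathrm{cbe}_{ -1}(X_v,w_v,\mathcal{F}_v)\ge\varepsilon$ for every $v\in X(0)$; (1b) $\mathrm{cbe}_{ -1}(X_e,w_e,\mathcal{F}_e)\ge\varepsilon'$ for every $e\in X(1)$; (1c) $\mathrm{cbe}_0(X_v,w_v,\mathcal{F}_v)\ge\varepsilon'$ for every $v\in X(0)$; (2a) $\mathrm{Gr}(X_v,w_v)$ is an $(\alpha_0,\beta_0)$-skeleton expander for all $v\in X(0)$; (2b) $\mathrm{Gr}(X,w)$ is an $(\alpha_{ -1},\beta_{ -1})$-skeleton expander; (2c) $\mathrm{NIH}^{1,1,2}(X,w)$ is an $(\alpha_{||},\beta_{||})$-skeleton expander. Suppose further that $\alpha_{ -1}<E\varepsilon$ and that there are $h_{ -1},h_0,h_{||}\in(0,1]$ with $$(\alpha_0+\beta_0h_0)+(\alpha_{||}+\beta_{||}h_{||})+\frac{\alpha_{ -1}+\beta_{ -1}h_{ -1}}{h_0}\le E'\varepsilon'.$$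 Then $$\mathrm{cse}_0(X,w,\mathcal{F})\ge\frac{E''}{h_0^{ -1}h_{ -1}^{ -1}+h_{||}^{ -1}}\qquad\text{and}\qquad\mathrm{ccd}_0(X,w,\mathcal{F})\ge\frac{E'''(E\varepsilon-\alpha_{ -1})}{\beta_{ -1}}$$ (the last quotient is read as $+\infty$ if $\beta_{ -1}=0$). Moreover, if $f\in C^0=C^0(X,\mathcal{F})$ satisfies $\mathrm{dist}_w(f,Z^0)<\frac{D}{h_0^{ -1}h_{ -1}^{ -1}+h_{||}^{ -1}}$, then applying the Correction Algorithm (with $k=0$) to $f$ with parameter $q=D'h_0$ returns $f'\in Z^0$ such that $\mathrm{dist}_w(f,f')\le\frac{1}{D''h_0}\mathrm{dist}_w(f,Z^0)$. Furthermore, the constants $(E,E',E'',E''',D,D',D'')$ for which these hypotheses on $(X,w,\mathcal{F})$ imply the two lower bounds on $\mathrm{cse}_0(X,w,\mathcal{F})$ and $\mathrm{ccd}_0(X,w,\mathcal{F})$ and the assertion on the output of the Correction Algorithm can be taken to have the following explicit values: - with no further assumption on $X$: $\big(L^{ -8},\frac14L^{ -18}F^{ -5},\frac12L^{ -13}F^{ -2},L^{ -3},L^{ -15}F^{ -1},\frac14L^{ -12}F^{ -2},\frac14L^{ -16}F^{ -3}\big)$; - if $X$ is lower-regular: $\big(1,\frac14F^{ -2},\frac12F^{ -1},1,F^{ -1},\frac14F^{ -1},\frac14F^{ -2}\big)$; - if $X$ is a simplicial complex: $\big(1,\frac1{12},\frac12,1,\frac12,\frac14,\frac18\big)$; - if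 $X$ is a cube complex: $\big(1,\frac1{16},\frac12,1,\frac12,\frac14,\frac18\big)$; - if $X(-1)\cup X(0)\cup X(1)\cup X(2)$ is an $m$-gon complex: $\big(L^{ -8},\frac1{4m}L^{ -18},\frac12L^{ -13},L^{ -3},\frac12L^{ -15},\frac14L^{ -12},\frac18L^{ -16}\big)$.
   Context: **Posets.** All posets are finite; $x\lhd y$ means $x<y$ with no element strictly between. A graded poset is a poset $X$ with $\dim:X\to\mathbb{Z}$ such that $x\le y$ implies $\dim x\le\dim y$ and $x\lhd y$ implies $\dim y=\dim x+1$. Put $X(i)=\{x\in X:\dim x=i\}$ ($i$-faces), $x(i)=\{y\in X(i):y\le x\}$, and $A_x=\{a\in A:a\ge x\}$ for $A\subseteq X$. A $d$-poset ($d\ge 0$) is a nonempty graded poset in which every face is $\le$ some $d$-face and which has a face $\emptyset_X$ with $\dim\emptyset_X=-1$ and $\emptyset_X\le x$ for all $x$. For a subset $A$ of a $d$-poset, $\mathrm{Inf}\,A$ is the set of maximal lower bounds of $A$. Simplicial complexes, cube complexes, and more generally regular cell complexes are identified with their face posets, including one empty face of dimension $-1$; an $m$-gon complex is a $2$-dimensional regular cell complex all of whose $2$-faces are $m$-gons. **Face counts.** For $i\le j\le k$, $F^{\max}_{i,j,k}(X)$ (resp. $F^{\min}_{i,j,k}(X)$) is the maximal (resp. minimal) number of $y\in X(j)$ with $x\le y\le z$, over all $x\in X(i)$, $z\in X(k)$ with $x\le z$. Write $F^{\max}_{j,k}=F^{\max}_{ -1,j,k}$, $L_{i,j,k}=F^{\max}_{i,j,k}/F^{\min}_{i,j,k}$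 and $L(X)=\max_{ -1\le i\le j\le k\le d}L_{i,j,k}$ (lower irregularity). $X$ is lower-regular if $L(X)=1$. **Weights and links.** A proper weight function on a $d$-poset $X$ is $w:X\to\mathbb{R}_+$ (positive reals) with $\sum_{y\in X(d)}w(y)=1$ and $w(x)=\sum_{y\in X(d),\,y\ge x}w(y)/|y(i)|$ for all $x\in X(i)$ and all $i$. For $A\subseteq X$, $w(A)=\sum_{a\in A}w(a)$. For $z\in X$ the link is $X_z=\{x\in X:x\ge z\}$ with $\dim_{X_z}x=\dim x-\dim z-1$, given the proper weight function $w_z(x)=\frac{1}{w(X(d)_z)}\sum_{y\in X(d)_x}\frac{w(y)}{\#\{x'\in X(\dim x):z\le x'\le y\}}$. **Orientation, sheaves, cohomology.** An $R$-orientation on $X$ assigns $[y:x]\in R^\times$ to each $x\lhd y$ so that $\sum_{y:x<y<z}[z:y][y:x]=0$ whenever $x\le z$ and $\dim z=\dim x+2$; links carry the restricted orientation. An $R$-sheaf $\mathcal{F}$ on $X$ consists of $R$-modules $\mathcal{F}(x)$ ($x\in X$) and $R$-linear maps $\mathrm{res}_{y\leftarrow x}:\mathcal{F}(x)\to\mathcal{F}(y)$ ($x<y$) with $\mathrm{res}_{z\leftarrow y}\circ\mathrm{res}_{y\leftarrow x}=\mathrm{res}_{z\leftarrow x}$ for $x<y<z$. $\mathcal{F}_z$ is the restriction of $\mathcal{F}$ to $X_z$. $C^i=C^i(X,\mathcal{F})=\prod_{x\in X(i)}\mathcal{F}(x)$; $d=d_i:C^i\to C^{i+1}$ is $(d_if)(y)=\sum_{x\in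 y(i)}[y:x]\,\mathrm{res}_{y\leftarrow x}f(x)$; $Z^i=\ker d_i$, $B^i=\mathrm{im}\,d_{i-1}$. **Expansion.** For $f,g\in C^i$: $\|f\|_w=w(\{x:f(x)\ne0\})$, $\mathrm{dist}_w(f,g)=\|f-g\|_w$. $\mathrm{cse}_i(X,w,\mathcal{F})$ is the supremum of the $\mu\ge0$ with $\|df\|_w\ge\mu\,\mathrm{dist}_w(f,Z^i)$ for all $f\in C^i$; $\mathrm{cbe}_i(X,w,\mathcal{F})$ is the supremum of the $\mu\ge 0$ with $\|df\|_w\ge\mu\,\mathrm{dist}_w(f,B^i)$ for all $f\in C^i$; $\mathrm{ccd}_i(X,w,\mathcal{F})=\inf\{\|f\|_w:f\in Z^i\setminus B^i\}$. **Hypergraphs, skeleton expansion.** $\mathrm{Gr}(X,w)$ is the weighted hypergraph with vertices $X(0)$, hyperedges $X(1)$ and weights from $w$; it is an $(\alpha,\beta)$-skeleton expander if for all $A\subseteq X(0)$ the total weight of the $e\in X(1)$ having at least two distinct vertices in $A$ is at most $\alpha w(A)+\beta w(A)^2$. $\mathrm{NIH}^{1,1,2}(X,w)$ has vertices $X(1)$, hyperedges $X(2)$ and weights from $w$; it is an $(\alpha,\beta)$-skeleton expander if for all $A\subseteq X(1)$ the total weight of the $z\in X(2)$ for which there are distinct $x,y\in A$ with $x,y<z$ and $\mathrm{Inf}\{x,y\}=\{\emptyset_X\}$ is at most $\alpha w(A)+\beta w(A)^2$. **Correction Algorithm.** For $u\in X$ and $g\in C^{k-\dim u-1}(X_u,\mathcal{F}_u)$,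 let $g^u\in C^k(X,\mathcal{F})$ be $g^u(x)=g(x)$ if $x\ge u$ and $0$ otherwise. Input: $f\in C^k(X,\mathcal{F})$ and a real $q\ge0$. Set $f_0=f$, $i=0$. While there exist $u\in X(0)\cup\dots\cup X(k)$ and $g\in C^{k-\dim u-1}(X_u,\mathcal{F}_u)$ with $\|df_i+d(g^u)\|_w<\|df_i\|_w-q\,w(u)$, choose such a pair, set $f_{i+1}=f_i+g^u$ and increase $i$ by $1$. Output the last $f_i$. -}

module Defs where

open import Algebra.Bundles using (CommutativeMonoid; CommutativeRing)
import Algebra.Definitions as AlgDefs
open import Algebra.Module.Bundles using (Module)
open import Algebra.Module.Morphism.Structures using (module ModuleMorphisms)
import Algebra.Properties.CommutativeMonoid.Sum as MonoidSum
import Algebra.Properties.Monoid.Mult as MonoidMult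
import Algebra.Properties.Semiring.Exp as SemiringExp
open import Axiom.ExcludedMiddle using (ExcludedMiddle)
open import Data.Bool.Base using (Bool)
open import Data.Fin.Base using (Fin; toℕ)
open import Data.Fin.Subset as Subset using (Subset)
open import Data.Integer.Base as ℤ using (ℤ; 0ℤ; 1ℤ; -1ℤ) renaming (+_ to pos)
import Data.Integer.Properties as ℤₚ
open import Data.Irrelevant using ([_])
open import Data.List.Base as List
  using (List; []; _∷_; length; lookup; filter; cartesianProduct; upTo)
import Data.List.Extrema as Extrema
import Data.List.Extrema.Nat as ℕExtrema
open import Data.List.Membership.Propositional using (_∈_)
open import Data.List.Relation.Unary.Any using (here; there)
open import Data.List.Relation.Unary.All as All using (All; []; _∷_)
open import Data.List.Relation.Unary.AllPairs using ([]; _∷_)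
open import Data.List.Relation.Unary.Enumerates.Setoid using (IsEnumeration)
open import Data.List.Relation.Unary.Unique.Propositional using (Unique)
open import Data.Maybe.Base using (Maybe; just; nothing)
open import Data.Nat.Base as ℕ using (ℕ; suc)
open import Data.Product.Base using (Σ; ∃; ∃₂; _×_; _,_; proj₁; proj₂)
open import Data.Refinement using (Refinement; Refinement-syntax; _,_; value; proof)
open import Data.Refinement.Properties using (value-injective)
open import Data.Vec.Base using (Vec)
open import Data.Vec.Relation.Binary.Pointwise.Inductive using (Pointwise)
open import Function.Base using (_∘_; flip)
open import Function.Bundles using (_⇔_)
open import Induction.WellFounded using (Acc)
open import Level using (Level; 0ℓ; _⊔_) renaming (suc to lsuc)
open import Relation.Binary.Bundles using (TotalOrder)
import Relation.Binary.Construct.Add.Extrema.NonStrict as AddExtrema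
import Relation.Binary.Construct.NonStrictToStrict as ToStrict
open import Relation.Binary.Construct.Closure.ReflexiveTransitive using (Star)
open import Relation.Binary.Core using (Rel)
open import Relation.Binary.PropositionalEquality
  using (_≡_; _≢_; refl; sym; trans; cong; setoid; isEquivalence)
open import Relation.Binary.Rewriting using (IsNormalForm)
open import Relation.Binary.Structures using (IsPartialOrder; IsTotalOrder)
open import Relation.Nullary using (¬_; Dec; yes; no)
open import Relation.Nullary.Construct.Add.Extrema using (_±; ⊥±; ⊤±)
  renaming ([_] to fin)
open import Relation.Nullary.Decidable using (True; fromWitness; toWitness; _×-dec_)
open import Relation.Nullary.Negation using (contradiction-irr)
open import Relation.Unary using (Pred; _⊆_; _∪_; _≐_; ｛_｝)

-- The real numbers, up to the isomorphism that characterises them.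
record CompleteOrderedField : Set₁ where
  field
    commutativeRing : CommutativeRing 0ℓ 0ℓ

  open CommutativeRing commutativeRing public hiding (refl; sym; trans; isEquivalence)

  infix 4 _≤_
  infix 8 _⁻¹

  field
    _≤_          : Rel Carrier 0ℓ
    isTotalOrder : IsTotalOrder _≈_ _≤_
    +-monoʳ-≤    : ∀ x {y z} → y ≤ z → x + y ≤ x + z
    *-nonNeg     : ∀ {x y} → 0# ≤ x → 0# ≤ y → 0# ≤ x * y
    0≉1          : ¬ 0# ≈ 1#
    -- 0# ⁻¹ is an unspecified element.
    _⁻¹          : Carrier → Carrier
    ⁻¹-cong      : ∀ {x y} → x ≈ y → x ⁻¹ ≈ y ⁻¹
    *-inverseʳ   : ∀ {x} → ¬ x ≈ 0# → x * x ⁻¹ ≈ 1#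

  UpperBound : ∀ {p} → Pred Carrier p → Carrier → Set p
  UpperBound P b = ∀ {x} → P x → x ≤ b

  field
    complete : (P : Pred Carrier 0ℓ) → ∃ P → ∃ (UpperBound P) →
               ∃ λ s → UpperBound P s × (∀ b → UpperBound P b → s ≤ b)

  totalOrder : TotalOrder 0ℓ 0ℓ 0ℓ
  totalOrder = record { isTotalOrder = isTotalOrder }

  open ToStrict _≈_ _≤_ public using (_<_)
  open MonoidMult +-monoid using () renaming (_×_ to _ו_)
  open SemiringExp semiring public using (_^_)

  infixl 7 _÷_

  _÷_ : Carrier → Carrier → Carrier
  x ÷ y = x * y ⁻¹

  fromℕ : ℕ → Carrier
  fromℕ n = n ו 1#

record GradedPoset : Set₁ where
  infix 4 _≤_ _⋖_

  field
    Carrier        : Set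
    _≤_            : Rel Carrier 0ℓ
    isPartialOrder : IsPartialOrder _≡_ _≤_
    faces          : List Carrier
    faces-complete : IsEnumeration (setoid Carrier) faces
    faces-unique   : Unique faces
    dim            : Carrier → ℤ

  open IsPartialOrder isPartialOrder public
    using () renaming (refl to ≤-refl; trans to ≤-trans; antisym to ≤-antisym)
  open ToStrict _≡_ _≤_ public using (_<_)

  _⋖_ : Rel Carrier 0ℓ
  x ⋖ y = x < y × ¬ (∃ λ t → x < t × t < y)

  field
    dim-mono : ∀ {x y} → x ≤ y → dim x ℤ.≤ dim y
    dim-⋖    : ∀ {x y} → x ⋖ y → dim y ≡ ℤ.suc (dim x)

  Faces : ℤ → Pred Carrier 0ℓ
  Faces i x = dim x ≡ i

  -- The set written y(i).
  FacesOf : Carrier → ℤ → Pred Carrier 0ℓ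
  FacesOf y i x = dim x ≡ i × x ≤ y

  LowerBound : ∀ {p} → Pred Carrier p → Pred Carrier p
  LowerBound A b = ∀ {a} → A a → b ≤ a

  Inf : ∀ {p} → Pred Carrier p → Pred Carrier p
  Inf A b = LowerBound A b × (∀ {b′} → LowerBound A b′ → b ≤ b′ → b′ ≡ b)

record IsDPoset (d : ℕ) (X : GradedPoset) : Set where
  open GradedPoset X
  field
    pure  : ∀ x → ∃ λ y → Faces (pos d) y × x ≤ y
    ∅     : Carrier
    dim-∅ : dim ∅ ≡ -1ℤ
    ∅-min : ∀ x → ∅ ≤ x

-- The nonempty faces below x form a poset isomorphic to (A, ⊑).
CellIso : (X : GradedPoset) → GradedPoset.Carrier X → {A : Set} → Rel A 0ℓ → Set
CellIso X x {A} _⊑_ = ∃ λ (φ : A → Carrier) →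
  (∀ a b → a ⊑ b ⇔ φ a ≤ φ b) ×
  (∀ y → (0ℤ ℤ.≤ dim y × y ≤ x) ⇔ ∃ λ a → φ a ≡ y)
  where open GradedPoset X

-- Abstract simplicial complexes: downward closed families of subsets.
IsSimplicialComplex : GradedPoset → Set
IsSimplicialComplex X = ∃₂ λ n (φ : Carrier → Subset n) →
  (∀ x y → x ≤ y ⇔ φ x Subset.⊆ φ y) ×
  (∀ x S → S Subset.⊆ φ x → ∃ λ y → φ y ≡ S) ×
  (∀ x → dim x ≡ pos Subset.∣ φ x ∣ ℤ.- 1ℤ)
  where open GradedPoset X

-- A nonempty face of the cube [0,1]ᵏ: each coordinate is fixed to an endpoint
-- (just) or free (nothing).
CubeFace : ℕ → Set
CubeFace k = Vec (Maybe Bool) k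

data _⊑ᴵ_ : Rel (Maybe Bool) 0ℓ where
  ⊑ᴵ-refl : ∀ {a} → a ⊑ᴵ a
  ⊑ᴵ-free : ∀ {a} → a ⊑ᴵ nothing

_⊑□_ : ∀ {k} → Rel (CubeFace k) 0ℓ
_⊑□_ = Pointwise _⊑ᴵ_

-- Regular cell complexes all of whose cells are combinatorial cubes.
IsCubeComplex : GradedPoset → Set
IsCubeComplex X = ∀ x k → dim x ≡ pos k → CellIso X x (_⊑□_ {k})
  where open GradedPoset X

-- The m-gon with vertices 0,…,m-1; the ends of the edge i are i and i+1 mod m.
data PolygonFace (m : ℕ) : Set where
  vertex   : Fin m → PolygonFace m
  edge     : Fin m → PolygonFace m
  interior : PolygonFace m

data _⊑ᴾ_ {m : ℕ} : Rel (PolygonFace m) 0ℓ where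
  ⊑ᴾ-refl     : ∀ {a} → a ⊑ᴾ a
  ⊑ᴾ-source   : ∀ {i} → vertex i ⊑ᴾ edge i
  ⊑ᴾ-target   : ∀ {i j} → toℕ j ≡ suc (toℕ i) → vertex j ⊑ᴾ edge i
  ⊑ᴾ-wrap     : ∀ {i j} → suc (toℕ i) ≡ m → toℕ j ≡ 0 → vertex j ⊑ᴾ edge i
  ⊑ᴾ-interior : ∀ {a} → a ⊑ᴾ interior

-- The faces of dimension at most 2 form an m-gon complex.  A regular cell
-- complex of dimension 2 is determined by its edges being segments and its
-- 2-cells being m-gons with m ≥ 2.
Is-gonComplex₂ : ℕ → GradedPoset → Set
Is-gonComplex₂ m X = 2 ℕ.≤ m ×
  (∀ x → dim x ≡ pos 1 → CellIso X x (_⊑□_ {1})) ×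
  (∀ x → dim x ≡ pos 2 → CellIso X x (_⊑ᴾ_ {m}))
  where open GradedPoset X

record Sheaf {r ℓr} (R : CommutativeRing r ℓr) (X : GradedPoset) (m ℓm : Level)
             : Set (r ⊔ ℓr ⊔ lsuc (m ⊔ ℓm)) where
  open GradedPoset X
  field
    stalk : Carrier → Module R m ℓm

  module Stalk (x : Carrier) = Module (stalk x)

  field
    res       : ∀ {x y} → .(x < y) → Stalk.Carrierᴹ x → Stalk.Carrierᴹ y
    res-hom   : ∀ {x y} .(x<y : x < y) →
                ModuleMorphisms.IsModuleHomomorphism
                  (Stalk.rawModule x) (Stalk.rawModule y) (res x<y)
    res-trans : ∀ {x y z} .(x<y : x < y) .(y<z : y < z) .(x<z : x < z) a →
                Stalk._≈ᴹ_ z (res y<z (res x<y a)) (res x<z a)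

-- The value at (y , x) is [y:x]; it is meaningful only when x ⋖ y.
Incidence : ∀ {r ℓr} → CommutativeRing r ℓr → GradedPoset → Set r
Incidence R X = Carrier → Carrier → CommutativeRing.Carrier R
  where open GradedPoset X

-- Everything below is classical mathematics over the reals: sums over subsets
-- of a finite poset, suprema and infima use excluded middle.
module Classical (em : ∀ {ℓ} → ExcludedMiddle ℓ) (ℝ : CompleteOrderedField) where

  module ℝ = CompleteOrderedField ℝ
  open ℝ using (0#; 1#; _+_; _*_; _^_; _⁻¹; _÷_; fromℕ; _≈_)
    renaming (Carrier to Real; _≤_ to _≤ᴿ_; _<_ to _<ᴿ_) public

  open AddExtrema _≤ᴿ_ using (_≤±_) public

  -- `True em` moves P to the lowest universe.
  sup : ∀ {p} → Pred Real p → Real ±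
  sup P with em {P = ∃ P} | em {P = ∃ (ℝ.UpperBound P)}
  ... | no _          | _             = ⊥±
  ... | yes _         | no _          = ⊤±
  ... | yes (x , Px)  | yes (b , P≤b) = fin (proj₁ (ℝ.complete
          (λ y → True (em {P = P y})) (x , fromWitness Px) (b , λ Py → P≤b (toWitness Py))))

  -- The supremum of the lower bounds; +∞ for the empty set.
  inf : ∀ {p} → Pred Real p → Real ±
  inf P = sup (λ b → ∀ {x} → P x → b ≤ᴿ x)

  -- Only used on finite values.
  toReal : Real ± → Real
  toReal (fin x) = x
  toReal ⊤±      = 0#
  toReal ⊥±      = 0#

  -- Division with value +∞ when the denominator is 0.
  _÷∞_ : Real → Real → Real ±
  x ÷∞ y with em {P = y ≈ 0#}
  ... | yes _ = ⊤±
  ... | no _  = fin (x ÷ y)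

  extend : ∀ {p a} {P : Set p} {A : Set a} → Dec P → (.P → A) → A → A
  extend (yes p) h _ = h p
  extend (no _)  _ z = z

  module _ (X : GradedPoset) where
    open GradedPoset X

    ∑ : ∀ {c ℓ p} (M : CommutativeMonoid c ℓ) (P : Pred Carrier p) →
        ((x : Carrier) → .(P x) → CommutativeMonoid.Carrier M) →
        CommutativeMonoid.Carrier M
    ∑ M P h = MonoidSum.sum M λ k →
      let x = lookup faces k in extend em (h x) (CommutativeMonoid.ε M)

    ∑ℝ : ∀ {p} (P : Pred Carrier p) → (Carrier → Real) → Real
    ∑ℝ P h = ∑ ℝ.+-commutativeMonoid P (λ x _ → h x)

    # : ∀ {p} → Pred Carrier p → ℕ
    # P = length (filter (λ x → em {P = P x}) faces)

    faceCounts : (i j k : ℤ) → List ℕ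
    faceCounts i j k = List.map (λ (x , z) → # λ y → Faces j y × x ≤ y × y ≤ z)
      (filter (λ (x , z) → em {P = Faces i x × Faces k z × x ≤ z})
        (cartesianProduct faces faces))

    Fmax : (i j k : ℤ) → ℕ
    Fmax i j k = ℕExtrema.max 0 (faceCounts i j k)

    -- No count exceeds the total number of faces.
    Fmin : (i j k : ℤ) → ℕ
    Fmin i j k = ℕExtrema.min (length faces) (faceCounts i j k)

    irregularity : (i j k : ℤ) → Real
    irregularity i j k = fromℕ (Fmax i j k) ÷ fromℕ (Fmin i j k)

    -- The maximum over -1 ≤ i ≤ j ≤ k ≤ d.
    lowerIrregularity : ℕ → Real
    lowerIrregularity d = Extrema.max ℝ.totalOrder 0#
      (List.map (λ (i , j , k) → irregularity i j k)
        (filter (λ (i , j , k) → (i ℤₚ.≤? j) ×-dec (j ℤₚ.≤? k))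
          (cartesianProduct dims (cartesianProduct dims dims))))
      where
      dims : List ℤ
      dims = List.map (λ n → pos n ℤ.- 1ℤ) (upTo (d ℕ.+ 2))

    IsLowerRegular : ℕ → Set
    IsLowerRegular d = lowerIrregularity d ≈ 1#

    weight : (Carrier → Real) → ∀ {p} → Pred Carrier p → Real
    weight w A = ∑ℝ A w

    record IsProperWeight (d : ℕ) (w : Carrier → Real) : Set where
      field
        positive : ∀ x → 0# <ᴿ w x
        total    : weight w (Faces (pos d)) ≈ 1#
        proper   : ∀ x → w x ≈
          ∑ℝ (λ y → Faces (pos d) y × x ≤ y) (λ y → w y ÷ fromℕ (# (FacesOf y (dim x))))

    -- Gr(X,w): hyperedges with two distinct vertices in A.
    IsSkeletonExpanderGr : (Carrier → Real) → (α β : Real) → Set₁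
    IsSkeletonExpanderGr w α β = ∀ (A : Pred Carrier 0ℓ) → A ⊆ Faces 0ℤ →
      weight w (λ e → Faces 1ℤ e × ∃₂ λ x y → A x × A y × x ≢ y × x ≤ e × y ≤ e)
        ≤ᴿ α * weight w A + β * weight w A ^ 2

    -- NIH¹'¹'²(X,w): pairs of edges whose only maximal lower bound is the empty face.
    IsSkeletonExpanderNIH : Carrier → (Carrier → Real) → (α β : Real) → Set₁
    IsSkeletonExpanderNIH ∅ w α β = ∀ (A : Pred Carrier 0ℓ) → A ⊆ Faces 1ℤ →
      weight w (λ z → Faces (pos 2) z × ∃₂ λ x y →
                  A x × A y × x ≢ y × x < z × y < z × Inf (｛ x ｝ ∪ ｛ y ｝) ≐ ｛ ∅ ｝)
        ≤ᴿ α * weight w A + β * weight w A ^ 2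

  record IsOrientation {r ℓr} (R : CommutativeRing r ℓr) (X : GradedPoset)
                       (or : Incidence R X) : Set (r ⊔ ℓr) where
    open GradedPoset X
    module R = CommutativeRing R
    field
      unit  : ∀ {x y} → x ⋖ y → AlgDefs.Invertible R._≈_ R.1# R._*_ (or y x)
      cycle : ∀ {x z} → x ≤ z → dim z ≡ ℤ.suc (ℤ.suc (dim x)) →
              ∑ X R.+-commutativeMonoid (λ y → x < y × y < z) (λ y _ → or z y R.* or y x)
                R.≈ R.0#

  module _ (X : GradedPoset) (z : GradedPoset.Carrier X) where
    open GradedPoset X

    LinkFace : Set
    LinkFace = [ x ∈ Carrier ∣ z ≤ x ]

    above : List Carrier → List LinkFace
    above []       = []
    above (x ∷ xs) with em {P = z ≤ x}
    ... | yes z≤x = (x , [ z≤x ]) ∷ above xs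
    ... | no  _   = above xs

    private
      ∈-above : ∀ {xs} (v : LinkFace) → value v ∈ xs → v ∈ above xs
      ∈-above {x ∷ _} v m with em {P = z ≤ x}
      ∈-above v (here refl) | yes _ = here (value-injective refl)
      ∈-above v (there m)   | yes _ = there (∈-above v m)
      ∈-above (_ , [ p ]) (here refl) | no z≰x = contradiction-irr p z≰x
      ∈-above v (there m)   | no _  = ∈-above v m

      All-above : ∀ {x} (p : z ≤ x) xs → All (x ≢_) xs → All ((x , [ p ]) ≢_) (above xs)
      All-above p []       []       = []
      All-above p (y ∷ xs) (n ∷ ns) with em {P = z ≤ y}
      ... | yes _ = (n ∘ cong value) ∷ All-above p xs ns
      ... | no  _ = All-above p xs ns

      Unique-above : ∀ xs → Unique xs → Unique (above xs)
      Unique-above []       []       = []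
      Unique-above (x ∷ xs) (n ∷ ns) with em {P = z ≤ x}
      ... | yes p = All-above p xs n ∷ Unique-above xs ns
      ... | no  _ = Unique-above xs ns

      value-< : ∀ {x y : LinkFace} → value x ≤ value y × x ≢ y → value x < value y
      value-< (x≤y , x≢y) = x≤y , x≢y ∘ value-injective

    link : GradedPoset
    link = record
      { Carrier        = LinkFace
      ; _≤_            = λ x y → value x ≤ value y
      ; isPartialOrder = record
        { isPreorder = record
          { isEquivalence = isEquivalence
          ; reflexive     = λ { refl → ≤-refl }
          ; trans         = ≤-trans
          }
        ; antisym = λ x≤y y≤x → value-injective (≤-antisym x≤y y≤x)
        }
      ; faces          = above faces
      ; faces-complete = λ v → ∈-above v (faces-complete (value v))
      ; faces-unique   = Unique-above faces faces-unique
      ; dim            = λ x → dim (value x) ℤ.- dim z ℤ.- 1ℤ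
      ; dim-mono       = λ x≤y → ℤₚ.+-monoˡ-≤ _ (ℤₚ.+-monoˡ-≤ _ (dim-mono x≤y))
      ; dim-⋖          = dim-⋖-link
      }
      where
      shift : ∀ {a b : ℤ} → b ≡ ℤ.suc a →
              b ℤ.- dim z ℤ.- 1ℤ ≡ ℤ.suc (a ℤ.- dim z ℤ.- 1ℤ)
      shift {a} refl = trans (cong (ℤ._- 1ℤ) (ℤₚ.+-assoc 1ℤ a (ℤ.- dim z)))
                             (ℤₚ.+-assoc 1ℤ (a ℤ.- dim z) (ℤ.- 1ℤ))

      dim-⋖-link : ∀ {x y : LinkFace} →
        (value x ≤ value y × x ≢ y) ×
          ¬ (∃ λ t → (value x ≤ value t × x ≢ t) × (value t ≤ value y × t ≢ y)) →
        dim (value y) ℤ.- dim z ℤ.- 1ℤ ≡ ℤ.suc (dim (value x) ℤ.- dim z ℤ.- 1ℤ)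
      dim-⋖-link {x , [ p ]} (x<y , none) = shift {dim x} (dim-⋖
        ( value-< x<y
        , λ { (t , (x≤t , x≢t) , (t≤y , t≢y)) → none
                ((t , [ ≤-trans p x≤t ]) , (x≤t , x≢t ∘ cong value) , (t≤y , t≢y ∘ cong value)) }))

    linkWeight : ℕ → (Carrier → Real) → LinkFace → Real
    linkWeight d w (x , _) =
      weight X w (λ y → Faces (pos d) y × z ≤ y) ⁻¹ *
      ∑ℝ X (λ y → Faces (pos d) y × x ≤ y)
           (λ y → w y ÷ fromℕ (# X λ x′ → Faces (dim x) x′ × z ≤ x′ × x′ ≤ y))

    linkIncidence : ∀ {r ℓr} {R : CommutativeRing r ℓr} → Incidence R X → Incidence R link
    linkIncidence or y x = or (value y) (value x)

    linkSheaf : ∀ {r ℓr m ℓm} {R : CommutativeRing r ℓr} →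
                Sheaf R X m ℓm → Sheaf R link m ℓm
    linkSheaf 𝓕 = record
      { stalk     = stalk ∘ value
      ; res       = λ x<y → res (value-< x<y)
      ; res-hom   = λ x<y → res-hom (value-< x<y)
      ; res-trans = λ x<y y<z x<z → res-trans (value-< x<y) (value-< y<z) (value-< x<z)
      }
      where open Sheaf 𝓕

  module Cochains {r ℓr m ℓm} {R : CommutativeRing r ℓr} (X : GradedPoset)
                  (or : Incidence R X) (𝓕 : Sheaf R X m ℓm) where
    open GradedPoset X
    open Sheaf 𝓕

    C : ℤ → Set m
    C i = ∀ x → .(Faces i x) → Stalk.Carrierᴹ x

    infixl 6 _+ᶜ_ _-ᶜ_

    _+ᶜ_ : ∀ {i} → C i → C i → C i
    (f +ᶜ g) x p = Stalk._+ᴹ_ x (f x p) (g x p)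

    _-ᶜ_ : ∀ {i} → C i → C i → C i
    (f -ᶜ g) x p = Stalk._+ᴹ_ x (f x p) (Stalk.-ᴹ_ x (g x p))

    private
      face-< : ∀ {i x y} → FacesOf y i x → Faces (ℤ.suc i) y → x < y
      face-< (dx , x≤y) dy =
        x≤y , λ x≡y → ℤₚ.i≢suc[i] (trans (sym dx) (trans (cong dim x≡y) dy))

    d : ∀ {i} → C i → C (ℤ.suc i)
    d {i} f y p = ∑ X (Stalk.+ᴹ-commutativeMonoid y) (FacesOf y i)
      λ x q → Stalk._*ₗ_ y (or y x) (res (face-< q p) (f x (proj₁ q)))

    Z : ∀ {i} → Pred (C i) ℓm
    Z f = ∀ y .p → Stalk._≈ᴹ_ y (d f y p) (Stalk.0ᴹ y)

    B : ∀ {i} → Pred (C i) (m ⊔ ℓm)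
    B {i} f = ∃ λ (g : C (ℤ.pred i)) → ∀ y .p →
      Stalk._≈ᴹ_ y (f y p) (d g y (trans p (sym (ℤₚ.suc-pred i))))

    Support : ∀ {i} → C i → Pred Carrier ℓm
    Support {i} f x = Σ (Faces i x) λ p → ¬ Stalk._≈ᴹ_ x (f x p) (Stalk.0ᴹ x)

    module _ (w : Carrier → Real) where

      norm : ∀ {i} → C i → Real
      norm f = weight X w (Support f)

      dist : ∀ {i} → C i → C i → Real
      dist f g = norm (f -ᶜ g)

      -- The infimum over g ∈ P of dist f g, for nonempty P.
      distTo : ∀ {i p} → C i → Pred (C i) p → Real
      distTo f P = toReal (inf λ t → ∃ λ g → P g × t ≈ dist f g)

      cse : ℤ → Real ±
      cse i = sup λ μ → 0# ≤ᴿ μ × (∀ (f : C i) → μ * distTo f Z ≤ᴿ norm (d f))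

      cbe : ℤ → Real ±
      cbe i = sup λ μ → 0# ≤ᴿ μ × (∀ (f : C i) → μ * distTo f B ≤ᴿ norm (d f))

      ccd : ℤ → Real ±
      ccd i = inf λ t → ∃ λ (f : C i) → Z f × ¬ B f × t ≈ norm f

  module _ {r ℓr m ℓm} {R : CommutativeRing r ℓr} (X : GradedPoset)
           (or : Incidence R X) (𝓕 : Sheaf R X m ℓm) where
    open GradedPoset X
    open Cochains X or 𝓕
    module Lk (u : Carrier) = Cochains (link X u) (linkIncidence X u {R = R} or) (linkSheaf X u 𝓕)

    -- The cochain written gᵘ.
    extendByZero : ∀ {k} u → Lk.C u (k ℤ.- dim u ℤ.- 1ℤ) → C k
    extendByZero u g x p = extend (em {P = u ≤ x})
      (λ u≤x → g (x , [ u≤x ]) (cong (λ i → i ℤ.- dim u ℤ.- 1ℤ) p))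
      (Sheaf.Stalk.0ᴹ 𝓕 x)

    -- One iteration of the Correction Algorithm; a relation, since its choices are
    -- not specified.
    data Correction (w : Carrier → Real) (k : ℤ) (q : Real) (f : C k) : C k → Set m where
      correct : ∀ u (g : Lk.C u (k ℤ.- dim u ℤ.- 1ℤ)) →
                0ℤ ℤ.≤ dim u → dim u ℤ.≤ k →
                norm w (d f +ᶜ d (extendByZero {k} u g)) <ᴿ norm w (d f) ℝ.- q * w u →
                Correction w k q f (f +ᶜ extendByZero {k} u g)

    -- However the choices are made, the algorithm stops, with an output satisfying P.
    CorrectionReturns : ∀ {p} → (Carrier → Real) → (k : ℤ) → Real → C k → Pred (C k) p →
                        Set (m ⊔ p)
    CorrectionReturns w k q f P =
      Acc (flip (Correction w k q)) f ×
      (∀ f′ → Star (Correction w k q) f f′ → IsNormalForm (Correction w k q) f′ → P f′)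

  record Constants : Set where
    constructor mkConstants
    field
      E E′ E″ E‴ D D′ D″ : Real

  AllPositive : Constants → Set
  AllPositive c = 0# <ᴿ E × 0# <ᴿ E′ × 0# <ᴿ E″ × 0# <ᴿ E‴ ×
                  0# <ᴿ D × 0# <ᴿ D′ × 0# <ᴿ D″
    where open Constants c

  -- The hypotheses imply the conclusions with the constants c, for X in the class 𝒦.
  ConstantsWork : (r ℓr m ℓm : Level) → ℕ → Real → Constants →
                  (𝒦 : (d : ℕ) → GradedPoset → Set) → Set (lsuc (r ⊔ ℓr ⊔ m ⊔ ℓm))
  ConstantsWork r ℓr m ℓm F L c 𝒦 =
    ∀ (R : CommutativeRing r ℓr) (d : ℕ) → 2 ℕ.≤ d →
    ∀ (X : GradedPoset) (isDPoset : IsDPoset d X) → 𝒦 d X →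
    let open GradedPoset X in
    ∀ (w : Carrier → Real) → IsProperWeight X d w →
    ∀ (or : Incidence R X) → IsOrientation R X or →
    lowerIrregularity X d ≤ᴿ L →
    Fmax X -1ℤ 0ℤ (pos 2) ℕ.≤ F → Fmax X -1ℤ 1ℤ (pos 2) ℕ.≤ F →
    ∀ (𝓕 : Sheaf R X m ℓm) →
    let cbeLink = λ z → Cochains.cbe (link X z) (linkIncidence X z {R = R} or)
                                     (linkSheaf X z 𝓕) (linkWeight X z d w)
        open Cochains X or 𝓕 renaming (d to δ)
    in
    ∀ (ε ε′ : Real) → 0# <ᴿ ε → 0# <ᴿ ε′ →
    ∀ (α₀ β₀ α₋₁ β₋₁ α∥ β∥ : Real) →
    0# ≤ᴿ α₀ → 0# ≤ᴿ β₀ → 0# ≤ᴿ α₋₁ → 0# ≤ᴿ β₋₁ → 0# ≤ᴿ α∥ → 0# ≤ᴿ β∥ →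
    (∀ v → Faces 0ℤ v → fin ε  ≤± cbeLink v -1ℤ) →
    (∀ e → Faces 1ℤ e → fin ε′ ≤± cbeLink e -1ℤ) →
    (∀ v → Faces 0ℤ v → fin ε′ ≤± cbeLink v 0ℤ) →
    (∀ v → Faces 0ℤ v → IsSkeletonExpanderGr (link X v) (linkWeight X v d w) α₀ β₀) →
    IsSkeletonExpanderGr X w α₋₁ β₋₁ →
    IsSkeletonExpanderNIH X (IsDPoset.∅ isDPoset) w α∥ β∥ →
    α₋₁ <ᴿ E * ε →
    ∀ (h₋₁ h₀ h∥ : Real) →
    0# <ᴿ h₋₁ → h₋₁ ≤ᴿ 1# → 0# <ᴿ h₀ → h₀ ≤ᴿ 1# → 0# <ᴿ h∥ → h∥ ≤ᴿ 1# →
    (α₀ + β₀ * h₀) + (α∥ + β∥ * h∥) + (α₋₁ + β₋₁ * h₋₁) ÷ h₀ ≤ᴿ E′ * ε′ →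
    let H = h₀ ⁻¹ * h₋₁ ⁻¹ + h∥ ⁻¹ in
    (fin (E″ ÷ H) ≤± cse w 0ℤ) ×
    (((E‴ * (E * ε ℝ.- α₋₁)) ÷∞ β₋₁) ≤± ccd w 0ℤ) ×
    (∀ (f : C 0ℤ) → distTo w f Z <ᴿ D ÷ H →
      CorrectionReturns X or 𝓕 w 0ℤ (D′ * h₀) f (λ f′ →
        Z f′ × dist w f f′ ≤ᴿ (1# ÷ (D″ * h₀)) * distTo w f Z))
    where open Constants c

  infix 8 _⁻^_

  _⁻^_ : Real → ℕ → Real
  x ⁻^ n = (x ^ n) ⁻¹

  ½ ¼ ⅛ : Real
  ½ = fromℕ 2 ⁻¹
  ¼ = fromℕ 4 ⁻¹
  ⅛ = fromℕ 8 ⁻¹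

  generalConstants : Real → Real → Constants
  generalConstants L F = mkConstants
    (L ⁻^ 8) (¼ * L ⁻^ 18 * F ⁻^ 5) (½ * L ⁻^ 13 * F ⁻^ 2) (L ⁻^ 3)
    (L ⁻^ 15 * F ⁻¹) (¼ * L ⁻^ 12 * F ⁻^ 2) (¼ * L ⁻^ 16 * F ⁻^ 3)

  lowerRegularConstants : Real → Constants
  lowerRegularConstants F = mkConstants
    1# (¼ * F ⁻^ 2) (½ * F ⁻¹) 1# (F ⁻¹) (¼ * F ⁻¹) (¼ * F ⁻^ 2)

  simplicialConstants cubeConstants : Constants
  simplicialConstants = mkConstants 1# (fromℕ 12 ⁻¹) ½ 1# ½ ¼ ⅛
  cubeConstants       = mkConstants 1# (fromℕ 16 ⁻¹) ½ 1# ½ ¼ ⅛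

  polygonConstants : Real → ℕ → Constants
  polygonConstants L m = mkConstants
    (L ⁻^ 8) ((fromℕ 4 * fromℕ m) ⁻¹ * L ⁻^ 18) (½ * L ⁻^ 13) (L ⁻^ 3)
    (½ * L ⁻^ 15) (¼ * L ⁻^ 12) (⅛ * L ⁻^ 16)

-- Let f′ be an output of the algorithm, g = d f′ and A = supp g.  Call a vertex u heavy if A has
-- weight at least h₀ in the link of u.  An edge of A without heavy vertices lies, by (1b) and
-- d g = 0, in many 2-faces containing a second edge of A.  At a heavy vertex u, (1c) and the fact
-- that no correction at u pays off give many 2-faces on which the restriction of g to the link of u
-- has nonzero coboundary; since d g = 0, such a 2-face contains an edge of A through u and one
-- avoiding u.  In all these 2-faces two edges of A are disjoint, or meet in a light vertex, or one
-- of them joins two heavy vertices.  The skeleton expansion of NIH(X), of the links of light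
-- vertices and of Gr(X) bounds the weight of the three kinds by small multiples of w(A), so that
-- A is empty as soon as w(A) is small.
--
-- Weights in X and in its links are compared by double counting; every comparison costs a factor
-- μ = Λ³, where Λ bounds the irregularity of X.

module Submission where

open import Algebra.Bundles using (CommutativeMonoid; CommutativeRing)
open import Algebra.Module.Bundles using (Module)
open import Algebra.Module.Morphism.Structures using (module ModuleMorphisms)
import Algebra.Properties.CommutativeMonoid.Sum as MonoidSum
import Algebra.Properties.Group as GroupProperties
import Algebra.Properties.Ring as RingProperties
import Algebra.Properties.Semiring.Exp as SemiringExp
import Algebra.Properties.Semiring.Mult as SemiringMult
import Algebra.Solver.Ring.NaturalCoefficients.Default as RingSolver
open import Axiom.ExcludedMiddle using (ExcludedMiddle)
open import Data.Bool.Base using (true; false)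
open import Data.Empty using (⊥-elim; ⊥-elim-irr)
open import Data.Fin.Subset as Subset using (Subset)
open import Data.Fin.Subset.Properties using (drop-∷-⊆; s⊆s; out⊆; p⊆q⇒∣p∣≤∣q∣)
open import Data.Integer.Base as ℤ using (ℤ; 0ℤ; 1ℤ; -1ℤ) renaming (+_ to pos)
import Data.Integer.Properties as ℤₚ
import Data.Integer.Tactic.RingSolver as ℤSolver
open import Data.Irrelevant using ([_])
open import Data.List.Base as List using (List; []; _∷_; lookup; filter; length; cartesianProduct; upTo; _++_)
import Data.List.Extrema as Extrema
import Data.List.Extrema.Nat as ℕExtrema
open import Data.List.Membership.Propositional using (_∈_)
open import Data.List.Membership.Propositional.Properties
  using (∈-map⁺; ∈-map⁻; ∈-filter⁺; ∈-filter⁻; ∈-cartesianProduct⁺; ∈-upTo⁺; ∈-++⁺ˡ; ∈-++⁺ʳ; ∈-++⁻; ∈-allFin)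
open import Data.List.Membership.Propositional.Properties.WithK using (unique∧set⇒bag)
open import Data.List.Properties using (length-map; length-++; length-tabulate)
open import Data.List.Relation.Binary.BagAndSetEquality using (∼bag⇒↭)
open import Data.List.Relation.Binary.Disjoint.Propositional using () renaming (Disjoint to DisjointLists)
open import Data.List.Relation.Binary.Permutation.Propositional.Properties using (↭-length)
open import Data.List.Relation.Unary.All as All using (All; []; _∷_)
open import Data.List.Relation.Unary.AllPairs using ([]; _∷_)
open import Data.List.Relation.Unary.Any using (here; there)
open import Data.List.Relation.Unary.Unique.Propositional using (Unique)
import Data.List.Relation.Unary.Unique.Propositional.Properties as Unique
open import Data.Maybe.Base using (just; nothing)
open import Data.Nat.Base as ℕ using (ℕ; zero; suc)
import Data.Nat.Properties as ℕₚ
open import Data.Product.Base using (Σ; ∃; ∃₂; _×_; _,_; proj₁; proj₂)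
open import Data.Refinement using (_,_; value)
open import Data.Sum.Base using (_⊎_; inj₁; inj₂; [_,_]′)
open import Data.Unit.Base using (⊤; tt)
open import Data.Vec.Base as Vecs using (Vec)
open import Data.Vec.Relation.Binary.Pointwise.Inductive using ([]; _∷_)
open import Function.Base using (_∘_; flip; id)
open import Function.Bundles using (mk⇔; Equivalence)
open import Induction.WellFounded using (Acc; acc)
open import Level using (Level; 0ℓ)
open import Relation.Binary.Bundles using (TotalOrder)
import Relation.Binary.Construct.Add.Extrema.NonStrict as AddExtrema
import Relation.Binary.Construct.Add.Supremum.NonStrict as AddSupremum
open import Relation.Binary.Construct.Closure.ReflexiveTransitive using (Star; _◅_) renaming (ε to ε⋆)
import Relation.Binary.Construct.NonStrictToStrict as ToStrict
open import Relation.Binary.Core using (Rel)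
open import Relation.Binary.PropositionalEquality as ≡ using (_≡_; _≢_)
import Relation.Binary.Reasoning.PartialOrder as PartialOrderReasoning
open import Relation.Binary.Rewriting using (IsNormalForm)
open import Relation.Nullary using (¬_; Dec; yes; no)
open import Relation.Nullary.Construct.Add.Extrema using (⊤±) renaming ([_] to fin)
open import Relation.Nullary.Decidable using (True; fromWitness; toWitness; recompute; _×-dec_)
open import Relation.Unary using (Pred; _∪_; _≐_; ｛_｝)
open import Defs

module OrderedField (ℝ : CompleteOrderedField) where
  open CompleteOrderedField ℝ
  open CommutativeRing commutativeRing public
    using () renaming (refl to ≈-refl; sym to ≈-sym; trans to ≈-trans; reflexive to ≈-reflexive)
  open TotalOrder totalOrder public
    using (antisym; total; poset)
    renaming (refl to ≤-refl; reflexive to ≤-reflexive; trans to ≤-trans)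
  open ToStrict _≈_ _≤_ public using (<⇒≤)
  open RingProperties ring using (-‿distribˡ-*; -‿involutive)
  open SemiringMult semiring using (×1-homo-*)
  open RingSolver commutativeSemiring public
    using (solve; _:+_; _:*_; _:=_; con)
  open PartialOrderReasoning poset public

  ≰⇒> : ∀ {x y} → ¬ x ≤ y → y < x
  ≰⇒> = ToStrict.≰⇒> _≈_ _≤_ ≈-sym ≤-reflexive total

  <⇒≱ : ∀ {x y} → x < y → ¬ y ≤ x
  <⇒≱ = ToStrict.<⇒≱ _≈_ _≤_ antisym

  <-≤-trans : ∀ {x y z} → x < y → y ≤ z → x < z
  <-≤-trans = ToStrict.<-≤-trans _≈_ _≤_ ≈-sym ≤-trans antisym (λ y≈z x≤y → ≤-trans x≤y (≤-reflexive y≈z))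

  ≤-<-trans : ∀ {x y z} → x ≤ y → y < z → x < z
  ≤-<-trans = ToStrict.≤-<-trans _≈_ _≤_ ≤-trans antisym (λ y≈z y≤x → ≤-trans (≤-reflexive (≈-sym y≈z)) y≤x)

  ≤-resp : ∀ {x x′ y y′} → x ≈ x′ → y ≈ y′ → x ≤ y → x′ ≤ y′
  ≤-resp x≈ y≈ x≤y = ≤-trans (≤-reflexive (≈-sym x≈)) (≤-trans x≤y (≤-reflexive y≈))

  +-monoˡ-≤ : ∀ x {y z} → y ≤ z → y + x ≤ z + x
  +-monoˡ-≤ x y≤z = ≤-resp (+-comm _ _) (+-comm _ _) (+-monoʳ-≤ x y≤z)

  +-mono-≤ : ∀ {x y u v} → x ≤ y → u ≤ v → x + u ≤ y + v
  +-mono-≤ x≤y u≤v = ≤-trans (+-monoˡ-≤ _ x≤y) (+-monoʳ-≤ _ u≤v)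

  x+y-y≈x : ∀ x y → (x + y) - y ≈ x
  x+y-y≈x x y = ≈-trans (+-assoc _ _ _) (≈-trans (+-congˡ (-‿inverseʳ y)) (+-identityʳ x))

  x-y+y≈x : ∀ x y → (x - y) + y ≈ x
  x-y+y≈x x y = ≈-trans (+-assoc _ _ _) (≈-trans (+-congˡ (-‿inverseˡ y)) (+-identityʳ x))

  +-cancelʳ-≤ : ∀ z {x y} → x + z ≤ y + z → x ≤ y
  +-cancelʳ-≤ z x+z≤y+z = ≤-resp (x+y-y≈x _ z) (x+y-y≈x _ z) (+-monoˡ-≤ (- z) x+z≤y+z)

  +-cancelˡ-≤ : ∀ z {x y} → z + x ≤ z + y → x ≤ y
  +-cancelˡ-≤ z = +-cancelʳ-≤ z ∘ ≤-resp (+-comm _ _) (+-comm _ _)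

  x-y≤z⇒x≤z+y : ∀ {x y z} → x - y ≤ z → x ≤ z + y
  x-y≤z⇒x≤z+y {x} {y} h = ≤-trans (≤-reflexive (≈-sym (x-y+y≈x x y))) (+-monoˡ-≤ y h)

  x≤z+y⇒x-y≤z : ∀ {x y z} → x ≤ z + y → x - y ≤ z
  x≤z+y⇒x-y≤z {x} {y} h = ≤-trans (+-monoˡ-≤ (- y) h) (≤-reflexive (x+y-y≈x _ y))

  x≤y⇒0≤y-x : ∀ {x y} → x ≤ y → 0# ≤ y - x
  x≤y⇒0≤y-x {x} h = ≤-resp (-‿inverseʳ x) ≈-refl (+-monoˡ-≤ (- x) h)

  *-left-comm : ∀ x y z → x * (y * z) ≈ y * (x * z)
  *-left-comm = solve 3 (λ x y z → x :* (y :* z) := y :* (x :* z)) ≈-refl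

  *-monoʳ-≤ : ∀ {x y z} → 0# ≤ x → y ≤ z → x * y ≤ x * z
  *-monoʳ-≤ {x} {y} {z} 0≤x y≤z = begin
    x * y                ≈⟨ +-identityʳ _ ⟨
    x * y + 0#           ≤⟨ +-monoʳ-≤ _ (*-nonNeg 0≤x (x≤y⇒0≤y-x y≤z)) ⟩
    x * y + x * (z - y)  ≈⟨ distribˡ x y (z - y) ⟨
    x * (y + (z - y))    ≈⟨ *-congˡ (≈-trans (+-comm _ _) (x-y+y≈x z y)) ⟩
    x * z                ∎

  *-monoˡ-≤ : ∀ {x y z} → 0# ≤ x → y ≤ z → y * x ≤ z * x
  *-monoˡ-≤ 0≤x = ≤-resp (*-comm _ _) (*-comm _ _) ∘ *-monoʳ-≤ 0≤x

  *-mono-≤ : ∀ {x y u v} → 0# ≤ x → 0# ≤ v → x ≤ y → u ≤ v → x * u ≤ y * v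
  *-mono-≤ 0≤x 0≤v x≤y u≤v = ≤-trans (*-monoʳ-≤ 0≤x u≤v) (*-monoˡ-≤ 0≤v x≤y)

  x≤x*y : ∀ {x y} → 0# ≤ x → 1# ≤ y → x ≤ x * y
  x≤x*y 0≤x 1≤y = ≤-resp (*-identityʳ _) ≈-refl (*-monoʳ-≤ 0≤x 1≤y)

  x*y≤x : ∀ {x y} → 0# ≤ x → y ≤ 1# → x * y ≤ x
  x*y≤x 0≤x y≤1 = ≤-resp ≈-refl (*-identityʳ _) (*-monoʳ-≤ 0≤x y≤1)

  0≤1 : 0# ≤ 1#
  0≤1 with total 0# 1#
  ... | inj₁ h = h
  ... | inj₂ h = ≤-resp ≈-refl -1*-1≈1 (*-nonNeg 0≤-1 0≤-1)
    where
    0≤-1 : 0# ≤ - 1#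
    0≤-1 = ≤-resp ≈-refl (+-identityˡ _) (x≤y⇒0≤y-x h)
    -1*-1≈1 : - 1# * - 1# ≈ 1#
    -1*-1≈1 = ≈-trans (≈-sym (-‿distribˡ-* 1# (- 1#)))
                      (≈-trans (-‿cong (*-identityˡ _)) (-‿involutive 1#))

  0<1 : 0# < 1#
  0<1 = 0≤1 , 0≉1

  <⇒≉0 : ∀ {x} → 0# < x → ¬ x ≈ 0#
  <⇒≉0 (_ , 0≉x) = 0≉x ∘ ≈-sym

  1≤⇒0< : ∀ {x} → 1# ≤ x → 0# < x
  1≤⇒0< = <-≤-trans 0<1

  *-inverseˡ : ∀ {x} → 0# < x → x ⁻¹ * x ≈ 1#
  *-inverseˡ 0<x = ≈-trans (*-comm _ _) (*-inverseʳ (<⇒≉0 0<x))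

  *-inverseʳ⁺ : ∀ {x} → 0# < x → x * x ⁻¹ ≈ 1#
  *-inverseʳ⁺ 0<x = *-inverseʳ (<⇒≉0 0<x)

  *-pos : ∀ {x y} → 0# < x → 0# < y → 0# < x * y
  *-pos {x} {y} 0<x 0<y = *-nonNeg (<⇒≤ 0<x) (<⇒≤ 0<y) , λ 0≈xy → <⇒≉0 0<y (begin-equality
    y                ≈⟨ *-identityˡ y ⟨
    1# * y           ≈⟨ *-congʳ (*-inverseˡ 0<x) ⟨
    x ⁻¹ * x * y     ≈⟨ *-assoc _ _ _ ⟩
    x ⁻¹ * (x * y)   ≈⟨ *-congˡ 0≈xy ⟨
    x ⁻¹ * 0#        ≈⟨ zeroʳ _ ⟩
    0#               ∎)

  ⁻¹-pos : ∀ {x} → 0# < x → 0# < x ⁻¹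
  ⁻¹-pos {x} 0<x = ≰⇒> λ x⁻¹≤0 → <⇒≱ 0<1
    (≤-resp (*-inverseʳ⁺ 0<x) (zeroʳ x) (*-monoʳ-≤ (<⇒≤ 0<x) x⁻¹≤0))

  *-cancelˡ-≤ : ∀ {x y z} → 0# < x → x * y ≤ x * z → y ≤ z
  *-cancelˡ-≤ {x} 0<x h = ≤-resp (cancel _) (cancel _) (*-monoʳ-≤ (<⇒≤ (⁻¹-pos 0<x)) h)
    where
    cancel : ∀ y → x ⁻¹ * (x * y) ≈ y
    cancel y = ≈-trans (≈-sym (*-assoc _ _ _)) (≈-trans (*-congʳ (*-inverseˡ 0<x)) (*-identityˡ y))

  *-monoʳ-< : ∀ {x y z} → 0# < x → y < z → x * y < x * z
  *-monoʳ-< 0<x y<z = ≰⇒> λ h → <⇒≱ y<z (*-cancelˡ-≤ 0<x h)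

  +-monoʳ-< : ∀ x {y z} → y < z → x + y < x + z
  +-monoʳ-< x y<z = ≰⇒> λ h → <⇒≱ y<z (+-cancelˡ-≤ x h)

  x≤y*z⇒x*y⁻¹≤z : ∀ {x y z} → 0# < y → x ≤ z * y → x * y ⁻¹ ≤ z
  x≤y*z⇒x*y⁻¹≤z {x} {y} {z} 0<y h = *-cancelˡ-≤ 0<y (begin
    y * (x * y ⁻¹)   ≈⟨ *-left-comm y x (y ⁻¹) ⟩
    x * (y * y ⁻¹)   ≈⟨ *-congˡ (*-inverseʳ⁺ 0<y) ⟩
    x * 1#           ≈⟨ *-identityʳ x ⟩
    x                ≤⟨ h ⟩
    z * y            ≈⟨ *-comm _ _ ⟩
    y * z            ∎)

  x*y≤z⇒x≤z*y⁻¹ : ∀ {x y z} → 0# < y → x * y ≤ z → x ≤ z * y ⁻¹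
  x*y≤z⇒x≤z*y⁻¹ {x} {y} {z} 0<y h = *-cancelˡ-≤ 0<y (begin
    y * x            ≈⟨ *-comm _ _ ⟩
    x * y            ≤⟨ h ⟩
    z                ≈⟨ *-identityʳ z ⟨
    z * 1#           ≈⟨ *-congˡ (*-inverseʳ⁺ 0<y) ⟨
    z * (y * y ⁻¹)   ≈⟨ *-left-comm y z (y ⁻¹) ⟨
    y * (z * y ⁻¹)   ∎)

  0≤fromℕ : ∀ n → 0# ≤ fromℕ n
  0≤fromℕ zero    = ≤-refl
  0≤fromℕ (suc n) = ≤-resp (+-identityˡ _) ≈-refl (+-mono-≤ 0≤1 (0≤fromℕ n))

  fromℕ-mono : ∀ {m n} → m ℕ.≤ n → fromℕ m ≤ fromℕ n
  fromℕ-mono {n = n} ℕ.z≤n = 0≤fromℕ n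
  fromℕ-mono (ℕ.s≤s h)     = +-monoʳ-≤ 1# (fromℕ-mono h)

  1≤fromℕ-suc : ∀ n → 1# ≤ fromℕ (suc n)
  1≤fromℕ-suc n = ≤-resp (+-identityʳ 1#) ≈-refl (fromℕ-mono {1} {suc n} (ℕ.s≤s ℕ.z≤n))

  0<fromℕ-suc : ∀ n → 0# < fromℕ (suc n)
  0<fromℕ-suc n = 1≤⇒0< (1≤fromℕ-suc n)

  fromℕ-1 : fromℕ 1 ≈ 1#
  fromℕ-1 = +-identityʳ 1#

  1≤fromℕ : ∀ {n} → 1 ℕ.≤ n → 1# ≤ fromℕ n
  1≤fromℕ h = ≤-resp fromℕ-1 ≈-refl (fromℕ-mono h)

  fromℕ-pos : ∀ {n} → 1 ℕ.≤ n → 0# < fromℕ n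
  fromℕ-pos = 1≤⇒0< ∘ 1≤fromℕ

  fromℕ-* : ∀ m n → fromℕ (m ℕ.* n) ≈ fromℕ m * fromℕ n
  fromℕ-* = ×1-homo-*

module Suprema (em : ∀ {ℓ} → ExcludedMiddle ℓ) (ℝ : CompleteOrderedField) where
  open Classical em ℝ hiding (module ℝ)
  open CompleteOrderedField ℝ using (_-_; UpperBound; complete)
  private module ℝ = CompleteOrderedField ℝ
  open OrderedField ℝ
  open AddExtrema _≤ᴿ_ using (_≤⊤±) renaming ([_] to [_]±)

  by-contradiction : ∀ {p} {P : Set p} → ¬ ¬ P → P
  by-contradiction {P = P} ¬¬p with em {P = P}
  ... | yes p = p
  ... | no ¬p = ⊥-elim (¬¬p ¬p)

  ∈⇒≤sup : ∀ {p} {P : Pred Real p} {x} → P x → fin x ≤± sup P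
  ∈⇒≤sup {P = P} {x} Px with em {P = ∃ P} | em {P = ∃ (UpperBound P)}
  ... | no ∄       | _      = ⊥-elim (∄ (x , Px))
  ... | yes _      | no _   = fin x ≤⊤±
  ... | yes (y , Py) | yes (b , P≤b) =
    [ proj₁ (proj₂ (complete (λ y → True (em {P = P y})) (y , fromWitness Py)
                             (b , λ Py → P≤b (toWitness Py)))) (fromWitness Px) ]±

  ⊤≤inf-∅ : ∀ {p} {P : Pred Real p} → (∀ {x} → ¬ P x) → ⊤± ≤± inf P
  ⊤≤inf-∅ {P = P} ∄ with em {P = ∃ λ b → ∀ {x} → P x → b ≤ᴿ x}
                         | em {P = ∃ (UpperBound (λ b → ∀ {x} → P x → b ≤ᴿ x))}
  ... | no h  | _           = ⊥-elim (h (0# , λ Px → ⊥-elim (∄ Px)))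
  ... | yes _ | no _        = ⊤± ≤⊤±
  ... | yes _ | yes (b , h) = ⊥-elim (<⇒≱ 0<1 (+-cancelˡ-≤ b
          (≤-resp ≈-refl (≈-sym (ℝ.+-identityʳ b)) (h {b + 1#} λ Px → ⊥-elim (∄ Px)))))

  module _ {p} {P : Pred Real p} {c} (c≤P : ∀ {x} → P x → c ≤ᴿ x) {t} (Pt : P t) where

    inf-finite : ∃ λ s → inf P ≡ fin s × (∀ {x} → P x → s ≤ᴿ x) ×
                   (∀ {b} → (∀ {x} → P x → b ≤ᴿ x) → b ≤ᴿ s)
    inf-finite with em {P = ∃ λ b → ∀ {x} → P x → b ≤ᴿ x}
                  | em {P = ∃ (UpperBound (λ b → ∀ {x} → P x → b ≤ᴿ x))}
    ... | no ∄ | _ = ⊥-elim (∄ (c , c≤P))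
    ... | yes _ | no ∄ = ⊥-elim (∄ (t , λ b≤P → b≤P Pt))
    ... | yes (b , b≤P) | yes (u , P≤u) = s , ≡.refl ,
          (λ {x} Px → s-least x λ b∈ → toWitness b∈ Px) , λ b≤P → s-upper (fromWitness λ {x} → b≤P {x})
      where
      least = complete (λ y → True (em {P = ∀ {x} → P x → y ≤ᴿ x}))
                (b , fromWitness λ {x} → b≤P {x}) (u , λ Py → P≤u (toWitness Py))
      s = proj₁ least
      s-upper = proj₁ (proj₂ least)
      s-least = proj₂ (proj₂ least)

    inf-≤ : ∀ {x} → P x → toReal (inf P) ≤ᴿ x
    inf-≤ with inf-finite
    ... | s , eq , lower , _ rewrite eq = lower

    inf-greatest : ∀ {b} → (∀ {x} → P x → b ≤ᴿ x) → b ≤ᴿ toReal (inf P)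
    inf-greatest with inf-finite
    ... | s , eq , _ , greatest rewrite eq = greatest

  slope-≤sup : ∀ {a} {A : Set a} (D N : A → Real) → (∀ f → 0# ≤ᴿ D f) → ∀ {ε} →
               fin ε ≤± sup (λ μ → 0# ≤ᴿ μ × (∀ f → μ * D f ≤ᴿ N f)) →
               ∀ f → ε * D f ≤ᴿ N f
  slope-≤sup D N 0≤D {ε} h f
    with em {P = ∃ λ μ → 0# ≤ᴿ μ × (∀ f → μ * D f ≤ᴿ N f)}
       | em {P = ∃ (UpperBound λ μ → 0# ≤ᴿ μ × (∀ f → μ * D f ≤ᴿ N f))} | h
  ... | no _  | _ | AddSupremum.[ () ]
  ... | yes _ | no unbounded | _ = by-contradiction λ N<εD → unbounded (ε , λ {μ} (_ , μ-slope) →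
          by-contradiction λ μ≰ε → N<εD (≤-trans (*-monoˡ-≤ (0≤D f) (<⇒≤ (≰⇒> μ≰ε))) (μ-slope f)))
  ... | yes (μ₀ , 0≤μ₀ , μ₀-slope) | yes (b , ≤b) | [ ε≤s ]± = by-contradiction λ εD≰N →
          let 0<D : 0# <ᴿ D f
              0<D = 0≤D f , λ 0≈D → εD≰N (begin
                ε * D f    ≈⟨ ℝ.*-congˡ 0≈D ⟨
                ε * 0#     ≈⟨ ℝ.zeroʳ ε ⟩
                0#         ≈⟨ ℝ.zeroʳ μ₀ ⟨
                μ₀ * 0#    ≈⟨ ℝ.*-congˡ 0≈D ⟩
                μ₀ * D f   ≤⟨ μ₀-slope f ⟩
                N f        ∎)
              ε≤N/D : ε ≤ᴿ N f * D f ⁻¹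
              ε≤N/D = ≤-trans ε≤s (proj₂ (proj₂ least) _ λ μ∈ →
                        x*y≤z⇒x≤z*y⁻¹ 0<D (proj₂ (toWitness μ∈) f))
          in εD≰N (begin
            ε * D f               ≤⟨ *-monoˡ-≤ (0≤D f) ε≤N/D ⟩
            N f * D f ⁻¹ * D f    ≈⟨ ℝ.*-assoc _ _ _ ⟩
            N f * (D f ⁻¹ * D f)  ≈⟨ ℝ.*-congˡ (*-inverseˡ 0<D) ⟩
            N f * 1#              ≈⟨ ℝ.*-identityʳ _ ⟩
            N f                   ∎)
    where
    least = complete (λ y → True (em {P = 0# ≤ᴿ y × (∀ f → y * D f ≤ᴿ N f)}))
              (μ₀ , fromWitness (0≤μ₀ , μ₀-slope)) (b , λ Py → ≤b (toWitness Py))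

  archimedean : ∀ x {c} → 0# <ᴿ c → ∃ λ n → x ≤ᴿ fromℕ n * c
  archimedean x {c} 0<c = by-contradiction λ ∄ →
    let bound : UpperBound Multiple x
        bound {y} (n , y≤nc) = ≤-trans y≤nc (by-contradiction λ nc≰x → ∄ (n , <⇒≤ (≰⇒> nc≰x)))
        s , s-upper , s-least = complete Multiple (0# , 0 , ≤-reflexive (≈-sym (ℝ.zeroˡ c))) (x , bound)
        s≤s-c : s ≤ᴿ s - c
        s≤s-c = s-least _ λ {y} (n , y≤nc) → +-cancelʳ-≤ c (begin
          y + c                 ≤⟨ +-monoˡ-≤ c y≤nc ⟩
          fromℕ n * c + c       ≈⟨ ℝ.+-comm _ _ ⟩
          c + fromℕ n * c       ≈⟨ ℝ.+-congʳ (ℝ.*-identityˡ c) ⟨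
          1# * c + fromℕ n * c  ≈⟨ ℝ.distribʳ c 1# _ ⟨
          fromℕ (suc n) * c     ≤⟨ s-upper (suc n , ≤-refl) ⟩
          s                     ≈⟨ x-y+y≈x s c ⟨
          s - c + c             ∎)
    in <⇒≱ 0<c (+-cancelˡ-≤ s (begin
         s + c        ≤⟨ +-monoˡ-≤ c s≤s-c ⟩
         s - c + c    ≈⟨ x-y+y≈x s c ⟩
         s            ≈⟨ ℝ.+-identityʳ s ⟨
         s + 0#       ∎))
    where
    Multiple : Pred Real 0ℓ
    Multiple y = ∃ λ n → y ≤ᴿ fromℕ n * c

  module _ {a r} {A : Set a} (_⟶_ : Rel A r) where

    descent : (ν : A → Real) → (∀ a → 0# ≤ᴿ ν a) → ∀ {c} → 0# <ᴿ c →
              (∀ {a b} → a ⟶ b → ν b + c ≤ᴿ ν a) → ∀ a → Acc (flip _⟶_) a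
    descent ν 0≤ν {c} 0<c step a = let n , h = archimedean (ν a) 0<c in go n a h
      where
      go : ∀ n a → ν a ≤ᴿ fromℕ n * c → Acc (flip _⟶_) a
      go zero a h = acc λ {b} a⟶b → ⊥-elim (<⇒≱ 0<c (begin
        c            ≈⟨ ℝ.+-identityˡ c ⟨
        0# + c       ≤⟨ +-monoˡ-≤ c (0≤ν b) ⟩
        ν b + c      ≤⟨ step a⟶b ⟩
        ν a          ≤⟨ h ⟩
        0# * c       ≈⟨ ℝ.zeroˡ c ⟩
        0#           ∎))
      go (suc n) a h = acc λ {b} a⟶b → go n b (+-cancelʳ-≤ c (begin
        ν b + c               ≤⟨ step a⟶b ⟩
        ν a                   ≤⟨ h ⟩
        (1# + fromℕ n) * c    ≈⟨ ℝ.distribʳ c 1# _ ⟩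
        1# * c + fromℕ n * c  ≈⟨ ℝ.+-comm _ _ ⟩
        fromℕ n * c + 1# * c  ≈⟨ ℝ.+-congˡ (ℝ.*-identityˡ c) ⟩
        fromℕ n * c + c       ∎))

    acc⇒normalForm : ∀ {a} → Acc (flip _⟶_) a → ∃ λ b → Star _⟶_ a b × IsNormalForm _⟶_ b
    acc⇒normalForm {a} (acc rs) with em {P = ∃ λ b → a ⟶ b}
    ... | no normal     = a , ε⋆ , normal
    ... | yes (b , a⟶b) = let c , b⟶*c , normal = acc⇒normalForm (rs a⟶b)
                          in c , a⟶b ◅ b⟶*c , normal

module ListSum {c ℓ} (M : CommutativeMonoid c ℓ) where
  open CommutativeMonoid M renaming (Carrier to Value)
  open MonoidSum M using (sum)
  private module M = CommutativeMonoid M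
  open import Algebra.Properties.CommutativeSemigroup M.commutativeSemigroup using (interchange)

  module _ {a} {A : Set a} where

    sumOver : List A → (A → Value) → Value
    sumOver []       h = ε
    sumOver (x ∷ xs) h = h x ∙ sumOver xs h

    sum-lookup : ∀ xs (h : A → Value) → sum (λ k → h (lookup xs k)) ≡ sumOver xs h
    sum-lookup []       h = ≡.refl
    sum-lookup (x ∷ xs) h = ≡.cong (h x ∙_) (sum-lookup xs h)

    sumOver-cong : ∀ xs {g h : A → Value} → (∀ x → g x ≈ h x) → sumOver xs g ≈ sumOver xs h
    sumOver-cong []       g≈h = refl
    sumOver-cong (x ∷ xs) g≈h = ∙-cong (g≈h x) (sumOver-cong xs g≈h)

    sumOver-∙ : ∀ xs (g h : A → Value) → sumOver xs (λ x → g x ∙ h x) ≈ sumOver xs g ∙ sumOver xs h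
    sumOver-∙ []       g h = sym (identityˡ ε)
    sumOver-∙ (x ∷ xs) g h = trans (∙-congˡ (sumOver-∙ xs g h)) (interchange _ _ _ _)

    sumOver-ε : ∀ xs {h : A → Value} → (∀ x → h x ≈ ε) → sumOver xs h ≈ ε
    sumOver-ε []       h≈ε = refl
    sumOver-ε (x ∷ xs) h≈ε = trans (∙-cong (h≈ε x) (sumOver-ε xs h≈ε)) (identityˡ ε)

  sumOver-swap : ∀ {a b} {A : Set a} {B : Set b} (xs : List A) (ys : List B) (h : A → B → Value) →
                 sumOver xs (λ x → sumOver ys (h x)) ≈ sumOver ys (λ y → sumOver xs λ x → h x y)
  sumOver-swap []       ys h = sym (sumOver-ε ys λ _ → refl)
  sumOver-swap (x ∷ xs) ys h = trans (∙-congˡ (sumOver-swap xs ys h)) (sym (sumOver-∙ ys (h x) _))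

module Indicators (em : ∀ {ℓ} → ExcludedMiddle ℓ) (ℝ : CompleteOrderedField) where
  open Classical em ℝ hiding (module ℝ)
  private module ℝ = CompleteOrderedField ℝ
  open OrderedField ℝ
  open ListSum ℝ.+-commutativeMonoid

  χ : ∀ {p} → Set p → Real
  χ P = extend (em {P = P}) (λ _ → 1#) 0#

  module _ {p} {P : Set p} where

    χ-yes : P → χ P ≈ 1#
    χ-yes p with em {P = P}
    ... | yes _ = ≈-refl
    ... | no ¬p = ⊥-elim (¬p p)

    χ-no : ¬ P → χ P ≈ 0#
    χ-no ¬p with em {P = P}
    ... | yes p = ⊥-elim (¬p p)
    ... | no _  = ≈-refl

    χ-cases : ∀ {ℓ} {B : Real → Set ℓ} → (P → B 1#) → (¬ P → B 0#) → B (χ P)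
    χ-cases b₁ b₀ with em {P = P}
    ... | yes p = b₁ p
    ... | no ¬p = b₀ ¬p

    0≤χ : 0# ≤ᴿ χ P
    0≤χ = χ-cases {B = 0# ≤ᴿ_} (λ _ → 0≤1) (λ _ → ≤-refl)

    χ*-mono : ∀ {x y} → (P → x ≤ᴿ y) → χ P * x ≤ᴿ χ P * y
    χ*-mono {x} {y} h = χ-cases {B = λ c → c * x ≤ᴿ c * y} (λ p → *-monoʳ-≤ 0≤1 (h p))
                          (λ _ → ≤-reflexive (≈-trans (ℝ.zeroˡ x) (≈-sym (ℝ.zeroˡ y))))

    χ*-cong : ∀ {x y} → (P → x ≈ y) → χ P * x ≈ χ P * y
    χ*-cong h = antisym (χ*-mono (≤-reflexive ∘ h)) (χ*-mono (≤-reflexive ∘ ≈-sym ∘ h))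

    χ≤ : ∀ {x} → 0# ≤ᴿ x → (P → 1# ≤ᴿ x) → χ P ≤ᴿ x
    χ≤ {x} 0≤x h = χ-cases {B = _≤ᴿ x} h (λ _ → 0≤x)

  χ-mono : ∀ {p q} {P : Set p} {Q : Set q} → (P → Q) → χ P ≤ᴿ χ Q
  χ-mono P⇒Q = χ≤ 0≤χ λ p → ≤-reflexive (≈-sym (χ-yes (P⇒Q p)))

  χ-cong : ∀ {p q} {P : Set p} {Q : Set q} → (P → Q) → (Q → P) → χ P ≈ χ Q
  χ-cong P⇒Q Q⇒P = antisym (χ-mono P⇒Q) (χ-mono Q⇒P)

  χ-× : ∀ {p q} {P : Set p} {Q : Set q} → χ (P × Q) ≈ χ P * χ Q
  χ-× {P = P} {Q} with em {P = P} | em {P = Q}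
  ... | yes p | yes q = ≈-trans (χ-yes (p , q)) (≈-sym (ℝ.*-identityˡ 1#))
  ... | yes p | no ¬q = ≈-trans (χ-no (¬q ∘ proj₂)) (≈-sym (ℝ.zeroʳ 1#))
  ... | no ¬p | _     = ≈-trans (χ-no (¬p ∘ proj₁)) (≈-sym (ℝ.zeroˡ _))

  χ-⊎ : ∀ {p q r} {P : Set p} {Q : Set q} {R : Set r} → (P → Q ⊎ R) → χ P ≤ᴿ χ Q + χ R
  χ-⊎ h = χ≤ (≤-resp (ℝ.+-identityˡ _) ≈-refl (+-mono-≤ 0≤χ 0≤χ)) λ p →
    [ (λ q → ≤-resp (≈-trans (ℝ.+-congʳ (χ-yes q)) (ℝ.+-identityʳ _)) ≈-refl (+-monoʳ-≤ (χ _) 0≤χ))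
    , (λ r → ≤-resp (≈-trans (ℝ.+-congˡ (χ-yes r)) (ℝ.+-identityˡ _)) ≈-refl (+-monoˡ-≤ (χ _) 0≤χ))
    ]′ (h p)
    where open ℝ using (+-monoʳ-≤)

  module _ {a} {A : Set a} where

    sumOver-*ˡ : ∀ xs c (h : A → Real) → c * sumOver xs h ≈ sumOver xs (λ x → c * h x)
    sumOver-*ˡ []       c h = ℝ.zeroʳ c
    sumOver-*ˡ (x ∷ xs) c h = ≈-trans (ℝ.distribˡ c _ _) (ℝ.+-congˡ (sumOver-*ˡ xs c h))

    sumOver-mono : ∀ xs {g h : A → Real} → (∀ x → g x ≤ᴿ h x) → sumOver xs g ≤ᴿ sumOver xs h
    sumOver-mono []       _   = ≤-refl
    sumOver-mono (x ∷ xs) g≤h = +-mono-≤ (g≤h x) (sumOver-mono xs g≤h)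

    0≤sumOver : ∀ xs {h : A → Real} → (∀ x → 0# ≤ᴿ h x) → 0# ≤ᴿ sumOver xs h
    0≤sumOver xs 0≤h = ≤-resp (sumOver-ε xs λ _ → ≈-refl) ≈-refl (sumOver-mono xs 0≤h)

    ∈⇒≤sumOver : ∀ {xs} {h : A → Real} → (∀ x → 0# ≤ᴿ h x) → ∀ {x} → x ∈ xs → h x ≤ᴿ sumOver xs h
    ∈⇒≤sumOver {xs = y ∷ ys} {h} 0≤h (here ≡.refl) =
      ≤-resp (ℝ.+-identityʳ _) ≈-refl (+-mono-≤ (≤-refl {h y}) (0≤sumOver ys 0≤h))
    ∈⇒≤sumOver {xs = y ∷ ys} {h} 0≤h (there x∈) =
      ≤-resp (ℝ.+-identityˡ _) ≈-refl (+-mono-≤ (0≤h y) (∈⇒≤sumOver 0≤h x∈))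

    sumOver-filter : ∀ {p} (P : Pred A p) xs →
      fromℕ (length (filter (λ x → em {P = P x}) xs)) ≈ sumOver xs (λ x → χ (P x))
    sumOver-filter P []       = ≈-refl
    sumOver-filter P (x ∷ xs) with em {P = P x}
    ... | yes _ = ℝ.+-congˡ (sumOver-filter P xs)
    ... | no _  = ≈-trans (sumOver-filter P xs) (≈-sym (ℝ.+-identityˡ _))

  module _ (X : GradedPoset) where
    open GradedPoset X using (Carrier; faces; faces-complete)

    Σᶠ : (Carrier → Real) → Real
    Σᶠ = sumOver faces

    ∑ℝ≈Σᶠ : ∀ {p} (P : Pred Carrier p) (h : Carrier → Real) → ∑ℝ X P h ≈ Σᶠ λ x → χ (P x) * h x
    ∑ℝ≈Σᶠ P h = ≈-trans (≈-reflexive (sum-lookup faces _)) (sumOver-cong faces aux)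
      where
      aux : ∀ x → extend (em {P = P x}) (λ _ → h x) 0# ≈ χ (P x) * h x
      aux x with em {P = P x}
      ... | yes _ = ≈-sym (ℝ.*-identityˡ _)
      ... | no _  = ≈-sym (ℝ.zeroˡ _)

    Σᶠ-*ˡ : ∀ {p} {P : Pred Carrier p} c (h : Carrier → Real) →
            c * Σᶠ (λ x → χ (P x) * h x) ≈ Σᶠ (λ x → χ (P x) * (c * h x))
    Σᶠ-*ˡ c h = ≈-trans (sumOver-*ˡ faces c _) (sumOver-cong faces λ x → *-left-comm c _ _)

    #≈Σᶠ : ∀ {p} (P : Pred Carrier p) → fromℕ (# X P) ≈ Σᶠ (λ x → χ (P x))
    #≈Σᶠ P = sumOver-filter P faces

    ≤Σᶠ : ∀ {h : Carrier → Real} → (∀ x → 0# ≤ᴿ h x) → ∀ x → h x ≤ᴿ Σᶠ h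
    ≤Σᶠ 0≤h x = ∈⇒≤sumOver 0≤h (faces-complete x)

    χ-∃ : ∀ {p q} {P : Set p} {Q : Pred Carrier q} → (P → ∃ Q) → χ P ≤ᴿ Σᶠ (λ x → χ (Q x))
    χ-∃ {Q = Q} h = χ≤ (0≤sumOver faces (λ _ → 0≤χ)) λ p → let x , q = h p in
      ≤-trans (≤-reflexive (≈-sym (χ-yes q))) (≤Σᶠ {λ x → χ (Q x)} (λ _ → 0≤χ) x)

    #-pos : ∀ {p} {P : Pred Carrier p} {x} → P x → 1 ℕ.≤ # X P
    #-pos {P = P} {x} Px with # X P in eq
    ... | suc n = ℕ.s≤s ℕ.z≤n
    ... | zero  = ⊥-elim (<⇒≱ 0<1 (begin
      1#                       ≈⟨ χ-yes Px ⟨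
      χ (P x)                  ≤⟨ ≤Σᶠ {λ x → χ (P x)} (λ _ → 0≤χ) x ⟩
      Σᶠ (λ x → χ (P x))       ≈⟨ #≈Σᶠ P ⟨
      fromℕ (# X P)            ≡⟨ ≡.cong fromℕ eq ⟩
      0#                       ∎))

    module _ {w : Carrier → Real} where

      weight-cong : ∀ {p q} {P : Pred Carrier p} {Q : Pred Carrier q} →
                    (∀ {x} → P x → Q x) → (∀ {x} → Q x → P x) → weight X w P ≈ weight X w Q
      weight-cong {P = P} {Q} P⊆Q Q⊆P = ≈-trans (∑ℝ≈Σᶠ P w) (≈-trans
        (sumOver-cong faces λ x → ℝ.*-congʳ (χ-cong P⊆Q Q⊆P)) (≈-sym (∑ℝ≈Σᶠ Q w)))

      module _ (0≤w : ∀ x → 0# ≤ᴿ w x) where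

        weight-mono : ∀ {p q} {P : Pred Carrier p} {Q : Pred Carrier q} →
                      (∀ {x} → P x → Q x) → weight X w P ≤ᴿ weight X w Q
        weight-mono {P = P} {Q} P⊆Q = ≤-resp (≈-sym (∑ℝ≈Σᶠ P w)) (≈-sym (∑ℝ≈Σᶠ Q w))
          (sumOver-mono faces λ x → *-monoˡ-≤ (0≤w x) (χ-mono P⊆Q))

        0≤weight : ∀ {p} {P : Pred Carrier p} → 0# ≤ᴿ weight X w P
        0≤weight {P = P} = ≤-resp ≈-refl (≈-sym (∑ℝ≈Σᶠ P w))
          (0≤sumOver faces λ x → ℝ.*-nonNeg 0≤χ (0≤w x))

        ∈⇒≤weight : ∀ {p} {P : Pred Carrier p} {x} → P x → w x ≤ᴿ weight X w P
        ∈⇒≤weight {P = P} {x} Px = ≤-resp (≈-trans (ℝ.*-congʳ (χ-yes Px)) (ℝ.*-identityˡ _))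
          (≈-sym (∑ℝ≈Σᶠ P w)) (≤Σᶠ {λ x → χ (P x) * w x} (λ x → ℝ.*-nonNeg 0≤χ (0≤w x)) x)

  module _ (X : GradedPoset) (z : GradedPoset.Carrier X) where
    open GradedPoset X

    sumOver-above : ∀ {p} (Q : Pred (LinkFace X z) p) (h : Carrier → Real) xs →
      sumOver (above X z xs) (λ x → χ (Q x) * h (value x)) ≈
      sumOver xs (λ x → χ (Σ (z ≤ x) λ z≤x → Q (x , [ z≤x ])) * h x)
    sumOver-above Q h [] = ≈-refl
    sumOver-above Q h (x ∷ xs) with em {P = z ≤ x}
    ... | yes z≤x = ℝ.+-cong (ℝ.*-congʳ (χ-cong (z≤x ,_) proj₂)) (sumOver-above Q h xs)
    ... | no  z≰x = ≈-trans (sumOver-above Q h xs) (≈-sym (≈-trans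
      (ℝ.+-congʳ (≈-trans (ℝ.*-congʳ (χ-no (z≰x ∘ proj₁))) (ℝ.zeroˡ _))) (ℝ.+-identityˡ _)))

    weight-link : ∀ {p} (Q : Pred (LinkFace X z) p) (h : Carrier → Real) →
      weight (link X z) (h ∘ value) Q ≈ Σᶠ X λ x → χ (Σ (z ≤ x) λ z≤x → Q (x , [ z≤x ])) * h x
    weight-link Q h = ≈-trans (∑ℝ≈Σᶠ (link X z) Q (h ∘ value)) (sumOver-above Q h faces)

module Grading (em : ∀ {ℓ} → ExcludedMiddle ℓ) (X : GradedPoset) where
  open GradedPoset X

  <-trans : ∀ {x y z} → x < y → y < z → x < z
  <-trans (x≤y , x≢y) (y≤z , y≢z) =
    ≤-trans x≤y y≤z , λ { ≡.refl → x≢y (≤-antisym x≤y y≤z) }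

  cover : ∀ {x z} → x < z → ∃ λ c → x ⋖ c × c ≤ z
  cover {x} {z} x<z = let c , x<c , c≤z , none = go faces
                      in c , (x<c , λ (t , x<t , t<c) → none (faces-complete t) (x<t , t<c)) , c≤z
    where
    go : ∀ xs → ∃ λ c → x < c × c ≤ z × (∀ {t} → t ∈ xs → ¬ (x < t × t < c))
    go []       = z , x<z , ≤-refl , λ ()
    go (t ∷ ts) with go ts
    ... | c , x<c , c≤z , none with em {P = x < t × t < c}
    ...   | no ¬between     = c , x<c , c≤z , λ { (here ≡.refl) → ¬between ; (there t∈) → none t∈ }
    ...   | yes (x<t , t<c) = t , x<t , ≤-trans (proj₁ t<c) c≤z , λ
            { (here ≡.refl) (_ , _ , t≢t) → t≢t ≡.refl
            ; (there s∈) (x<s , s<t)      → none s∈ (x<s , <-trans s<t t<c) }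

  dim-< : ∀ {x z} → x < z → dim x ℤ.< dim z
  dim-< x<z = let c , x⋖c , c≤z = cover x<z in
    ℤₚ.<-≤-trans (ℤₚ.suc[i]≤j⇒i<j (ℤₚ.≤-reflexive (≡.sym (dim-⋖ x⋖c)))) (dim-mono c≤z)

  ≤∧dim≡⇒≡ : ∀ {x y} → x ≤ y → dim x ≡ dim y → x ≡ y
  ≤∧dim≡⇒≡ {x} {y} x≤y dx≡dy with em {P = x ≡ y}
  ... | yes x≡y = x≡y
  ... | no  x≢y = ⊥-elim (ℤₚ.<-irrefl dx≡dy (dim-< (x≤y , x≢y)))

  ≤∧dim<⇒< : ∀ {x y} → x ≤ y → dim x ℤ.< dim y → x < y
  ≤∧dim<⇒< x≤y dx<dy = x≤y , λ { ≡.refl → ℤₚ.<-irrefl ≡.refl dx<dy }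

  face-between : ∀ {x z j} → x ≤ z → dim x ℤ.≤ j → j ℤ.≤ dim z → ∃ λ y → dim y ≡ j × x ≤ y × y ≤ z
  face-between {x} {z} {j} x≤z dx≤j j≤dz =
    go ℤ.∣ j ℤ.- dim x ∣ x≤z (≡.trans (≡.sym ([j-i]+i≡j j (dim x)))
      (≡.cong (ℤ._+ dim x) (≡.sym (ℤₚ.0≤i⇒+∣i∣≡i (ℤₚ.i≤j⇒0≤j-i dx≤j)))))
    where
    [j-i]+i≡j : ∀ j i → j ℤ.- i ℤ.+ i ≡ j
    [j-i]+i≡j j i = ≡.trans (ℤₚ.+-assoc j (ℤ.- i) i)
      (≡.trans (≡.cong (λ k → j ℤ.+ k) (ℤₚ.+-inverseˡ i)) (ℤₚ.+-identityʳ j))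
    go : ∀ n {x} → x ≤ z → j ≡ pos n ℤ.+ dim x → ∃ λ y → dim y ≡ j × x ≤ y × y ≤ z
    go zero    {x} x≤z eq = x , ≡.sym (≡.trans eq (ℤₚ.+-identityˡ _)) , ≤-refl , x≤z
    go (suc n) {x} x≤z eq =
      let c , x⋖c , c≤z = cover (≤∧dim<⇒< x≤z (ℤₚ.<-≤-trans dx<j j≤dz))
          y , dy , c≤y , y≤z = go n c≤z (≡.trans eq (shift c x⋖c))
      in y , dy , ≤-trans (proj₁ (proj₁ x⋖c)) c≤y , y≤z
      where
      shift : ∀ c → x ⋖ c → pos (suc n) ℤ.+ dim x ≡ pos n ℤ.+ dim c
      shift c x⋖c = ≡.trans (≡.cong (ℤ._+ dim x) (ℤₚ.+-comm 1ℤ (pos n)))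
        (≡.trans (ℤₚ.+-assoc (pos n) 1ℤ (dim x)) (≡.cong (λ k → pos n ℤ.+ k) (≡.sym (dim-⋖ x⋖c))))
      dx<j : dim x ℤ.< j
      dx<j = ≡.subst (dim x ℤ.<_) (≡.sym eq)
        (ℤₚ.≤-<-trans (ℤₚ.≤-reflexive (≡.sym (ℤₚ.+-identityˡ (dim x)))) (ℤₚ.+-monoˡ-< (dim x) (ℤ.+<+ (ℕ.s≤s ℕ.z≤n))))

module DPosetDimensions {d : ℕ} {X : GradedPoset} (isDPoset : IsDPoset d X) where
  open GradedPoset X
  open IsDPoset isDPoset

  dim≤d : ∀ x → dim x ℤ.≤ pos d
  dim≤d x = let y , dy , x≤y = pure x in ≡.subst (dim x ℤ.≤_) dy (dim-mono x≤y)

  -1≤dim : ∀ x → -1ℤ ℤ.≤ dim x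
  -1≤dim x = ≡.subst (ℤ._≤ dim x) dim-∅ (dim-mono (∅-min x))

[i+1]-1≡i : ∀ {i} → -1ℤ ℤ.≤ i → pos ℤ.∣ i ℤ.+ 1ℤ ∣ ℤ.- 1ℤ ≡ i
[i+1]-1≡i {i} -1≤i = ≡.trans (≡.cong (ℤ._- 1ℤ) (ℤₚ.0≤i⇒+∣i∣≡i (ℤₚ.+-monoˡ-≤ 1ℤ -1≤i))) (cancel i)
  where
  cancel : ∀ i → i ℤ.+ 1ℤ ℤ.- 1ℤ ≡ i
  cancel = ℤSolver.solve-∀

module Weights (em : ∀ {ℓ} → ExcludedMiddle ℓ) (ℝ : CompleteOrderedField) where
  open Classical em ℝ hiding (module ℝ)
  private module ℝ = CompleteOrderedField ℝ
  open OrderedField ℝ hiding (total)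
  open Indicators em ℝ
  open ListSum ℝ.+-commutativeMonoid

  -- The hypothesis L(X) ≤ Λ, without quotients of maxima by minima.
  Comparable : GradedPoset → Real → Set
  Comparable X Λ = ∀ {x x′ z z′} j → dim x ≡ dim x′ → dim z ≡ dim z′ → x ≤ z → x′ ≤ z′ →
    dim x ℤ.≤ j → j ℤ.≤ dim z →
    fromℕ (# X λ y → Faces j y × x ≤ y × y ≤ z) ≤ᴿ Λ * fromℕ (# X λ y → Faces j y × x′ ≤ y × y ≤ z′)
    where open GradedPoset X

  #FacesOf≈ : ∀ {d X} (isDPoset : IsDPoset d X) → let open GradedPoset X in
    ∀ z j → fromℕ (# X (FacesOf z j)) ≈ fromℕ (# X λ y → Faces j y × IsDPoset.∅ isDPoset ≤ y × y ≤ z)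
  #FacesOf≈ {X = X} isDPoset z j = ≈-trans (#≈Σᶠ X _) (≈-trans (sumOver-cong (GradedPoset.faces X) λ x →
    χ-cong (λ (a , b) → a , IsDPoset.∅-min isDPoset x , b) (λ (a , _ , b) → a , b)) (≈-sym (#≈Σᶠ X _)))

  module ProperlyWeighted {d : ℕ} {X : GradedPoset} (isDPoset : IsDPoset d X)
           {w : GradedPoset.Carrier X → Real} (isProper : IsProperWeight X d w) where
    open GradedPoset X renaming (≤-refl to ≼-refl; ≤-trans to ≼-trans)
    open Grading em X
    open IsDPoset isDPoset
    open IsProperWeight isProper

    Top : Pred Carrier 0ℓ
    Top = Faces (pos d)

    open DPosetDimensions isDPoset public

    0≤w : ∀ x → 0# ≤ᴿ w x
    0≤w x = <⇒≤ (positive x)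

    topWeight : Carrier → Real
    topWeight z = weight X w (λ y → Top y × z ≤ y)

    topWeight-pos : ∀ z → 0# <ᴿ topWeight z
    topWeight-pos z = let y , dy , z≤y = pure z in
      <-≤-trans (positive y) (∈⇒≤weight X 0≤w {P = λ y → Top y × z ≤ y} (dy , z≤y))

    Σᶠ-*ˡ-weighted : ∀ {p} {P : Pred Carrier p} c (g : Carrier → Real) →
      c * Σᶠ X (λ y → χ (P y) * (w y * g y)) ≈ Σᶠ X (λ y → χ (P y) * (w y * (c * g y)))
    Σᶠ-*ˡ-weighted c g = ≈-trans (Σᶠ-*ˡ X c _) (sumOver-cong faces λ y → ℝ.*-congˡ (*-left-comm c _ _))

    -- linkWeight X z d w, extended to all of X.
    relWeight : Carrier → Carrier → Real
    relWeight z x = topWeight z ⁻¹ *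
      ∑ℝ X (λ y → Top y × x ≤ y)
           (λ y → w y ÷ fromℕ (# X λ x′ → Faces (dim x) x′ × z ≤ x′ × x′ ≤ y))

    relWeight-pos : ∀ {z x} → z ≤ x → 0# ≤ᴿ relWeight z x
    relWeight-pos {z} {x} z≤x = ℝ.*-nonNeg (<⇒≤ (⁻¹-pos (topWeight-pos z)))
      (≤-resp ≈-refl (≈-sym (∑ℝ≈Σᶠ X (λ y → Top y × x ≤ y)
        (λ y → w y ÷ fromℕ (# X λ x′ → Faces (dim x) x′ × z ≤ x′ × x′ ≤ y)))) (0≤sumOver faces λ y →
        ≤-resp (ℝ.zeroʳ _) ≈-refl (χ*-mono λ (_ , x≤y) → ℝ.*-nonNeg (0≤w y)
          (<⇒≤ (⁻¹-pos (fromℕ-pos (#-pos X (≡.refl , z≤x , x≤y))))))))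

    shares-total : ∀ {p} (I : Pred Carrier p) (c : Carrier → Carrier → Real) →
      (∀ {x} y → I x → c x y ≈ Σᶠ X λ x′ → χ (I x′ × x′ ≤ y)) →
      Σᶠ X (λ x → χ (I x) * Σᶠ X λ y → χ (Top y × x ≤ y) * (w y * c x y ⁻¹)) ≈
      Σᶠ X (λ y → χ (Top y × ∃ λ x → I x × x ≤ y) * w y)
    shares-total I c c≈C = begin-equality
      Σᶠ X (λ x → χ (I x) * Σᶠ X λ y → χ (Top y × x ≤ y) * (w y * c x y ⁻¹))
        ≈⟨ sumOver-cong faces (λ x → ≈-trans (χ*-cong λ Ix → sumOver-cong faces λ y →
             ℝ.*-congˡ (ℝ.*-congˡ (ℝ.⁻¹-cong (c≈C y Ix)))) (sumOver-*ˡ faces (χ (I x)) _)) ⟩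
      Σᶠ X (λ x → Σᶠ X λ y → χ (I x) * (χ (Top y × x ≤ y) * (w y * C y ⁻¹)))
        ≈⟨ sumOver-swap faces faces _ ⟩
      Σᶠ X (λ y → Σᶠ X λ x → χ (I x) * (χ (Top y × x ≤ y) * (w y * C y ⁻¹)))
        ≈⟨ sumOver-cong faces (λ y → ≈-trans (sumOver-cong faces λ x → regroup x y)
             (≈-sym (sumOver-*ˡ faces (χ (Top y) * (w y * C y ⁻¹)) _))) ⟩
      Σᶠ X (λ y → χ (Top y) * (w y * C y ⁻¹) * C y)
        ≈⟨ sumOver-cong faces cancel ⟩
      Σᶠ X (λ y → χ (Top y × ∃ λ x → I x × x ≤ y) * w y) ∎
      where
      C : Carrier → Real
      C y = Σᶠ X λ x′ → χ (I x′ × x′ ≤ y)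

      regroup : ∀ x y → χ (I x) * (χ (Top y × x ≤ y) * (w y * C y ⁻¹)) ≈
                        χ (Top y) * (w y * C y ⁻¹) * χ (I x × x ≤ y)
      regroup x y = ≈-trans (ℝ.*-congˡ (ℝ.*-congʳ χ-×)) (≈-trans
        (solve 4 (λ i t l v → i :* ((t :* l) :* v) := (t :* v) :* (i :* l)) ≈-refl
           (χ (I x)) (χ (Top y)) (χ (x ≤ y)) (w y * C y ⁻¹))
        (ℝ.*-congˡ (≈-sym χ-×)))

      cancel : ∀ y → χ (Top y) * (w y * C y ⁻¹) * C y ≈ χ (Top y × ∃ λ x → I x × x ≤ y) * w y
      cancel y with em {P = ∃ λ x → I x × x ≤ y}
      ... | yes (x , h) = begin-equality
        χ (Top y) * (w y * C y ⁻¹) * C y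
          ≈⟨ solve 4 (λ t v i c → t :* (v :* i) :* c := t :* v :* (i :* c)) ≈-refl _ _ _ _ ⟩
        χ (Top y) * w y * (C y ⁻¹ * C y)  ≈⟨ ℝ.*-congˡ (*-inverseˡ (<-≤-trans 0<1 1≤C)) ⟩
        χ (Top y) * w y * 1#              ≈⟨ ℝ.*-identityʳ _ ⟩
        χ (Top y) * w y                   ≈⟨ ℝ.*-congʳ (χ-cong (_, (x , h)) proj₁) ⟩
        χ (Top y × ∃ λ x → I x × x ≤ y) * w y ∎
        where
        1≤C : 1# ≤ᴿ C y
        1≤C = ≤-resp (χ-yes h) ≈-refl (≤Σᶠ X {λ x → χ (I x × x ≤ y)} (λ _ → 0≤χ) x)
      ... | no ∄ = ≈-trans (≈-trans (ℝ.*-congˡ (sumOver-ε faces λ x → χ-no λ h → ∄ (x , h))) (ℝ.zeroʳ _))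
                     (≈-sym (≈-trans (ℝ.*-congʳ (χ-no (∄ ∘ proj₂))) (ℝ.zeroˡ _)))

    relWeight-total : ∀ z {i} → dim z ℤ.≤ i → i ℤ.≤ pos d →
                      Σᶠ X (λ x → χ (Faces i x × z ≤ x) * relWeight z x) ≈ 1#
    relWeight-total z {i} dz≤i i≤d = begin-equality
      Σᶠ X (λ x → χ (Faces i x × z ≤ x) * relWeight z x)
        ≈⟨ sumOver-cong faces (λ x → ≈-trans
             (*-left-comm _ _ _)
             (ℝ.*-congˡ (ℝ.*-congˡ (∑ℝ≈Σᶠ X _ _)))) ⟩
      Σᶠ X (λ x → topWeight z ⁻¹ * (χ (Faces i x × z ≤ x) *
        Σᶠ X λ y → χ (Top y × x ≤ y) * (w y * c x y ⁻¹)))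
        ≈⟨ sumOver-*ˡ faces _ _ ⟨
      topWeight z ⁻¹ * Σᶠ X (λ x → χ (Faces i x × z ≤ x) *
        Σᶠ X λ y → χ (Top y × x ≤ y) * (w y * c x y ⁻¹))
        ≈⟨ ℝ.*-congˡ (shares-total (λ x → Faces i x × z ≤ x) c c≈C) ⟩
      topWeight z ⁻¹ * Σᶠ X (λ y → χ (Top y × ∃ λ x → (Faces i x × z ≤ x) × x ≤ y) * w y)
        ≈⟨ ℝ.*-congˡ (sumOver-cong faces λ y → ℝ.*-congʳ (χ-cong
             (λ (ty , x , (_ , z≤x) , x≤y) → ty , ≼-trans z≤x x≤y)
             (λ (ty , z≤y) → ty , let x , dx , z≤x , x≤y = face-between z≤y dz≤i (ℤₚ.≤-trans i≤d (ℤₚ.≤-reflexive (≡.sym ty)))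
                                  in x , (dx , z≤x) , x≤y))) ⟩
      topWeight z ⁻¹ * Σᶠ X (λ y → χ (Top y × z ≤ y) * w y)
        ≈⟨ ℝ.*-congˡ (∑ℝ≈Σᶠ X _ w) ⟨
      topWeight z ⁻¹ * topWeight z
        ≈⟨ *-inverseˡ (topWeight-pos z) ⟩
      1# ∎
      where
      c : Carrier → Carrier → Real
      c x y = fromℕ (# X λ x′ → Faces (dim x) x′ × z ≤ x′ × x′ ≤ y)
      c≈C : ∀ {x} y → Faces i x × z ≤ x → c x y ≈ Σᶠ X λ x′ → χ ((Faces i x′ × z ≤ x′) × x′ ≤ y)
      c≈C y (≡.refl , _) = ≈-trans (#≈Σᶠ X _) (sumOver-cong faces λ x′ →
        χ-cong (λ (a , b , c) → (a , b) , c) (λ ((a , b) , c) → a , b , c))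

    weight≤1 : ∀ i → weight X w (Faces i) ≤ᴿ 1#
    weight≤1 i = begin
      weight X w (Faces i)
        ≈⟨ ∑ℝ≈Σᶠ X (Faces i) w ⟩
      Σᶠ X (λ x → χ (Faces i x) * w x)
        ≈⟨ sumOver-cong faces (λ x → ℝ.*-congˡ (≈-trans (proper x) (∑ℝ≈Σᶠ X _ _))) ⟩
      Σᶠ X (λ x → χ (Faces i x) * Σᶠ X λ y → χ (Top y × x ≤ y) * (w y * fromℕ (# X (FacesOf y (dim x))) ⁻¹))
        ≈⟨ shares-total (Faces i) _ (λ { y ≡.refl → #≈Σᶠ X _ }) ⟩
      Σᶠ X (λ y → χ (Top y × ∃ λ x → Faces i x × x ≤ y) * w y)
        ≤⟨ sumOver-mono faces (λ y → *-monoˡ-≤ (0≤w y) (χ-mono proj₁)) ⟩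
      Σᶠ X (λ y → χ (Top y) * w y)
        ≈⟨ ∑ℝ≈Σᶠ X Top w ⟨
      weight X w Top
        ≈⟨ total ⟩
      1# ∎

    module Comparison {Λ : Real} (1≤Λ : 1# ≤ᴿ Λ) (comparable : Comparable X Λ) where

      μ : Real
      μ = Λ * Λ * Λ

      private
        0≤Λ : 0# ≤ᴿ Λ
        0≤Λ = ≤-trans 0≤1 1≤Λ

      #FacesOf-comparable : ∀ {y y′} i → dim y ≡ dim y′ → -1ℤ ℤ.≤ i → i ℤ.≤ dim y →
                            fromℕ (# X (FacesOf y i)) ≤ᴿ Λ * fromℕ (# X (FacesOf y′ i))
      #FacesOf-comparable {y} {y′} i dy≡ -1≤i i≤dy =
        ≤-resp (≈-sym (#FacesOf≈ isDPoset y i)) (ℝ.*-congˡ (≈-sym (#FacesOf≈ isDPoset y′ i)))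
          (comparable i ≡.refl dy≡ (∅-min y) (∅-min y′) (≡.subst (ℤ._≤ i) (≡.sym dim-∅) -1≤i) i≤dy)

      module _ {z x : Carrier} (z≤x : z ≤ x) where
        private
          n = fromℕ (# X (FacesOf x (dim z)))
          a b c : Carrier → Real
          a y = fromℕ (# X (FacesOf y (dim z)))
          b y = fromℕ (# X (FacesOf y (dim x)))
          c y = fromℕ (# X λ x′ → Faces (dim x) x′ × z ≤ x′ × x′ ≤ y)
          S = ∑ℝ X (λ y → Top y × x ≤ y) (λ y → w y ÷ c y)
          P = topWeight z

          dz≤dx = dim-mono z≤x
          dx≤d = dim≤d x

          a-pos : ∀ {y} → z ≤ y → 0# <ᴿ a y
          a-pos z≤y = fromℕ-pos (#-pos X (≡.refl , z≤y))

          b-pos : ∀ {y} → x ≤ y → 0# <ᴿ b y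
          b-pos x≤y = fromℕ-pos (#-pos X (≡.refl , x≤y))

          c-pos : ∀ {y} → x ≤ y → 0# <ᴿ c y
          c-pos x≤y = fromℕ-pos (#-pos X (≡.refl , z≤x , x≤y))

          dim-top : ∀ {y i} → Top y → i ℤ.≤ pos d → i ℤ.≤ dim y
          dim-top ty i≤d = ≡.subst (_ ℤ.≤_) (≡.sym ty) i≤d

          a-comparable : ∀ {y y′} → Top y → Top y′ → a y ≤ᴿ Λ * a y′
          a-comparable ty ty′ = #FacesOf-comparable (dim z) (≡.trans ty (≡.sym ty′))
            (-1≤dim z) (dim-top ty (dim≤d z))

          wz*a≤ΛP : ∀ {y} → Top y → w z * a y ≤ᴿ Λ * P
          wz*a≤ΛP {y} ty = begin
            w z * a y
              ≈⟨ ℝ.*-comm _ _ ⟩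
            a y * w z
              ≈⟨ ℝ.*-congˡ (≈-trans (proper z) (∑ℝ≈Σᶠ X _ _)) ⟩
            a y * Σᶠ X (λ y′ → χ (Top y′ × z ≤ y′) * (w y′ * a y′ ⁻¹))
              ≈⟨ Σᶠ-*ˡ-weighted _ _ ⟩
            Σᶠ X (λ y′ → χ (Top y′ × z ≤ y′) * (w y′ * (a y * a y′ ⁻¹)))
              ≤⟨ sumOver-mono faces (λ y′ → χ*-mono λ (ty′ , z≤y′) → ≤-resp ≈-refl (ℝ.*-comm _ _) (*-monoʳ-≤ (0≤w y′)
                   (x≤y*z⇒x*y⁻¹≤z (a-pos z≤y′) (a-comparable ty ty′)))) ⟩
            Σᶠ X (λ y′ → χ (Top y′ × z ≤ y′) * (Λ * w y′))
              ≈⟨ Σᶠ-*ˡ X _ _ ⟨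
            Λ * Σᶠ X (λ y′ → χ (Top y′ × z ≤ y′) * w y′)
              ≈⟨ ℝ.*-congˡ (∑ℝ≈Σᶠ X _ w) ⟨
            Λ * P ∎

          P≤Λwz*a : ∀ {y} → Top y → P ≤ᴿ Λ * (w z * a y)
          P≤Λwz*a {y} ty = begin
            P
              ≈⟨ ∑ℝ≈Σᶠ X _ w ⟩
            Σᶠ X (λ y′ → χ (Top y′ × z ≤ y′) * w y′)
              ≤⟨ sumOver-mono faces (λ y′ → χ*-mono λ (ty′ , z≤y′) →
                   ≤-resp (ℝ.*-identityʳ _) ≈-refl (*-monoʳ-≤ (0≤w y′)
                     (x*y≤z⇒x≤z*y⁻¹ (a-pos z≤y′) (≤-resp (≈-sym (ℝ.*-identityˡ _)) ≈-refl (a-comparable ty′ ty))))) ⟩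
            Σᶠ X (λ y′ → χ (Top y′ × z ≤ y′) * (w y′ * (Λ * a y * a y′ ⁻¹)))
              ≈⟨ Σᶠ-*ˡ-weighted _ _ ⟨
            (Λ * a y) * Σᶠ X (λ y′ → χ (Top y′ × z ≤ y′) * (w y′ * a y′ ⁻¹))
              ≈⟨ ℝ.*-congˡ (≈-trans (proper z) (∑ℝ≈Σᶠ X _ _)) ⟨
            (Λ * a y) * w z
              ≈⟨ solve 3 (λ l a w → (l :* a) :* w := l :* (w :* a)) ≈-refl _ _ _ ⟩
            Λ * (w z * a y) ∎

          pairs : (y : Carrier) →
            Σᶠ X (λ x′ → χ (FacesOf y (dim x) x′) * fromℕ (# X (FacesOf x′ (dim z)))) ≈
            Σᶠ X (λ z′ → χ (FacesOf y (dim z) z′) * fromℕ (# X λ x′ → Faces (dim x) x′ × z′ ≤ x′ × x′ ≤ y))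
          pairs y = begin-equality
            Σᶠ X (λ x′ → χ (FacesOf y (dim x) x′) * fromℕ (# X (FacesOf x′ (dim z))))
              ≈⟨ sumOver-cong faces (λ x′ → ≈-trans (ℝ.*-congˡ (#≈Σᶠ X _)) (sumOver-*ˡ faces _ _)) ⟩
            Σᶠ X (λ x′ → Σᶠ X λ z′ → χ (FacesOf y (dim x) x′) * χ (FacesOf x′ (dim z) z′))
              ≈⟨ sumOver-swap faces faces _ ⟩
            Σᶠ X (λ z′ → Σᶠ X λ x′ → χ (FacesOf y (dim x) x′) * χ (FacesOf x′ (dim z) z′))
              ≈⟨ sumOver-cong faces (λ z′ → sumOver-cong faces λ x′ →
                   ≈-trans (≈-sym χ-×) (≈-trans (χ-cong
                     (λ ((dx′ , x′≤y) , dz′ , z′≤x′) → (dz′ , ≼-trans z′≤x′ x′≤y) , dx′ , z′≤x′ , x′≤y)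
                     (λ ((dz′ , _) , dx′ , z′≤x′ , x′≤y) → (dx′ , x′≤y) , dz′ , z′≤x′)) χ-×)) ⟩
            Σᶠ X (λ z′ → Σᶠ X λ x′ → χ (FacesOf y (dim z) z′) * χ (Faces (dim x) x′ × z′ ≤ x′ × x′ ≤ y))
              ≈⟨ sumOver-cong faces (λ z′ → ≈-trans (ℝ.*-congˡ (#≈Σᶠ X _)) (sumOver-*ˡ faces _ _)) ⟨
            Σᶠ X (λ z′ → χ (FacesOf y (dim z) z′) * fromℕ (# X λ x′ → Faces (dim x) x′ × z′ ≤ x′ × x′ ≤ y)) ∎

          #*k≈ : ∀ {p} (Q : Pred Carrier p) k → Σᶠ X (λ u → χ (Q u) * k) ≈ k * fromℕ (# X Q)
          #*k≈ Q k = ≈-trans (sumOver-cong faces λ u → ℝ.*-comm _ _)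
            (≈-trans (≈-sym (sumOver-*ˡ faces k _)) (ℝ.*-congˡ (≈-sym (#≈Σᶠ X Q))))

          k*#≤ : ∀ {p} (Q : Pred Carrier p) {k} {f : Carrier → Real} → (∀ {u} → Q u → k ≤ᴿ Λ * f u) →
                 k * fromℕ (# X Q) ≤ᴿ Λ * Σᶠ X (λ u → χ (Q u) * f u)
          k*#≤ Q {k} {f} h = begin
            k * fromℕ (# X Q)                 ≈⟨ #*k≈ Q k ⟨
            Σᶠ X (λ u → χ (Q u) * k)          ≤⟨ sumOver-mono faces (λ u → χ*-mono h) ⟩
            Σᶠ X (λ u → χ (Q u) * (Λ * f u))  ≈⟨ Σᶠ-*ˡ X Λ f ⟨
            Λ * Σᶠ X (λ u → χ (Q u) * f u)    ∎

          ≤k*# : ∀ {p} (Q : Pred Carrier p) {k} {f : Carrier → Real} → (∀ {u} → Q u → f u ≤ᴿ Λ * k) →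
                 Σᶠ X (λ u → χ (Q u) * f u) ≤ᴿ Λ * (k * fromℕ (# X Q))
          ≤k*# Q {k} {f} h = begin
            Σᶠ X (λ u → χ (Q u) * f u)        ≤⟨ sumOver-mono faces (λ u → χ*-mono h) ⟩
            Σᶠ X (λ u → χ (Q u) * (Λ * k))    ≈⟨ #*k≈ Q (Λ * k) ⟩
            Λ * k * fromℕ (# X Q)             ≈⟨ ℝ.*-assoc _ _ _ ⟩
            Λ * (k * fromℕ (# X Q))           ∎

          n*b≤Λ²c*a : ∀ {y} → Top y → x ≤ y → n * b y ≤ᴿ Λ * (Λ * (c y * a y))
          n*b≤Λ²c*a {y} ty x≤y = begin
            n * b y  ≤⟨ k*#≤ (FacesOf y (dim x)) (λ (dx′ , _) →
                          #FacesOf-comparable (dim z) (≡.sym dx′) (-1≤dim z) dz≤dx) ⟩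
            Λ * Σᶠ X (λ x′ → χ (FacesOf y (dim x) x′) * fromℕ (# X (FacesOf x′ (dim z))))
                     ≈⟨ ℝ.*-congˡ (pairs y) ⟩
            Λ * Σᶠ X (λ z′ → χ (FacesOf y (dim z) z′) * fromℕ (# X λ x′ → Faces (dim x) x′ × z′ ≤ x′ × x′ ≤ y))
                     ≤⟨ *-monoʳ-≤ 0≤Λ (≤k*# (FacesOf y (dim z)) λ (dz′ , z′≤y) →
                          comparable (dim x) dz′ ≡.refl z′≤y (≼-trans z≤x x≤y)
                            (≡.subst (ℤ._≤ dim x) (≡.sym dz′) dz≤dx) (dim-mono x≤y)) ⟩
            Λ * (Λ * (c y * a y)) ∎

          c*a≤Λ²n*b : ∀ {y} → Top y → x ≤ y → c y * a y ≤ᴿ Λ * (Λ * (n * b y))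
          c*a≤Λ²n*b {y} ty x≤y = begin
            c y * a y  ≤⟨ k*#≤ (FacesOf y (dim z)) (λ (dz′ , z′≤y) →
                            comparable (dim x) (≡.sym dz′) ≡.refl (≼-trans z≤x x≤y) z′≤y dz≤dx (dim-mono x≤y)) ⟩
            Λ * Σᶠ X (λ z′ → χ (FacesOf y (dim z) z′) * fromℕ (# X λ x′ → Faces (dim x) x′ × z′ ≤ x′ × x′ ≤ y))
                     ≈⟨ ℝ.*-congˡ (pairs y) ⟨
            Λ * Σᶠ X (λ x′ → χ (FacesOf y (dim x) x′) * fromℕ (# X (FacesOf x′ (dim z))))
                     ≤⟨ *-monoʳ-≤ 0≤Λ (≤k*# (FacesOf y (dim x)) λ (dx′ , _) →
                          #FacesOf-comparable (dim z) dx′ (-1≤dim z) (≡.subst (dim z ℤ.≤_) (≡.sym dx′) dz≤dx)) ⟩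
            Λ * (Λ * (n * b y)) ∎

          k = n * (P ⁻¹ * w z)
          P-pos = topWeight-pos z
          0≤P⁻¹ = <⇒≤ (⁻¹-pos P-pos)

          k*S≈ : n * (relWeight z x * w z) ≈ Σᶠ X λ y → χ (Top y × x ≤ y) * (w y * (k * c y ⁻¹))
          k*S≈ = begin-equality
            n * (P ⁻¹ * S * w z)
              ≈⟨ solve 4 (λ n p s v → n :* (p :* s :* v) := n :* (p :* v) :* s) ≈-refl _ _ _ _ ⟩
            k * S
              ≈⟨ ℝ.*-congˡ (∑ℝ≈Σᶠ X _ _) ⟩
            k * Σᶠ X (λ y → χ (Top y × x ≤ y) * (w y * c y ⁻¹))
              ≈⟨ Σᶠ-*ˡ-weighted _ _ ⟩
            Σᶠ X (λ y → χ (Top y × x ≤ y) * (w y * (k * c y ⁻¹))) ∎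

          μ*w≈ : μ * w x ≈ Σᶠ X λ y → χ (Top y × x ≤ y) * (w y * (μ * b y ⁻¹))
          μ*w≈ = ≈-trans (ℝ.*-congˡ (≈-trans (proper x) (∑ℝ≈Σᶠ X _ _))) (Σᶠ-*ˡ-weighted _ _)

        -- Termwise over the top faces y ≥ x, with pairs of faces z′ ≤ x′ below y counted in two ways.
        relWeight-≤ : n * (relWeight z x * w z) ≤ᴿ μ * w x
        relWeight-≤ = begin
          n * (relWeight z x * w z)
            ≈⟨ k*S≈ ⟩
          Σᶠ X (λ y → χ (Top y × x ≤ y) * (w y * (k * c y ⁻¹)))
            ≤⟨ sumOver-mono faces (λ y → χ*-mono λ (ty , x≤y) → *-monoʳ-≤ (0≤w y) (bound ty x≤y)) ⟩
          Σᶠ X (λ y → χ (Top y × x ≤ y) * (w y * (μ * b y ⁻¹)))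
            ≈⟨ μ*w≈ ⟨
          μ * w x ∎
          where
          bound : ∀ {y} → Top y → x ≤ y → k * c y ⁻¹ ≤ᴿ μ * b y ⁻¹
          bound {y} ty x≤y = x≤y*z⇒x*y⁻¹≤z (c-pos x≤y) (begin
            n * (P ⁻¹ * w z)
              ≤⟨ x*y≤z⇒x≤z*y⁻¹ (b-pos x≤y) (begin
                n * (P ⁻¹ * w z) * b y
                  ≈⟨ solve 4 (λ n p v b → n :* (p :* v) :* b := p :* (v :* (n :* b))) ≈-refl _ _ _ _ ⟩
                P ⁻¹ * (w z * (n * b y))
                  ≤⟨ *-monoʳ-≤ 0≤P⁻¹ (*-monoʳ-≤ (0≤w z) (n*b≤Λ²c*a ty x≤y)) ⟩
                P ⁻¹ * (w z * (Λ * (Λ * (c y * a y))))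
                  ≈⟨ solve 5 (λ p v l c a → p :* (v :* (l :* (l :* (c :* a)))) := l :* l :* c :* p :* (v :* a)) ≈-refl _ _ _ _ _ ⟩
                Λ * Λ * c y * P ⁻¹ * (w z * a y)
                  ≤⟨ *-monoʳ-≤ (ℝ.*-nonNeg (ℝ.*-nonNeg (ℝ.*-nonNeg 0≤Λ 0≤Λ) (<⇒≤ (c-pos x≤y))) 0≤P⁻¹) (wz*a≤ΛP ty) ⟩
                Λ * Λ * c y * P ⁻¹ * (Λ * P)
                  ≈⟨ solve 4 (λ l c p q → l :* l :* c :* q :* (l :* p) := l :* l :* l :* c :* (q :* p)) ≈-refl _ _ _ _ ⟩
                μ * c y * (P ⁻¹ * P)
                  ≈⟨ ≈-trans (ℝ.*-congˡ (*-inverseˡ P-pos)) (ℝ.*-identityʳ _) ⟩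
                μ * c y ∎) ⟩
            μ * c y * b y ⁻¹
              ≈⟨ solve 3 (λ l c b → l :* c :* b := l :* b :* c) ≈-refl _ _ _ ⟩
            μ * b y ⁻¹ * c y ∎)

        ≤-relWeight : w x ≤ᴿ μ * (n * (relWeight z x * w z))
        ≤-relWeight = begin
          w x
            ≈⟨ ≈-trans (proper x) (∑ℝ≈Σᶠ X _ _) ⟩
          Σᶠ X (λ y → χ (Top y × x ≤ y) * (w y * b y ⁻¹))
            ≤⟨ sumOver-mono faces (λ y → χ*-mono λ (ty , x≤y) → *-monoʳ-≤ (0≤w y) (bound ty x≤y)) ⟩
          Σᶠ X (λ y → χ (Top y × x ≤ y) * (w y * (μ * (k * c y ⁻¹))))
            ≈⟨ ≈-trans (ℝ.*-congˡ k*S≈) (Σᶠ-*ˡ-weighted _ _) ⟨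
          μ * (n * (relWeight z x * w z)) ∎
          where
          bound : ∀ {y} → Top y → x ≤ y → b y ⁻¹ ≤ᴿ μ * (k * c y ⁻¹)
          bound {y} ty x≤y = ≤-resp (ℝ.*-identityˡ _) ≈-refl (x≤y*z⇒x*y⁻¹≤z (b-pos x≤y) (begin
            1#
              ≤⟨ x*y≤z⇒x≤z*y⁻¹ (c-pos x≤y) (≤-resp (≈-sym (ℝ.*-identityˡ _)) ≈-refl (begin
                c y
                  ≈⟨ ≈-trans (ℝ.*-congˡ (*-inverseˡ P-pos)) (ℝ.*-identityʳ _) ⟨
                c y * (P ⁻¹ * P)
                  ≤⟨ *-monoʳ-≤ (<⇒≤ (c-pos x≤y)) (*-monoʳ-≤ 0≤P⁻¹ (P≤Λwz*a ty)) ⟩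
                c y * (P ⁻¹ * (Λ * (w z * a y)))
                  ≈⟨ solve 5 (λ c p l v a → c :* (p :* (l :* (v :* a))) := p :* l :* v :* (c :* a)) ≈-refl _ _ _ _ _ ⟩
                P ⁻¹ * Λ * w z * (c y * a y)
                  ≤⟨ *-monoʳ-≤ (ℝ.*-nonNeg (ℝ.*-nonNeg 0≤P⁻¹ 0≤Λ) (0≤w z)) (c*a≤Λ²n*b ty x≤y) ⟩
                P ⁻¹ * Λ * w z * (Λ * (Λ * (n * b y)))
                  ≈⟨ solve 5 (λ p l v n b → p :* l :* v :* (l :* (l :* (n :* b))) := l :* l :* l :* (n :* (p :* v)) :* b) ≈-refl _ _ _ _ _ ⟩
                μ * k * b y ∎)) ⟩
            μ * k * b y * c y ⁻¹
              ≈⟨ solve 4 (λ m k b c → m :* k :* b :* c := m :* (k :* c) :* b) ≈-refl _ _ _ _ ⟩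
            μ * (k * c y ⁻¹) * b y ∎))

module Expansion (em : ∀ {ℓ} → ExcludedMiddle ℓ) (ℝ : CompleteOrderedField) where
  open Classical em ℝ hiding (module ℝ)
  private module ℝ = CompleteOrderedField ℝ
  open OrderedField ℝ hiding (total)
  open Suprema em ℝ using (by-contradiction)
  open Indicators em ℝ
  open ListSum ℝ.+-commutativeMonoid
  open Weights em ℝ

  module Masses {d : ℕ} {X : GradedPoset} (isDPoset : IsDPoset d X)
           {w : GradedPoset.Carrier X → Real} (isProper : IsProperWeight X d w)
           {Λ : Real} (1≤Λ : 1# ≤ᴿ Λ) (comparable : Comparable X Λ) where
    open GradedPoset X renaming (≤-refl to ≼-refl; ≤-trans to ≼-trans)
    open IsDPoset isDPoset
    open Grading em X
    open ProperlyWeighted isDPoset isProper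
    open Comparison 1≤Λ comparable

    mass : ∀ {p} → Pred Carrier p → Real
    mass Q = Σᶠ X λ x → χ (Q x) * w x

    massAbove : ∀ {p} → Carrier → Pred Carrier p → Real
    massAbove z Q = Σᶠ X λ x → χ (Q x) * relWeight z x

    1≤μ : 1# ≤ᴿ μ
    1≤μ = ≤-trans 1≤Λ (≤-trans (x≤x*y 0≤Λ 1≤Λ) (x≤x*y (ℝ.*-nonNeg 0≤Λ 0≤Λ) 1≤Λ))
      where 0≤Λ = ≤-trans 0≤1 1≤Λ

    0≤μ : 0# ≤ᴿ μ
    0≤μ = ≤-trans 0≤1 1≤μ

    0≤mass : ∀ {p} (Q : Pred Carrier p) → 0# ≤ᴿ mass Q
    0≤mass Q = 0≤sumOver faces λ x → ℝ.*-nonNeg 0≤χ (0≤w x)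

    mass-mono : ∀ {p q} {P : Pred Carrier p} {Q : Pred Carrier q} → (∀ {x} → P x → Q x) → mass P ≤ᴿ mass Q
    mass-mono P⊆Q = sumOver-mono faces λ x → *-monoˡ-≤ (0≤w x) (χ-mono P⊆Q)

    mass-⊎ : ∀ {p q r} {P : Pred Carrier p} {Q : Pred Carrier q} {R : Pred Carrier r} →
             (∀ {x} → P x → Q x ⊎ R x) → mass P ≤ᴿ mass Q + mass R
    mass-⊎ h = ≤-resp ≈-refl (sumOver-∙ faces _ _) (sumOver-mono faces λ x →
      ≤-resp ≈-refl (ℝ.distribʳ _ _ _) (*-monoˡ-≤ (0≤w x) (χ-⊎ h)))

    0≤massAbove : ∀ {p z} {Q : Pred Carrier p} → (∀ {x} → Q x → z ≤ x) → 0# ≤ᴿ massAbove z Q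
    0≤massAbove below = 0≤sumOver faces λ x →
      ≤-resp (ℝ.zeroʳ _) ≈-refl (χ*-mono λ q → relWeight-pos (below q))

    massAbove-mono : ∀ {p q z} {P : Pred Carrier p} {Q : Pred Carrier q} →
                     (∀ {x} → Q x → z ≤ x) → (∀ {x} → P x → Q x) → massAbove z P ≤ᴿ massAbove z Q
    massAbove-mono {z = z} {P} {Q} below P⊆Q = sumOver-mono faces step
      where
      step : ∀ x → χ (P x) * relWeight z x ≤ᴿ χ (Q x) * relWeight z x
      step x with em {P = P x}
      ... | yes p = ≤-reflexive (ℝ.*-congʳ (≈-sym (χ-yes (P⊆Q p))))
      ... | no  _ = ≤-resp (≈-trans (ℝ.zeroʳ _) (≈-sym (ℝ.zeroˡ _))) ≈-refl
                      (χ*-mono λ q → relWeight-pos (below q))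

    massAbove≤1 : ∀ {p z i} {Q : Pred Carrier p} → (∀ {x} → Q x → dim x ≡ i × z ≤ x) →
                  dim z ℤ.≤ i → i ℤ.≤ pos d → massAbove z Q ≤ᴿ 1#
    massAbove≤1 {z = z} {i} {Q} h dz≤i i≤d =
      ≤-trans (massAbove-mono {Q = λ x → Faces i x × z ≤ x} proj₂ h)
              (≤-reflexive (relWeight-total z dz≤i i≤d))

    mass-cover : ∀ {p q s} {T : Pred Carrier p} {S : Pred Carrier s} {Q : Carrier → Pred Carrier q} →
                 (∀ {x} → T x → ∃ λ z → S z × Q z x) →
                 mass T ≤ᴿ Σᶠ X λ z → χ (S z) * mass (Q z)
    mass-cover {T = T} {S} {Q} h = begin
      mass T
        ≤⟨ sumOver-mono faces (λ x → *-monoˡ-≤ (0≤w x) (χ-∃ X h)) ⟩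
      Σᶠ X (λ x → Σᶠ X (λ z → χ (S z × Q z x)) * w x)
        ≈⟨ sumOver-cong faces (λ x → ≈-trans (ℝ.*-comm _ _) (≈-trans (sumOver-*ˡ faces _ _)
             (sumOver-cong faces λ z → ≈-trans (ℝ.*-congˡ χ-×)
               (solve 3 (λ a b c → a :* (b :* c) := b :* (c :* a)) ≈-refl _ _ _)))) ⟩
      Σᶠ X (λ x → Σᶠ X λ z → χ (S z) * (χ (Q z x) * w x))
        ≈⟨ sumOver-swap faces faces _ ⟩
      Σᶠ X (λ z → Σᶠ X λ x → χ (S z) * (χ (Q z x) * w x))
        ≈⟨ sumOver-cong faces (λ z → sumOver-*ˡ faces _ _) ⟨
      Σᶠ X (λ z → χ (S z) * mass (Q z)) ∎

    flow-≤ : ∀ {p q j} {S : Pred Carrier p} {Q : Carrier → Pred Carrier q} →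
             (∀ {z} → S z → dim z ≡ j) → (∀ {z x} → Q z x → z ≤ x) →
             Σᶠ X (λ z → χ (S z) * (w z * massAbove z (Q z))) ≤ᴿ μ * mass (λ x → ∃ λ z → S z × Q z x)
    flow-≤ {j = j} {S} {Q} dimS below = begin
      Σᶠ X (λ z → χ (S z) * (w z * massAbove z (Q z)))
        ≈⟨ sumOver-cong faces (λ z → ≈-trans (≈-sym (ℝ.*-assoc _ _ _)) (≈-trans (sumOver-*ˡ faces _ _)
             (sumOver-cong faces λ x → ≈-trans
               (solve 4 (λ s v q r → (s :* v) :* (q :* r) := (s :* q) :* (r :* v)) ≈-refl _ _ _ _)
               (ℝ.*-congʳ (≈-sym χ-×))))) ⟩
      Σᶠ X (λ z → Σᶠ X λ x → χ (S z × Q z x) * (relWeight z x * w z))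
        ≈⟨ sumOver-swap faces faces _ ⟩
      Σᶠ X (λ x → Σᶠ X λ z → χ (S z × Q z x) * (relWeight z x * w z))
        ≤⟨ sumOver-mono faces bound ⟩
      Σᶠ X (λ x → μ * (χ (∃ λ z → S z × Q z x) * w x))
        ≈⟨ sumOver-*ˡ faces _ _ ⟨
      μ * mass (λ x → ∃ λ z → S z × Q z x) ∎
      where
      bound : ∀ x → Σᶠ X (λ z → χ (S z × Q z x) * (relWeight z x * w z)) ≤ᴿ μ * (χ (∃ λ z → S z × Q z x) * w x)
      bound x with em {P = ∃ λ z → S z × Q z x}
      ... | no ∄ = ≤-reflexive (≈-trans
              (sumOver-ε faces λ z → ≈-trans (ℝ.*-congʳ (χ-no λ h → ∄ (z , h))) (ℝ.zeroˡ _))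
              (≈-sym (≈-trans (ℝ.*-congˡ (ℝ.zeroˡ _)) (ℝ.zeroʳ _))))
      ... | yes (z₀ , s₀ , q₀) = begin
        Σᶠ X (λ z → χ (S z × Q z x) * (relWeight z x * w z))
          ≤⟨ sumOver-mono faces (λ z → χ*-mono λ (s , q) →
               x*y≤z⇒x≤z*y⁻¹ n-pos (≤-resp (ℝ.*-comm _ _) ≈-refl (share z s q))) ⟩
        Σᶠ X (λ z → χ (S z × Q z x) * (μ * w x * n ⁻¹))
          ≤⟨ sumOver-mono faces (λ z → *-monoˡ-≤ 0≤μwn⁻¹ (χ-mono λ (s , q) → dimS s , below q)) ⟩
        Σᶠ X (λ z → χ (FacesOf x j z) * (μ * w x * n ⁻¹))
          ≈⟨ ≈-trans (sumOver-cong faces λ z → ℝ.*-comm _ _) (≈-sym (sumOver-*ˡ faces _ _)) ⟩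
        μ * w x * n ⁻¹ * Σᶠ X (λ z → χ (FacesOf x j z))
          ≈⟨ ℝ.*-congˡ (#≈Σᶠ X _) ⟨
        μ * w x * n ⁻¹ * n
          ≈⟨ ≈-trans (ℝ.*-assoc _ _ _) (≈-trans (ℝ.*-congˡ (*-inverseˡ n-pos)) (ℝ.*-identityʳ _)) ⟩
        μ * w x
          ≈⟨ ℝ.*-congˡ (ℝ.*-identityˡ _) ⟨
        μ * (1# * w x) ∎
        where
        n = fromℕ (# X (FacesOf x j))
        n-pos : 0# <ᴿ n
        n-pos = fromℕ-pos (#-pos X (dimS s₀ , below q₀))
        0≤μwn⁻¹ : 0# ≤ᴿ μ * w x * n ⁻¹
        0≤μwn⁻¹ = ℝ.*-nonNeg (ℝ.*-nonNeg 0≤μ (0≤w x)) (<⇒≤ (⁻¹-pos n-pos))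
        share : ∀ z → S z → Q z x → n * (relWeight z x * w z) ≤ᴿ μ * w x
        share z s q = ≤-resp (ℝ.*-congʳ (≈-reflexive (≡.cong (λ i → fromℕ (# X (FacesOf x i))) (dimS s)))) ≈-refl
          (relWeight-≤ (below q))

    massAbove-≤ : ∀ {p z n} {Q : Pred Carrier p} → (∀ {x} → Q x → z ≤ x) →
                  (∀ {x} → Q x → n ≤ᴿ fromℕ (# X (FacesOf x (dim z)))) →
                  n * (w z * massAbove z Q) ≤ᴿ μ * mass Q
    massAbove-≤ {z = z} {n} {Q} below n≤ = begin
      n * (w z * massAbove z Q)
        ≈⟨ ≈-trans (≈-sym (ℝ.*-assoc _ _ _)) (sumOver-*ˡ faces _ _) ⟩
      Σᶠ X (λ x → n * w z * (χ (Q x) * relWeight z x))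
        ≈⟨ sumOver-cong faces (λ x → solve 4 (λ n v q r → (n :* v) :* (q :* r) := q :* (n :* (r :* v))) ≈-refl _ _ _ _) ⟩
      Σᶠ X (λ x → χ (Q x) * (n * (relWeight z x * w z)))
        ≤⟨ sumOver-mono faces (λ x → χ*-mono λ q → ≤-trans
             (*-monoˡ-≤ (ℝ.*-nonNeg (relWeight-pos (below q)) (0≤w z)) (n≤ q))
             (relWeight-≤ (below q))) ⟩
      Σᶠ X (λ x → χ (Q x) * (μ * w x))
        ≈⟨ Σᶠ-*ˡ X _ _ ⟨
      μ * mass Q ∎

    ≤-massAbove : ∀ {p z n} {Q : Pred Carrier p} → (∀ {x} → Q x → z ≤ x) →
                  (∀ {x} → Q x → fromℕ (# X (FacesOf x (dim z))) ≤ᴿ n) →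
                  mass Q ≤ᴿ μ * n * (w z * massAbove z Q)
    ≤-massAbove {z = z} {n} {Q} below ≤n = begin
      mass Q
        ≤⟨ sumOver-mono faces (λ x → χ*-mono λ q → ≤-trans (≤-relWeight (below q))
             (*-monoʳ-≤ 0≤μ (*-monoˡ-≤ (ℝ.*-nonNeg (relWeight-pos (below q)) (0≤w z)) (≤n q)))) ⟩
      Σᶠ X (λ x → χ (Q x) * (μ * (n * (relWeight z x * w z))))
        ≈⟨ sumOver-cong faces (λ x → solve 5 (λ q m n r v → q :* (m :* (n :* (r :* v))) := m :* n :* v :* (q :* r)) ≈-refl _ _ _ _ _) ⟩
      Σᶠ X (λ x → μ * n * w z * (χ (Q x) * relWeight z x))
        ≈⟨ sumOver-*ˡ faces _ _ ⟨
      μ * n * w z * massAbove z Q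
        ≈⟨ ℝ.*-assoc _ _ _ ⟩
      μ * n * (w z * massAbove z Q) ∎

    mass-coboundary-≤ : ∀ {p q n} {S : Pred Carrier p} {T : Pred Carrier q} →
      (∀ {v} → S v → dim v ≡ 0ℤ) → 1ℤ ℤ.≤ pos d →
      (∀ {e} → dim e ≡ 1ℤ → fromℕ (# X (FacesOf e 0ℤ)) ≤ᴿ n) → 0# ≤ᴿ n →
      (∀ {e} → T e → dim e ≡ 1ℤ × ∃ λ v → S v × v ≤ e) →
      mass T ≤ᴿ μ * n * mass S
    mass-coboundary-≤ {n = n} {S} {T} dimS 1≤d ≤n 0≤n h = begin
      mass T
        ≤⟨ mass-cover {S = S} {Q = λ v e → Faces 1ℤ e × v ≤ e}
             (λ t → let de , v , s , v≤e = h t in v , s , de , v≤e) ⟩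
      Σᶠ X (λ v → χ (S v) * mass (λ e → Faces 1ℤ e × v ≤ e))
        ≤⟨ sumOver-mono faces (λ v → χ*-mono λ s → ≤-trans
             (≤-massAbove proj₂ λ (de , _) → ≡.subst (λ i → fromℕ (# X (FacesOf _ i)) ≤ᴿ n) (≡.sym (dimS s)) (≤n de))
             (*-monoʳ-≤ 0≤μn (x*y≤x (0≤w v)
               (massAbove≤1 id (≡.subst (ℤ._≤ 1ℤ) (≡.sym (dimS s)) (ℤ.+≤+ ℕ.z≤n)) 1≤d)))) ⟩
      Σᶠ X (λ v → χ (S v) * (μ * n * w v))
        ≈⟨ Σᶠ-*ˡ X _ _ ⟨
      μ * n * mass S ∎
      where
      0≤μn : 0# ≤ᴿ μ * n
      0≤μn = ℝ.*-nonNeg 0≤μ 0≤n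

    scaled-≤ : ∀ {p} {S : Pred Carrier p} {f : Carrier → Real} {k} → (∀ {z} → S z → k ≤ᴿ f z) →
               k * mass S ≤ᴿ Σᶠ X λ z → χ (S z) * (w z * f z)
    scaled-≤ {S = S} {f} {k} k≤f = begin
      k * mass S                         ≈⟨ Σᶠ-*ˡ X k w ⟩
      Σᶠ X (λ z → χ (S z) * (k * w z))   ≤⟨ sumOver-mono faces (λ z → χ*-mono λ s →
                                              ≤-resp (ℝ.*-comm _ _) ≈-refl (*-monoʳ-≤ (0≤w z) (k≤f s))) ⟩
      Σᶠ X (λ z → χ (S z) * (w z * f z)) ∎

    Distinct₀ : ∀ {p} → Pred Carrier p → Pred Carrier p
    Distinct₀ S e = Faces 1ℤ e × ∃₂ λ x y → S x × S y × x ≢ y × x ≤ e × y ≤ e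

    -- A nonzero 0-cocycle with support S is nonzero at a second vertex of any edge to which
    -- its value restricts nontrivially.
    cocycle-support-large : ∀ {p ε α β} {S : Pred Carrier p} → (∀ {v} → S v → dim v ≡ 0ℤ) →
      (∀ {v} → S v → ε ≤ᴿ massAbove v (λ e → dim e ≡ 1ℤ × v ≤ e × ∃ λ v′ → S v′ × v ≢ v′ × v′ ≤ e)) →
      mass (Distinct₀ S) ≤ᴿ α * mass S + β * mass S ^ 2 →
      (∃ λ v → S v) → ε ≤ᴿ μ * (α + β * mass S)
    cocycle-support-large {ε = ε} {α} {β} {S} dimS expand skeleton (v₀ , s₀) = *-cancelˡ-≤ mass-pos (begin
      m * ε                              ≈⟨ ℝ.*-comm _ _ ⟩
      ε * m                              ≤⟨ scaled-≤ expand ⟩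
      Σᶠ X (λ v → χ (S v) * (w v * massAbove v (Q v)))
                                         ≤⟨ flow-≤ dimS (proj₁ ∘ proj₂) ⟩
      μ * mass (λ e → ∃ λ v → S v × Q v e)
                                         ≤⟨ *-monoʳ-≤ 0≤μ (mass-mono λ (v , s , de , v≤e , v′ , s′ , v≢v′ , v′≤e) →
                                              de , v , v′ , s , s′ , v≢v′ , v≤e , v′≤e) ⟩
      μ * mass (Distinct₀ S)             ≤⟨ *-monoʳ-≤ 0≤μ skeleton ⟩
      μ * (α * m + β * m ^ 2)            ≈⟨ solve 4 (λ k a b m → k :* (a :* m :+ b :* (m :* (m :* con 1))) := m :* (k :* (a :+ b :* m))) ≈-refl _ _ _ _ ⟩
      m * (μ * (α + β * m))              ∎)
      where
      m = mass S
      Q : Carrier → Pred Carrier _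
      Q v e = dim e ≡ 1ℤ × v ≤ e × ∃ λ v′ → S v′ × v ≢ v′ × v′ ≤ e
      mass-pos : 0# <ᴿ m
      mass-pos = <-≤-trans (IsProperWeight.positive isProper v₀) (≤-resp
        (≈-trans (ℝ.*-congʳ (χ-yes s₀)) (ℝ.*-identityˡ _)) ≈-refl (≤Σᶠ X {λ x → χ (S x) * w x} (λ x → ℝ.*-nonNeg 0≤χ (0≤w x)) v₀))

    module SmallCocycle
      {A : Pred Carrier 0ℓ} (A⊆ : ∀ {e} → A e → dim e ≡ 1ℤ) (2≤d : pos 2 ℤ.≤ pos d)
      {n₋ n₊ V : Real} (0≤n₊ : 0# ≤ᴿ n₊) (1≤V : 1# ≤ᴿ V) (0<n₋ : 0# <ᴿ n₋)
      (n₋≤ : ∀ {e} → dim e ≡ 1ℤ → n₋ ≤ᴿ fromℕ (# X (FacesOf e 0ℤ)))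
      (≤n₊ : ∀ {e} → dim e ≡ 1ℤ → fromℕ (# X (FacesOf e 0ℤ)) ≤ᴿ n₊)
      (≤V : ∀ {z i} → dim z ≡ pos 2 → i ≡ 0ℤ ⊎ i ≡ 1ℤ → fromℕ (# X (FacesOf z i)) ≤ᴿ V)
      {ε q σ τ h₋₁ h₀ h∥ α₀ β₀ α₋₁ β₋₁ α∥ β∥ E : Real}
      (0≤ε : 0# ≤ᴿ ε) (0<h₀ : 0# <ᴿ h₀) (0≤σ : 0# ≤ᴿ σ) (0≤τ : 0# ≤ᴿ τ) (σ+τ≈1 : σ + τ ≈ 1#)
      (0≤α₀ : 0# ≤ᴿ α₀) (0≤β₀ : 0# ≤ᴿ β₀) (0≤α₋₁ : 0# ≤ᴿ α₋₁) (0≤β₋₁ : 0# ≤ᴿ β₋₁)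
      (0≤α∥ : 0# ≤ᴿ α∥) (0≤β∥ : 0# ≤ᴿ β∥)
      (0≤h₋₁ : 0# ≤ᴿ h₋₁) (0≤h∥ : 0# ≤ᴿ h∥)
      (small : (α₀ + β₀ * h₀) + (α∥ + β∥ * h∥) + (α₋₁ + β₋₁ * h₋₁) ÷ h₀ ≤ᴿ E * ε)
      (q-small : q * μ ≤ᴿ τ * (n₋ * h₀))
      where

      Aᵤ : Carrier → Pred Carrier 0ℓ
      Aᵤ u e = A e × u ≤ e

      Heavy Light HH AL AH : Pred Carrier 0ℓ
      Heavy u = dim u ≡ 0ℤ × h₀ ≤ᴿ massAbove u (Aᵤ u)
      Light u = dim u ≡ 0ℤ × ¬ Heavy u
      HH = Distinct₀ Heavy
      AL e = A e × (∀ {u} → Heavy u → ¬ u ≤ e)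
      AH e = A e × ∃ λ u → Heavy u × u ≤ e

      -- The 2-faces seen by a nonzero value at the edge e.
      AtEdge : Carrier → Pred Carrier 0ℓ
      AtEdge e z = dim z ≡ pos 2 × e ≤ z × ∃ λ e′ → A e′ × e ≢ e′ × e′ ≤ z

      -- The 2-faces at which the coboundary in the link of u of the restriction to u may be nonzero.
      AtVertex : Carrier → Pred Carrier 0ℓ
      AtVertex u z = dim z ≡ pos 2 × u ≤ z × ∃₂ λ e e′ → A e × A e′ × u ≤ e × e ≤ z × ¬ u ≤ e′ × e′ ≤ z

      TwoAbove : Carrier → Pred Carrier 0ℓ
      TwoAbove u z = dim z ≡ pos 2 × u ≤ z × ∃₂ λ e e′ → A e × A e′ × e ≢ e′ × u ≤ e × u ≤ e′ × e ≤ z × e′ ≤ z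

      Disjoint : Pred Carrier 0ℓ
      Disjoint z = Faces (pos 2) z × ∃₂ λ x y →
        A x × A y × x ≢ y × x < z × y < z × Inf (｛ x ｝ ∪ ｛ y ｝) ≐ ｛ ∅ ｝

      AtLight AtHH Bad : Pred Carrier 0ℓ
      AtLight z = ∃ λ u → Light u × TwoAbove u z
      AtHH z = dim z ≡ pos 2 × ∃ λ e → HH e × e ≤ z
      Bad z = Disjoint z ⊎ AtLight z ⊎ AtHH z

      private
        edge< : ∀ {e z} → A e → e ≤ z → dim z ≡ pos 2 → e < z
        edge< a e≤z dz = ≤∧dim<⇒< e≤z (≡.subst₂ ℤ._<_ (≡.sym (A⊆ a)) (≡.sym dz) (ℤ.+<+ (ℕ.s≤s (ℕ.s≤s ℕ.z≤n))))

        dim≤-1⇒≡∅ : ∀ {b} → dim b ℤ.≤ -1ℤ → b ≡ ∅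
        dim≤-1⇒≡∅ {b} h = ≡.sym (≤∧dim≡⇒≡ (∅-min b)
          (≡.trans dim-∅ (ℤₚ.≤-antisym (-1≤dim b) h)))

      -- Two distinct edges with no common vertex have no common lower bound but ∅.
      disjoint-or-meet : ∀ {e e′ z} → dim z ≡ pos 2 → A e → A e′ → e ≢ e′ → e ≤ z → e′ ≤ z →
                         Disjoint z ⊎ ∃ λ u → dim u ≡ 0ℤ × u ≤ e × u ≤ e′
      disjoint-or-meet {e} {e′} dz a a′ e≢e′ e≤z e′≤z with em {P = ∃ λ u → dim u ≡ 0ℤ × u ≤ e × u ≤ e′}
      ... | yes meet = inj₂ meet
      ... | no  none = inj₁ (dz , e , e′ , a , a′ , e≢e′ , edge< a e≤z dz , edge< a′ e′≤z dz ,
                       (λ (lower , _) → ≡.sym (only-∅ lower)) ,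
                       λ { ≡.refl → (λ {_} _ → ∅-min _) , λ lower _ → only-∅ lower })
        where
        only-∅ : ∀ {b} → LowerBound (｛ e ｝ ∪ ｛ e′ ｝) b → b ≡ ∅
        only-∅ {b} lower = dim≤-1⇒≡∅ (ℤₚ.≮⇒≥ λ -1<db → -1<db⇒⊥ (ℤₚ.i<j⇒suc[i]≤j -1<db))
          where
          b≤e = lower (inj₁ ≡.refl)
          b≤e′ = lower (inj₂ ≡.refl)
          db<1 : dim b ℤ.< 1ℤ
          db<1 = ℤₚ.≰⇒> λ 1≤db → e≢e′ (≡.trans (≡.sym (top b≤e (A⊆ a) 1≤db)) (top b≤e′ (A⊆ a′) 1≤db))
            where
            top : ∀ {f} → b ≤ f → dim f ≡ 1ℤ → 1ℤ ℤ.≤ dim b → b ≡ f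
            top b≤f df 1≤db = ≤∧dim≡⇒≡ b≤f (ℤₚ.≤-antisym (dim-mono b≤f) (≡.subst (ℤ._≤ dim b) (≡.sym df) 1≤db))
          -1<db⇒⊥ : ¬ 0ℤ ℤ.≤ dim b
          -1<db⇒⊥ 0≤db = none (b , ℤₚ.≤-antisym (ℤₚ.i<j⇒i≤pred[j] db<1) 0≤db , b≤e , b≤e′)

      atEdge-bad : ∀ {e z} → AL e → AtEdge e z → Bad z
      atEdge-bad (a , light) (dz , e≤z , e′ , a′ , e≢e′ , e′≤z) with disjoint-or-meet dz a a′ e≢e′ e≤z e′≤z
      ... | inj₁ disjoint               = inj₁ disjoint
      ... | inj₂ (u , du , u≤e , u≤e′) = inj₂ (inj₁ (u , (du , λ heavy → light heavy u≤e) ,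
              dz , ≼-trans u≤e e≤z , _ , e′ , a , a′ , e≢e′ , u≤e , u≤e′ , e≤z , e′≤z))

      atVertex-bad : ∀ {u z} → Heavy u → AtVertex u z → Bad z
      atVertex-bad {u} hu (dz , u≤z , e , e′ , a , a′ , u≤e , e≤z , u≰e′ , e′≤z)
        with disjoint-or-meet dz a a′ (λ { ≡.refl → u≰e′ u≤e }) e≤z e′≤z
      ... | inj₁ disjoint = inj₁ disjoint
      ... | inj₂ (v , dv , v≤e , v≤e′) with em {P = Heavy v}
      ...   | no  light = inj₂ (inj₁ (v , (dv , light) , dz , ≼-trans v≤e e≤z , e , e′ , a , a′ ,
                            (λ { ≡.refl → u≰e′ u≤e }) , v≤e , v≤e′ , e≤z , e′≤z))
      ...   | yes hv    = inj₂ (inj₂ (dz , e , (A⊆ a , u , v , hu , hv , (λ { ≡.refl → u≰e′ v≤e′ }) , u≤e , v≤e) , e≤z))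

      module _
        (edges : ∀ {e} → A e → ε ≤ᴿ massAbove e (AtEdge e))
        (vertices : ∀ {u} → dim u ≡ 0ℤ →
          ε * mass (Aᵤ u) ≤ᴿ ε * (q * w u) + μ * n₊ * (w u * massAbove u (AtVertex u)))
        (skeleton₀ : ∀ {u} → dim u ≡ 0ℤ →
          massAbove u (TwoAbove u) ≤ᴿ α₀ * massAbove u (Aᵤ u) + β₀ * massAbove u (Aᵤ u) ^ 2)
        (skeleton₋₁ : mass HH ≤ᴿ α₋₁ * mass Heavy + β₋₁ * mass Heavy ^ 2)
        (skeleton∥ : mass Disjoint ≤ᴿ α∥ * mass A + β∥ * mass A ^ 2)
        (mass≤h∥ : mass A ≤ᴿ h∥) (mass≤h₀h₋₁ : μ * mass A ≤ᴿ h₀ * h₋₁)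
        where

        private
          m b Z N K : Real
          m = mass A
          b = mass Bad
          Z = α₀ + β₀ * h₀
          N = α∥ + β∥ * h∥
          K = (α₋₁ + β₋₁ * h₋₁) ÷ h₀

          0≤m = 0≤mass A
          0≤h₀ = <⇒≤ 0<h₀
          0≤V = ≤-trans 0≤1 1≤V

          +-nonNeg : ∀ {x y} → 0# ≤ᴿ x → 0# ≤ᴿ y → 0# ≤ᴿ x + y
          +-nonNeg 0≤x 0≤y = ≤-resp (ℝ.+-identityˡ _) ≈-refl (+-mono-≤ 0≤x 0≤y)

          0≤Z = +-nonNeg 0≤α₀ (ℝ.*-nonNeg 0≤β₀ 0≤h₀)
          0≤N = +-nonNeg 0≤α∥ (ℝ.*-nonNeg 0≤β∥ 0≤h∥)
          0≤K′ = +-nonNeg 0≤α₋₁ (ℝ.*-nonNeg 0≤β₋₁ 0≤h₋₁)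
          0≤K = ℝ.*-nonNeg 0≤K′ (<⇒≤ (⁻¹-pos 0<h₀))

          quadratic : ∀ {α β h t} → 0# ≤ᴿ β → 0# ≤ᴿ t → t ≤ᴿ h → α * t + β * t ^ 2 ≤ᴿ (α + β * h) * t
          quadratic {α} {β} {h} {t} 0≤β 0≤t t≤h = begin
            α * t + β * t ^ 2   ≈⟨ solve 3 (λ a b t → a :* t :+ b :* (t :* (t :* con 1)) := (a :+ b :* t) :* t) ≈-refl α β t ⟩
            (α + β * t) * t     ≤⟨ *-monoˡ-≤ 0≤t (ℝ.+-monoʳ-≤ α (*-monoʳ-≤ 0≤β t≤h)) ⟩
            (α + β * h) * t     ∎

        mass-AL : ε * mass AL ≤ᴿ μ * b
        mass-AL = begin
          ε * mass AL
            ≤⟨ scaled-≤ (λ (a , _) → edges a) ⟩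
          Σᶠ X (λ e → χ (AL e) * (w e * massAbove e (AtEdge e)))
            ≤⟨ flow-≤ (A⊆ ∘ proj₁) (proj₁ ∘ proj₂) ⟩
          μ * mass (λ z → ∃ λ e → AL e × AtEdge e z)
            ≤⟨ *-monoʳ-≤ 0≤μ (mass-mono λ (e , al , at) → atEdge-bad al at) ⟩
          μ * b ∎

        heavy-≤ : ∀ {u} → Heavy u → σ * ε * mass (Aᵤ u) ≤ᴿ μ * n₊ * (w u * massAbove u (AtVertex u))
        heavy-≤ {u} (du , h₀≤) = +-cancelˡ-≤ (ε * (τ * a)) (begin
          ε * (τ * a) + σ * ε * a
            ≈⟨ solve 4 (λ e t s a → e :* (t :* a) :+ s :* e :* a := (s :+ t) :* (e :* a)) ≈-refl _ _ _ _ ⟩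
          (σ + τ) * (ε * a)
            ≈⟨ ≈-trans (ℝ.*-congʳ σ+τ≈1) (ℝ.*-identityˡ _) ⟩
          ε * a
            ≤⟨ vertices du ⟩
          ε * (q * w u) + μ * n₊ * (w u * massAbove u (AtVertex u))
            ≤⟨ +-monoˡ-≤ _ (*-monoʳ-≤ 0≤ε (*-cancelˡ-≤ (1≤⇒0< 1≤μ) q-bound)) ⟩
          ε * (τ * a) + μ * n₊ * (w u * massAbove u (AtVertex u)) ∎)
          where
          a = mass (Aᵤ u)
          q-bound : μ * (q * w u) ≤ᴿ μ * (τ * a)
          q-bound = begin
            μ * (q * w u)
              ≈⟨ solve 3 (λ m q v → m :* (q :* v) := (q :* m) :* v) ≈-refl _ _ _ ⟩
            q * μ * w u
              ≤⟨ *-monoˡ-≤ (0≤w u) q-small ⟩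
            τ * (n₋ * h₀) * w u
              ≈⟨ solve 4 (λ t n h v → t :* (n :* h) :* v := t :* (n :* (v :* h))) ≈-refl _ _ _ _ ⟩
            τ * (n₋ * (w u * h₀))
              ≤⟨ *-monoʳ-≤ 0≤τ (*-monoʳ-≤ (<⇒≤ 0<n₋) (*-monoʳ-≤ (0≤w u) h₀≤)) ⟩
            τ * (n₋ * (w u * massAbove u (Aᵤ u)))
              ≤⟨ *-monoʳ-≤ 0≤τ (massAbove-≤ proj₂ λ (a , _) →
                   ≡.subst (λ i → n₋ ≤ᴿ fromℕ (# X (FacesOf _ i))) (≡.sym du) (n₋≤ (A⊆ a))) ⟩
            τ * (μ * a)
              ≈⟨ *-left-comm _ _ _ ⟩
            μ * (τ * a) ∎

        mass-AH : σ * ε * mass AH ≤ᴿ μ * n₊ * (μ * b)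
        mass-AH = begin
          σ * ε * mass AH
            ≤⟨ *-monoʳ-≤ (ℝ.*-nonNeg 0≤σ 0≤ε) (mass-cover {S = Heavy} {Q = Aᵤ} λ (a , u , hu , u≤e) → u , hu , a , u≤e) ⟩
          σ * ε * Σᶠ X (λ u → χ (Heavy u) * mass (Aᵤ u))
            ≈⟨ Σᶠ-*ˡ X _ _ ⟩
          Σᶠ X (λ u → χ (Heavy u) * (σ * ε * mass (Aᵤ u)))
            ≤⟨ sumOver-mono faces (λ u → χ*-mono heavy-≤) ⟩
          Σᶠ X (λ u → χ (Heavy u) * (μ * n₊ * (w u * massAbove u (AtVertex u))))
            ≈⟨ Σᶠ-*ˡ X _ _ ⟨
          μ * n₊ * Σᶠ X (λ u → χ (Heavy u) * (w u * massAbove u (AtVertex u)))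
            ≤⟨ *-monoʳ-≤ (ℝ.*-nonNeg 0≤μ 0≤n₊) (flow-≤ proj₁ (proj₁ ∘ proj₂)) ⟩
          μ * n₊ * (μ * mass (λ z → ∃ λ u → Heavy u × AtVertex u z))
            ≤⟨ *-monoʳ-≤ (ℝ.*-nonNeg 0≤μ 0≤n₊) (*-monoʳ-≤ 0≤μ (mass-mono λ (u , hu , at) → atVertex-bad hu at)) ⟩
          μ * n₊ * (μ * b) ∎

        mass-A : σ * ε * m ≤ᴿ (σ + n₊) * (μ * μ) * b
        mass-A = begin
          σ * ε * m
            ≤⟨ *-monoʳ-≤ (ℝ.*-nonNeg 0≤σ 0≤ε) (mass-⊎ split) ⟩
          σ * ε * (mass AL + mass AH)
            ≈⟨ solve 4 (λ s e x y → s :* e :* (x :+ y) := s :* (e :* x) :+ s :* e :* y) ≈-refl _ _ _ _ ⟩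
          σ * (ε * mass AL) + σ * ε * mass AH
            ≤⟨ +-mono-≤ (*-monoʳ-≤ 0≤σ (≤-trans mass-AL (*-monoˡ-≤ (0≤mass Bad) (x≤x*y 0≤μ 1≤μ)))) mass-AH ⟩
          σ * (μ * μ * b) + μ * n₊ * (μ * b)
            ≈⟨ solve 4 (λ s n m b → s :* (m :* m :* b) :+ m :* n :* (m :* b) := (s :+ n) :* (m :* m) :* b) ≈-refl _ _ _ _ ⟩
          (σ + n₊) * (μ * μ) * b ∎
          where
          split : ∀ {e} → A e → AL e ⊎ AH e
          split {e} a with em {P = ∃ λ u → Heavy u × u ≤ e}
          ... | yes h = inj₂ (a , h)
          ... | no  h = inj₁ (a , λ hu u≤e → h (_ , hu , u≤e))

        mass-Disjoint : mass Disjoint ≤ᴿ N * m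
        mass-Disjoint = ≤-trans skeleton∥ (quadratic 0≤β∥ 0≤m mass≤h∥)

        flow-Aᵤ : ∀ {p} {S : Pred Carrier p} → (∀ {u} → S u → dim u ≡ 0ℤ) →
                  Σᶠ X (λ u → χ (S u) * (w u * massAbove u (Aᵤ u))) ≤ᴿ μ * m
        flow-Aᵤ dimS = ≤-trans (flow-≤ dimS proj₂) (*-monoʳ-≤ 0≤μ (mass-mono λ (_ , _ , a , _) → a))

        mass-AtLight : mass AtLight ≤ᴿ μ * V * Z * (μ * m)
        mass-AtLight = begin
          mass AtLight
            ≤⟨ mass-cover id ⟩
          Σᶠ X (λ u → χ (Light u) * mass (TwoAbove u))
            ≤⟨ sumOver-mono faces (λ u → χ*-mono light-≤) ⟩
          Σᶠ X (λ u → χ (Light u) * (μ * V * Z * (w u * massAbove u (Aᵤ u))))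
            ≈⟨ Σᶠ-*ˡ X _ _ ⟨
          μ * V * Z * Σᶠ X (λ u → χ (Light u) * (w u * massAbove u (Aᵤ u)))
            ≤⟨ *-monoʳ-≤ (ℝ.*-nonNeg 0≤μV 0≤Z) (flow-Aᵤ proj₁) ⟩
          μ * V * Z * (μ * m) ∎
          where
          0≤μV = ℝ.*-nonNeg 0≤μ 0≤V
          light-≤ : ∀ {u} → Light u → mass (TwoAbove u) ≤ᴿ μ * V * Z * (w u * massAbove u (Aᵤ u))
          light-≤ {u} (du , light) = begin
            mass (TwoAbove u)
              ≤⟨ ≤-massAbove (proj₁ ∘ proj₂) (λ (dz , _) → ≤V dz (inj₁ du)) ⟩
            μ * V * (w u * massAbove u (TwoAbove u))
              ≤⟨ *-monoʳ-≤ 0≤μV (*-monoʳ-≤ (0≤w u) (≤-trans (skeleton₀ du)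
                   (quadratic 0≤β₀ (0≤massAbove proj₂) (<⇒≤ (≰⇒> λ h → light (du , h)))))) ⟩
            μ * V * (w u * (Z * massAbove u (Aᵤ u)))
              ≈⟨ solve 4 (λ k v z a → k :* (v :* (z :* a)) := k :* z :* (v :* a)) ≈-refl _ _ _ _ ⟩
            μ * V * Z * (w u * massAbove u (Aᵤ u)) ∎

        h₀*Heavy : h₀ * mass Heavy ≤ᴿ μ * m
        h₀*Heavy = ≤-trans (scaled-≤ proj₂) (flow-Aᵤ proj₁)

        mass-AtHH : mass AtHH ≤ᴿ μ * V * (K * (μ * m))
        mass-AtHH = begin
          mass AtHH
            ≤⟨ mass-cover {S = HH} {Q = λ e z → Faces (pos 2) z × e ≤ z} (λ (dz , e , hh , e≤z) → e , hh , dz , e≤z) ⟩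
          Σᶠ X (λ e → χ (HH e) * mass (λ z → Faces (pos 2) z × e ≤ z))
            ≤⟨ sumOver-mono faces (λ e → χ*-mono λ (de , _) → ≤-trans
                 (≤-massAbove proj₂ λ (dz , _) → ≤V dz (inj₂ de))
                 (*-monoʳ-≤ 0≤μV (x*y≤x (0≤w e) (massAbove≤1 id (≡.subst (ℤ._≤ pos 2) (≡.sym de) (ℤ.+≤+ (ℕ.s≤s ℕ.z≤n))) 2≤d)))) ⟩
          Σᶠ X (λ e → χ (HH e) * (μ * V * w e))
            ≈⟨ Σᶠ-*ˡ X _ _ ⟨
          μ * V * mass HH
            ≤⟨ *-monoʳ-≤ 0≤μV (≤-trans skeleton₋₁ (quadratic 0≤β₋₁ (0≤mass Heavy) Heavy≤h₋₁)) ⟩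
          μ * V * ((α₋₁ + β₋₁ * h₋₁) * mass Heavy)
            ≤⟨ *-monoʳ-≤ 0≤μV (*-monoʳ-≤ 0≤K′ (x*y≤z⇒x≤z*y⁻¹ 0<h₀ (≤-resp (ℝ.*-comm _ _) ≈-refl h₀*Heavy))) ⟩
          μ * V * ((α₋₁ + β₋₁ * h₋₁) * (μ * m * h₀ ⁻¹))
            ≈⟨ solve 4 (λ k a m i → k :* (a :* (m :* i)) := k :* (a :* i :* m)) ≈-refl _ _ _ _ ⟩
          μ * V * (K * (μ * m)) ∎
          where
          0≤μV = ℝ.*-nonNeg 0≤μ 0≤V
          Heavy≤h₋₁ : mass Heavy ≤ᴿ h₋₁
          Heavy≤h₋₁ = *-cancelˡ-≤ 0<h₀ (≤-trans h₀*Heavy mass≤h₀h₋₁)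

        mass-Bad : b ≤ᴿ μ * μ * V * (E * ε) * m
        mass-Bad = begin
          b
            ≤⟨ mass-⊎ id ⟩
          mass Disjoint + mass (λ z → AtLight z ⊎ AtHH z)
            ≤⟨ +-mono-≤ (≤-trans mass-Disjoint N-scaled) (≤-trans (mass-⊎ id) (+-mono-≤ mass-AtLight mass-AtHH)) ⟩
          μ * V * (N * (μ * m)) + (μ * V * Z * (μ * m) + μ * V * (K * (μ * m)))
            ≈⟨ solve 6 (λ m v n z k a → m :* v :* (n :* (m :* a)) :+ (m :* v :* z :* (m :* a) :+ m :* v :* (k :* (m :* a)))
                 := m :* m :* v :* (z :+ n :+ k) :* a) ≈-refl μ V N Z K m ⟩
          μ * μ * V * (Z + N + K) * m
            ≤⟨ *-monoˡ-≤ 0≤m (*-monoʳ-≤ (ℝ.*-nonNeg (ℝ.*-nonNeg 0≤μ 0≤μ) 0≤V) small) ⟩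
          μ * μ * V * (E * ε) * m ∎
          where
          N-scaled : N * m ≤ᴿ μ * V * (N * (μ * m))
          N-scaled = begin
            N * m                 ≤⟨ *-monoʳ-≤ 0≤N (≤-resp ≈-refl (ℝ.*-comm _ _) (x≤x*y 0≤m 1≤μ)) ⟩
            N * (μ * m)           ≤⟨ x≤x*y (ℝ.*-nonNeg 0≤N (ℝ.*-nonNeg 0≤μ 0≤m)) (≤-trans 1≤μ (x≤x*y 0≤μ 1≤V)) ⟩
            N * (μ * m) * (μ * V) ≈⟨ ℝ.*-comm _ _ ⟩
            μ * V * (N * (μ * m)) ∎

        support-empty : 0# <ᴿ ε → (σ + n₊) * V * (μ * μ * μ * μ) * E <ᴿ σ → ∀ {e} → ¬ A e
        support-empty 0<ε E-small {e} a = <⇒≱ (*-monoʳ-< (*-pos 0<ε 0<m) E-small) (begin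
          ε * m * σ
            ≈⟨ solve 3 (λ e m s → e :* m :* s := s :* e :* m) ≈-refl _ _ _ ⟩
          σ * ε * m
            ≤⟨ mass-A ⟩
          (σ + n₊) * (μ * μ) * b
            ≤⟨ *-monoʳ-≤ (ℝ.*-nonNeg (+-nonNeg 0≤σ 0≤n₊) (ℝ.*-nonNeg 0≤μ 0≤μ)) mass-Bad ⟩
          (σ + n₊) * (μ * μ) * (μ * μ * V * (E * ε) * m)
            ≈⟨ solve 6 (λ s k v e c a → s :* (k :* k) :* (k :* k :* v :* (e :* c) :* a) := c :* a :* (s :* v :* (k :* k :* k :* k) :* e))
                 ≈-refl (σ + n₊) μ V E ε m ⟩
          ε * m * ((σ + n₊) * V * (μ * μ * μ * μ) * E) ∎)
          where
          0<m : 0# <ᴿ m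
          0<m = <-≤-trans (IsProperWeight.positive isProper e) (≤-resp
            (≈-trans (ℝ.*-congʳ (χ-yes a)) (ℝ.*-identityˡ _)) ≈-refl
            (≤Σᶠ X {λ x → χ (A x) * w x} (λ x → ℝ.*-nonNeg 0≤χ (0≤w x)) e))

module SheafCochains (em : ∀ {ℓ} → ExcludedMiddle ℓ) (ℝ : CompleteOrderedField) where
  open Classical em ℝ hiding (module ℝ)
  private module ℝ = CompleteOrderedField ℝ

  extend-yes : ∀ {p a} {P : Set p} {A : Set a} (h : .P → A) (z : A) (p : P) → extend (em {P = P}) h z ≡ h p
  extend-yes {P = P} h z p with em {P = P}
  ... | yes _ = ≡.refl
  ... | no ¬p = ⊥-elim (¬p p)

  extend-no : ∀ {p a} {P : Set p} {A : Set a} (h : .P → A) (z : A) → ¬ P → extend (em {P = P}) h z ≡ z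
  extend-no {P = P} h z ¬p with em {P = P}
  ... | yes p = ⊥-elim (¬p p)
  ... | no _  = ≡.refl

  module _ {c ℓ} (M : CommutativeMonoid c ℓ) where
    open CommutativeMonoid M renaming (_≈_ to _≈′_)
    open ListSum M

    sumOver-link : ∀ {X : GradedPoset} (u : GradedPoset.Carrier X) →
      let open GradedPoset X using (_≤_) in
      {g : LinkFace X u → CommutativeMonoid.Carrier M} {h : GradedPoset.Carrier X → CommutativeMonoid.Carrier M} →
      (∀ {x} (u≤x : u ≤ x) → g (x , [ u≤x ]) ≈′ h x) → (∀ {x} → ¬ u ≤ x → h x ≈′ ε) →
      ∀ xs → sumOver (above X u xs) g ≈′ sumOver xs h
    sumOver-link u g≈h h≈ε [] = refl
    sumOver-link {X} u g≈h h≈ε (x ∷ xs) with em {P = GradedPoset._≤_ X u x}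
    ... | yes u≤x = ∙-cong (g≈h u≤x) (sumOver-link {X} u g≈h h≈ε xs)
    ... | no  u≰x = trans (sumOver-link {X} u g≈h h≈ε xs) (trans (sym (identityˡ _)) (∙-congʳ (sym (h≈ε u≰x))))

  module Coboundary {r ℓr m ℓm} {R : CommutativeRing r ℓr} (X : GradedPoset)
                    (or : Incidence R X) (𝓕 : Sheaf R X m ℓm) where
    open GradedPoset X renaming (≤-refl to ≼-refl; ≤-trans to ≼-trans)
    open Grading em X
    open Sheaf 𝓕
    open Cochains {R = R} X or 𝓕
    open module Res {x y} .(x<y : x < y) = ModuleMorphisms.IsModuleHomomorphism (res-hom x<y)
      public using () renaming (⟦⟧-cong to res-cong; 0ᴹ-homo to res-0; +ᴹ-homo to res-+; *ₗ-homo to res-*)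
    private
      module R = CommutativeRing R
      module S (x : Carrier) = Module (stalk x)
      Sum : ∀ y → (Carrier → S.Carrierᴹ y) → S.Carrierᴹ y
      Sum y = ListSum.sumOver (S.+ᴹ-commutativeMonoid y) faces

    face-< : ∀ {i x y} → FacesOf y i x → Faces (ℤ.suc i) y → x < y
    face-< {i} (dx , x≤y) dy = x≤y , λ { ≡.refl → ℤₚ.i≢suc[i] (≡.trans (≡.sym dx) dy) }

    term : ∀ {i} (f : C i) y → .(Faces (ℤ.suc i) y) → Carrier → S.Carrierᴹ y
    term {i} f y p x = extend (em {P = FacesOf y i x})
      (λ q → S._*ₗ_ y (or y x) (res (face-< q p) (f x (proj₁ q)))) (S.0ᴹ y)

    d≡Sum : ∀ {i} (f : C i) y .(p : Faces (ℤ.suc i) y) → d f y p ≡ Sum y (term f y p)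
    d≡Sum f y p = ListSum.sum-lookup (S.+ᴹ-commutativeMonoid y) faces (term f y p)

    module _ {i : ℤ} where

      term-yes : ∀ (f : C i) {y} .(p : Faces (ℤ.suc i) y) {x} (q : FacesOf y i x) →
                 term f y p x ≡ S._*ₗ_ y (or y x) (res (face-< q p) (f x (proj₁ q)))
      term-yes f p {x} q = extend-yes (λ q → S._*ₗ_ _ (or _ x) (res (face-< q p) (f x (proj₁ q)))) (S.0ᴹ _) q

      term-no : ∀ (f : C i) {y} .(p : Faces (ℤ.suc i) y) {x} → ¬ FacesOf y i x → term f y p x ≡ S.0ᴹ y
      term-no f p {x} = extend-no (λ q → S._*ₗ_ _ (or _ x) (res (face-< q p) (f x (proj₁ q)))) (S.0ᴹ _)

      term-cong : ∀ {f g : C i} {y} .{p : Faces (ℤ.suc i) y} →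
                  (∀ {x} → x ≤ y → .(q : Faces i x) → S._≈ᴹ_ x (f x q) (g x q)) →
                  ∀ x → S._≈ᴹ_ y (term f y p x) (term g y p x)
      term-cong {f} {g} {y} {p} f≈g x with em {P = FacesOf y i x}
      ... | yes q = S.*ₗ-congˡ y (res-cong (face-< q p) (f≈g (proj₂ q) (proj₁ q)))
      ... | no _  = S.≈ᴹ-refl y

      d-cong : ∀ {f g : C i} {y} .{p : Faces (ℤ.suc i) y} →
               (∀ {x} → x ≤ y → .(q : Faces i x) → S._≈ᴹ_ x (f x q) (g x q)) →
               S._≈ᴹ_ y (d f y p) (d g y p)
      d-cong {f} {g} {y} {p} f≈g rewrite d≡Sum f y p | d≡Sum g y p =
        ListSum.sumOver-cong (S.+ᴹ-commutativeMonoid y) faces (term-cong {f} {g} {y} {p} (λ {x} → f≈g {x}))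

      d-reindex : ∀ {i′} → i ≡ i′ → ∀ {f : C i} {g : C i′} {y} .{p : Faces (ℤ.suc i) y} .{q : Faces (ℤ.suc i′) y} →
                  (∀ {x} → x ≤ y → .(p′ : Faces i x) .(q′ : Faces i′ x) → S._≈ᴹ_ x (f x p′) (g x q′)) →
                  S._≈ᴹ_ y (d f y p) (d g y q)
      d-reindex ≡.refl {f} {g} {y} {p} f≈g = d-cong {f} {g} {y} {p} λ x≤y q → f≈g x≤y q q

      term-0 : ∀ {f : C i} {y} .{p : Faces (ℤ.suc i) y} {x} →
               (x ≤ y → .(q : Faces i x) → S._≈ᴹ_ x (f x q) (S.0ᴹ x)) → S._≈ᴹ_ y (term f y p x) (S.0ᴹ y)
      term-0 {f} {y} {p} {x} f≈0 with em {P = FacesOf y i x}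
      ... | yes q = S.≈ᴹ-trans y (S.*ₗ-congˡ y (S.≈ᴹ-trans y
              (res-cong (face-< q p) (f≈0 (proj₂ q) (proj₁ q)))
              (res-0 (face-< q p)))) (S.*ₗ-zeroʳ y _)
      ... | no _  = S.≈ᴹ-refl y

      d-0 : ∀ {f : C i} {y} .{p : Faces (ℤ.suc i) y} →
            (∀ {x} → x ≤ y → .(q : Faces i x) → S._≈ᴹ_ x (f x q) (S.0ᴹ x)) → S._≈ᴹ_ y (d f y p) (S.0ᴹ y)
      d-0 {f} {y} {p} f≈0 rewrite d≡Sum f y p =
        ListSum.sumOver-ε (S.+ᴹ-commutativeMonoid y) faces λ x → term-0 {f} {y} {p} {x} f≈0

      d-+ : ∀ (f g : C i) {y} .{p : Faces (ℤ.suc i) y} → S._≈ᴹ_ y (d (f +ᶜ g) y p) ((d f +ᶜ d g) y p)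
      d-+ f g {y} {p} rewrite d≡Sum (f +ᶜ g) y p | d≡Sum f y p | d≡Sum g y p =
        S.≈ᴹ-trans y (ListSum.sumOver-cong (S.+ᴹ-commutativeMonoid y) faces term-+)
          (ListSum.sumOver-∙ (S.+ᴹ-commutativeMonoid y) faces (term f y p) (term g y p))
        where
        term-+ : ∀ x → S._≈ᴹ_ y (term (f +ᶜ g) y p x) (S._+ᴹ_ y (term f y p x) (term g y p x))
        term-+ x with em {P = FacesOf y i x}
        ... | yes q = S.≈ᴹ-trans y (S.*ₗ-congˡ y (res-+ (face-< q p) _ _))
                                   (S.*ₗ-distribˡ y _ _ _)
        ... | no _  = S.≈ᴹ-sym y (S.+ᴹ-identityˡ y _)

      module _ (isOrientation : IsOrientation R X or) where

        d∘d≈0 : ∀ (f : C i) z .(p : Faces (ℤ.suc (ℤ.suc i)) z) → S._≈ᴹ_ z (d (d f) z p) (S.0ᴹ z)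
        d∘d≈0 f z p′ rewrite d≡Sum (d f) z p′ = begin
          Sum z (term (d f) z p′)
            ≈⟨ sumOver-cong faces expand ⟩
          Sum z (λ y → Sum z (double y))
            ≈⟨ sumOver-swap faces faces double ⟩
          Sum z (λ x → Sum z (λ y → double y x))
            ≈⟨ sumOver-ε faces column ⟩
          S.0ᴹ z ∎
          where
          open ListSum (S.+ᴹ-commutativeMonoid z)
          open import Relation.Binary.Reasoning.Setoid (CommutativeMonoid.setoid (S.+ᴹ-commutativeMonoid z))

          p : Faces (ℤ.suc (ℤ.suc i)) z
          p = recompute (dim z ℤₚ.≟ ℤ.suc (ℤ.suc i)) p′

          double : Carrier → Carrier → S.Carrierᴹ z
          double y x = extend (em {P = FacesOf z (ℤ.suc i) y}) (λ q →
            S._*ₗ_ z (or z y) (res (face-< q p) (term f y (proj₁ q) x))) (S.0ᴹ z)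

          expand : ∀ y → S._≈ᴹ_ z (term (d f) z p′ y) (Sum z (double y))
          expand y with em {P = FacesOf z (ℤ.suc i) y}
          ... | no _  = S.≈ᴹ-sym z (sumOver-ε faces λ _ → S.≈ᴹ-refl z)
          ... | yes q rewrite d≡Sum f y (proj₁ q) = distribute faces
            where
            distribute : ∀ xs → S._≈ᴹ_ z
              (S._*ₗ_ z (or z y) (res (face-< q p) (ListSum.sumOver (S.+ᴹ-commutativeMonoid y) xs (term f y (proj₁ q)))))
              (sumOver xs λ x → S._*ₗ_ z (or z y) (res (face-< q p) (term f y (proj₁ q) x)))
            distribute []       = S.≈ᴹ-trans z (S.*ₗ-congˡ z (res-0 (face-< q p))) (S.*ₗ-zeroʳ z _)
            distribute (x ∷ xs) = S.≈ᴹ-trans z (S.*ₗ-congˡ z (res-+ (face-< q p) _ _)) (S.≈ᴹ-trans z (S.*ₗ-distribˡ z _ _ _)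
              (S.+ᴹ-cong z (S.≈ᴹ-refl z) (distribute xs)))

          column : ∀ x → S._≈ᴹ_ z (Sum z (λ y → double y x)) (S.0ᴹ z)
          column x with em {P = FacesOf z i x}
          ... | no ¬q = sumOver-ε faces vanish
            where
            vanish : ∀ y → S._≈ᴹ_ z (double y x) (S.0ᴹ z)
            vanish y with em {P = FacesOf z (ℤ.suc i) y}
            ... | no _  = S.≈ᴹ-refl z
            ... | yes q rewrite term-no f (proj₁ q) {x} (λ (dx , x≤y) → ¬q (dx , ≼-trans x≤y (proj₂ q))) =
              S.≈ᴹ-trans z (S.*ₗ-congˡ z (res-0 (face-< q p))) (S.*ₗ-zeroʳ z _)
          ... | yes (dx , x≤z) = begin
            Sum z (λ y → double y x)
              ≈⟨ sumOver-cong faces factor ⟩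
            Sum z (λ y → S._*ₗ_ z (coeff y) v)
              ≈⟨ collect faces ⟩
            S._*ₗ_ z (ListSum.sumOver R.+-commutativeMonoid faces coeff) v
              ≈⟨ S.*ₗ-congʳ z (R.trans (R.reflexive (≡.sym (ListSum.sum-lookup R.+-commutativeMonoid faces coeff)))
                   (IsOrientation.cycle isOrientation x≤z (≡.trans p (≡.cong (ℤ.suc ∘ ℤ.suc) (≡.sym dx))))) ⟩
            S._*ₗ_ z R.0# v
              ≈⟨ S.*ₗ-zeroˡ z v ⟩
            S.0ᴹ z ∎
            where
            x<z : x < z
            x<z = ≤∧dim<⇒< x≤z (≡.subst₂ ℤ._<_ (≡.sym dx) (≡.sym p)
                    (ℤₚ.<-trans (ℤₚ.suc[i]≤j⇒i<j ℤₚ.≤-refl) (ℤₚ.suc[i]≤j⇒i<j ℤₚ.≤-refl)))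
            v : S.Carrierᴹ z
            v = res x<z (f x dx)
            coeff : Carrier → R.Carrier
            coeff y = extend (em {P = x < y × y < z}) (λ _ → or z y R.* or y x) R.0#

            collect : ∀ ys → S._≈ᴹ_ z (sumOver ys λ y → S._*ₗ_ z (coeff y) v)
                                      (S._*ₗ_ z (ListSum.sumOver R.+-commutativeMonoid ys coeff) v)
            collect []       = S.≈ᴹ-sym z (S.*ₗ-zeroˡ z v)
            collect (y ∷ ys) = S.≈ᴹ-trans z (S.+ᴹ-cong z (S.≈ᴹ-refl z) (collect ys)) (S.≈ᴹ-sym z (S.*ₗ-distribʳ z v _ _))

            between⇒ : ∀ {y} → x < y → y < z → FacesOf z (ℤ.suc i) y
            between⇒ {y} x<y y<z = ℤₚ.≤-antisym
              (ℤₚ.≮⇒≥ λ h → ℤₚ.<-irrefl ≡.refl (ℤₚ.<-≤-trans (dim-< y<z)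
                 (≡.subst (ℤ._≤ dim y) (≡.sym p) (ℤₚ.i<j⇒suc[i]≤j h))))
              (≡.subst (λ j → ℤ.suc j ℤ.≤ dim y) dx (ℤₚ.i<j⇒suc[i]≤j (dim-< x<y))) , proj₁ y<z

            factor : ∀ y → S._≈ᴹ_ z (double y x) (S._*ₗ_ z (coeff y) v)
            factor y with em {P = FacesOf z (ℤ.suc i) y} | em {P = x < y × y < z}
            ... | no _  | no _          = S.≈ᴹ-sym z (S.*ₗ-zeroˡ z v)
            ... | no ¬q | yes (x<y , y<z) = ⊥-elim (¬q (between⇒ x<y y<z))
            ... | yes q | no ¬b
              rewrite term-no f (proj₁ q) {x} (λ xy → ¬b (face-< xy (proj₁ q) , face-< q p)) =
              S.≈ᴹ-trans z (S.≈ᴹ-trans z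
                (S.*ₗ-congˡ z (res-0 (face-< q p))) (S.*ₗ-zeroʳ z _))
                (S.≈ᴹ-sym z (S.*ₗ-zeroˡ z v))
            ... | yes q | yes (x<y , y<z)
              rewrite term-yes f (proj₁ q) {x} (dx , proj₁ x<y) =
              S.≈ᴹ-trans z (S.*ₗ-congˡ z (S.≈ᴹ-trans z
                (res-* (face-< q p) _ _)
                (S.*ₗ-congˡ z (res-trans x<y y<z x<z (f x dx)))))
                (S.≈ᴹ-sym z (S.*ₗ-assoc z _ _ _))

  shift-dim : ∀ {i j a b} → i ≡ ℤ.suc j ℤ.+ b → a ℤ.- b ℤ.- 1ℤ ≡ j → a ≡ i
  shift-dim {a = a} {b} ≡.refl ≡.refl = lemma a b
    where
    lemma : ∀ a b → a ≡ 1ℤ ℤ.+ (a ℤ.- b ℤ.- 1ℤ) ℤ.+ b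
    lemma = ℤSolver.solve-∀

  unshift-dim : ∀ {i j a b} → i ≡ ℤ.suc j ℤ.+ b → a ≡ i → a ℤ.- b ℤ.- 1ℤ ≡ j
  unshift-dim {j = j} {b = b} ≡.refl ≡.refl = lemma j b
    where
    lemma : ∀ j b → (1ℤ ℤ.+ j ℤ.+ b) ℤ.- b ℤ.- 1ℤ ≡ j
    lemma = ℤSolver.solve-∀

  module Restriction {r ℓr m ℓm} {R : CommutativeRing r ℓr} (X : GradedPoset)
                     (or : Incidence R X) (𝓕 : Sheaf R X m ℓm) (u : GradedPoset.Carrier X) where
    open GradedPoset X renaming (≤-refl to ≼-refl; ≤-trans to ≼-trans)
    open Sheaf 𝓕
    open Cochains {R = R} X or 𝓕
    open Coboundary {R = R} X or 𝓕
    private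
      module S (x : Carrier) = Module (stalk x)
      orᵘ = linkIncidence X u {R = R} or
      𝓕ᵘ = linkSheaf X u 𝓕
      module L = Cochains {R = R} (link X u) orᵘ 𝓕ᵘ
      module ∂ᵘ = Coboundary {R = R} (link X u) orᵘ 𝓕ᵘ

    module _ {i j : ℤ} (i≡ : i ≡ ℤ.suc j ℤ.+ dim u) where

      restrict : C i → L.C j
      restrict g x p = g (value x) (shift-dim i≡ p)

      d-link : ∀ (g : C i) (c : L.C j) {y} (u≤y : u ≤ y) .(p : dim y ℤ.- dim u ℤ.- 1ℤ ≡ ℤ.suc j)
               .(q : dim y ≡ ℤ.suc i) →
               (∀ x .p′ .q′ → S._≈ᴹ_ (value x) (c x p′) (g (value x) q′)) →
               (∀ {x} → x ≤ y → ¬ u ≤ x → .(q′ : Faces i x) → S._≈ᴹ_ x (g x q′) (S.0ᴹ x)) →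
               S._≈ᴹ_ y (L.d c (y , [ u≤y ]) p) (d g y q)
      d-link g c {y} u≤y p q agree vanish
        rewrite ∂ᵘ.d≡Sum c (y , [ u≤y ]) p
              | d≡Sum g y q =
        sumOver-link (S.+ᴹ-commutativeMonoid y) {X} u
          inside (λ {x} u≰x → term-0 {i} {g} {y} {q} {x} λ x≤y → vanish x≤y u≰x) faces
        where
        inside : ∀ {x} (u≤x : u ≤ x) → S._≈ᴹ_ y
          (∂ᵘ.term c (y , [ u≤y ]) p (x , [ u≤x ]))
          (term g y q x)
        inside {x} u≤x with em {P = GradedPoset.FacesOf (link X u) (y , [ u≤y ]) j (x , [ u≤x ])} | em {P = FacesOf y i x}
        ... | yes a | yes b = S.*ₗ-congˡ y (res-cong (face-< b q)
                (agree (x , [ u≤x ]) (proj₁ a) (proj₁ b)))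
        ... | yes (dx , x≤y) | no ¬b = ⊥-elim (¬b (shift-dim i≡ dx , x≤y))
        ... | no ¬a | yes (dx , x≤y) = ⊥-elim (¬a (unshift-dim i≡ dx , x≤y))
        ... | no _  | no _  = S.≈ᴹ-refl y

    module _ {k : ℤ} (g : L.C (k ℤ.- dim u ℤ.- 1ℤ)) where
      private
        gᵘ : C k
        gᵘ = extendByZero {R = R} X or 𝓕 {k} u g

        k≡ : k ≡ ℤ.suc (k ℤ.- dim u ℤ.- 1ℤ) ℤ.+ dim u
        k≡ = shift-dim ≡.refl ≡.refl

      extendByZero-away : ∀ {x} → ¬ u ≤ x → .(p : Faces k x) → gᵘ x p ≡ S.0ᴹ x
      extendByZero-away {x} u≰x p = extend-no
        (λ u≤x → g (x , [ u≤x ]) (≡.cong (λ i → i ℤ.- dim u ℤ.- 1ℤ) p)) (S.0ᴹ x) u≰x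

      d-extendByZero-above : ∀ {y} (u≤y : u ≤ y) .(p : dim y ℤ.- dim u ℤ.- 1ℤ ≡ ℤ.suc (k ℤ.- dim u ℤ.- 1ℤ))
        .(q : Faces (ℤ.suc k) y) → S._≈ᴹ_ y (L.d g (y , [ u≤y ]) p) (d gᵘ y q)
      d-extendByZero-above u≤y p q = d-link k≡ gᵘ g u≤y p q
        (λ { (x , [ u≤x ]) p′ q′ → agree u≤x p′ q′ })
        λ _ u≰x q′ → S.≈ᴹ-reflexive _ (extendByZero-away u≰x q′)
        where
        agree : ∀ {x} .(u≤x : u ≤ x) .(p′ : dim x ℤ.- dim u ℤ.- 1ℤ ≡ k ℤ.- dim u ℤ.- 1ℤ) .(q′ : Faces k x) →
                S._≈ᴹ_ x (g (x , [ u≤x ]) p′) (gᵘ x q′)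
        agree {x} u≤x p′ q′ with em {P = u ≤ x}
        ... | yes _   = S.≈ᴹ-refl x
        ... | no  u≰x = ⊥-elim-irr (u≰x u≤x)

      d-extendByZero-away : ∀ {y} → ¬ u ≤ y → .(q : Faces (ℤ.suc k) y) → S._≈ᴹ_ y (d gᵘ y q) (S.0ᴹ y)
      d-extendByZero-away {y} u≰y q = d-0 {k} {gᵘ} {y} {q} λ x≤y q′ →
        S.≈ᴹ-reflexive _ (extendByZero-away (λ u≤x → u≰y (≼-trans u≤x x≤y)) q′)

  module Distance {r ℓr m ℓm} {R : CommutativeRing r ℓr} (X : GradedPoset)
                  (or : Incidence R X) (𝓕 : Sheaf R X m ℓm)
                  {w : GradedPoset.Carrier X → Real} (0≤w : ∀ x → 0# ≤ᴿ w x) where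
    open GradedPoset X using (Carrier; dim; Faces)
    open Sheaf 𝓕
    open Cochains {R = R} X or 𝓕
    open Coboundary {R = R} X or 𝓕 using (d-0)
    open OrderedField ℝ
    open Suprema em ℝ
    open Indicators em ℝ
    private
      module S (x : Carrier) = Module (stalk x)

    norm-cong : ∀ {i} (f g : C i) → (∀ x .(p : Faces i x) → S._≈ᴹ_ x (f x p) (g x p)) → norm w f ≈ norm w g
    norm-cong f g f≈g = weight-cong X {w} {P = Support f} {Support g}
      (λ {x} (p , f≢0) → p , λ g≈0 → f≢0 (S.≈ᴹ-trans x (f≈g x p) g≈0))
      (λ {x} (p , g≢0) → p , λ f≈0 → g≢0 (S.≈ᴹ-trans x (S.≈ᴹ-sym x (f≈g x p)) f≈0))

    0≤norm : ∀ {i} (f : C i) → 0# ≤ᴿ norm w f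
    0≤norm f = 0≤weight X 0≤w {P = Support f}

    module _ {i p} (f : C i) (P : Pred (C i) p) where

      distTo-≤ : ∀ {g} → P g → distTo w f P ≤ᴿ dist w f g
      distTo-≤ {g} Pg = inf-≤ {P = λ t → ∃ λ g → P g × t ≈ dist w f g} {0#}
        (λ (g , _ , t≈) → ≤-resp ≈-refl (≈-sym t≈) (0≤norm (f -ᶜ g))) (g , Pg , ≈-refl) (g , Pg , ≈-refl)

      distTo-greatest : ∃ P → ∀ {b} → (∀ {g} → P g → b ≤ᴿ dist w f g) → b ≤ᴿ distTo w f P
      distTo-greatest (g₀ , Pg₀) {b} h = inf-greatest {P = λ t → ∃ λ g → P g × t ≈ dist w f g} {0#}
        (λ (g , _ , t≈) → ≤-resp ≈-refl (≈-sym t≈) (0≤norm (f -ᶜ g))) (g₀ , Pg₀ , ≈-refl)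
        λ (g , Pg , t≈) → ≤-resp ≈-refl (≈-sym t≈) (h Pg)

      0≤distTo : ∃ P → 0# ≤ᴿ distTo w f P
      0≤distTo ∃P = distTo-greatest ∃P λ {g} _ → 0≤norm (f -ᶜ g)

    0ᶜ : ∀ {i} → C i
    0ᶜ x _ = S.0ᴹ x

    ∃B : ∀ {i} → ∃ (B {i})
    ∃B {i} = (λ y p → d {ℤ.pred i} 0ᶜ y (≡.trans p (≡.sym (ℤₚ.suc-pred i)))) , 0ᶜ , λ y p → S.≈ᴹ-refl y

    ∃Z : ∀ {i} → ∃ (Z {i})
    ∃Z {i} = 0ᶜ , λ y p → d-0 {i} {0ᶜ} {y} {p} λ {x} _ _ → S.≈ᴹ-refl x

    cbe-inequality : ∀ {i ε} → fin ε ≤± cbe w i → ∀ (f : C i) → ε * distTo w f B ≤ᴿ norm w (d f)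
    cbe-inequality h = slope-≤sup (λ f → distTo w f B) (λ f → norm w (d f)) (λ f → 0≤distTo f B ∃B) h

module LocalExpansion (em : ∀ {ℓ} → ExcludedMiddle ℓ) (ℝ : CompleteOrderedField) where
  open Classical em ℝ hiding (module ℝ)
  private module ℝ = CompleteOrderedField ℝ
  open OrderedField ℝ hiding (total)
  open Suprema em ℝ
  open Indicators em ℝ
  open Weights em ℝ
  open Expansion em ℝ
  open SheafCochains em ℝ
  open ListSum ℝ.+-commutativeMonoid

  module AtFaces {r ℓr m ℓm} {R : CommutativeRing r ℓr} {d : ℕ} {X : GradedPoset} (isDPoset : IsDPoset d X)
           {w : GradedPoset.Carrier X → Real} (isProper : IsProperWeight X d w)
           (or : Incidence R X) (𝓕 : Sheaf R X m ℓm)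
           {Λ : Real} (1≤Λ : 1# ≤ᴿ Λ) (comparable : Comparable X Λ) where
    open GradedPoset X renaming (≤-refl to ≼-refl; ≤-trans to ≼-trans)
    open Grading em X
    open Sheaf 𝓕
    open Cochains {R = R} X or 𝓕 renaming (d to δ)
    open Coboundary {R = R} X or 𝓕
    open Restriction {R = R} X or 𝓕
    open ProperlyWeighted isDPoset isProper
    open Comparison 1≤Λ comparable
    open Masses isDPoset isProper 1≤Λ comparable
    private
      module S (x : Carrier) = Module (stalk x)

      wᴸ : ∀ u → LinkFace X u → Real
      wᴸ u = linkWeight X u d w

      0≤wᴸ : ∀ u (x : LinkFace X u) → 0# ≤ᴿ wᴸ u x
      0≤wᴸ u (x , [ u≤x ]) = by-contradiction λ ¬0≤ → ⊥-elim-irr (¬0≤ (relWeight-pos u≤x))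

      module L (u : Carrier) where
        orᴸ = linkIncidence X u {R = R} or
        𝓕ᴸ = linkSheaf X u 𝓕
        open Cochains {R = R} (link X u) orᴸ 𝓕ᴸ public
        open Coboundary {R = R} (link X u) orᴸ 𝓕ᴸ public using (d-0; d-+; d-reindex)
        open Distance {R = R} (link X u) orᴸ 𝓕ᴸ (0≤wᴸ u) public using (distTo-greatest; cbe-inequality; ∃B)

    norm≈mass : ∀ {i} (f : C i) → norm w f ≈ mass (Support f)
    norm≈mass f = ∑ℝ≈Σᶠ X (Support f) w

    norm-link : ∀ u {j} (c : L.C u j) →
                L.norm u (wᴸ u) c ≈ massAbove u (λ x → Σ (u ≤ x) λ u≤x → L.Support u c (x , [ u≤x ]))
    norm-link u c = weight-link X u (L.Support u c) (relWeight u)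

    nonzero-face-away : ∀ u {i j} (i≡ : i ≡ ℤ.suc j ℤ.+ dim u) (f : C i) → Z f → ∀ {y} (u≤y : u ≤ y)
      .(p : dim y ℤ.- dim u ℤ.- 1ℤ ≡ ℤ.suc j) .(q : Faces (ℤ.suc i) y) →
      ¬ S._≈ᴹ_ y (L.d u (restrict u {i} {j} i≡ f) (y , [ u≤y ]) p) (S.0ᴹ y) →
      ∃ λ x → Support f x × ¬ u ≤ x × x ≤ y
    nonzero-face-away u {i} {j} i≡ f Zf {y} u≤y p q δf≢0 = by-contradiction λ ∄ → δf≢0 (S.≈ᴹ-trans y
      (d-link u {i} {j} i≡ f (restrict u {i} {j} i≡ f) u≤y p q (λ x _ _ → S.≈ᴹ-refl (value x))
        λ {x} x≤y u≰x q′ → by-contradiction λ fx≢0 → ∄ (x , (recompute (dim x ℤₚ.≟ i) q′ , fx≢0) , u≰x , x≤y))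
      (Zf y q))

    expansion-at-face : ∀ {i} u → dim u ≡ i → ∀ {ε} → 0# ≤ᴿ ε → fin ε ≤± L.cbe u (wᴸ u) -1ℤ →
      (f : C i) → Support f u → Z f →
      ε ≤ᴿ massAbove u λ y → dim y ≡ ℤ.suc i × u ≤ y × ∃ λ x → Support f x × u ≢ x × x ≤ y
    expansion-at-face {i} u du {ε} 0≤ε cbe≥ε f (_ , fu≢0) Zf = begin
      ε
        ≤⟨ x≤x*y 0≤ε (L.distTo-greatest u c (L.B u)
             (L.∃B u) 1≤dist) ⟩
      ε * L.distTo u (wᴸ u) c (L.B u)
        ≤⟨ L.cbe-inequality u cbe≥ε c ⟩
      L.norm u (wᴸ u) (L.d u c)
        ≈⟨ norm-link u (L.d u c) ⟩
      massAbove u (λ y → Σ (u ≤ y) λ u≤y → L.Support u (L.d u c) (y , [ u≤y ]))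
        ≤⟨ massAbove-mono (proj₁ ∘ proj₂) (λ (u≤y , dy , nz) →
             let dy′ = shift-dim {ℤ.suc i} {0ℤ} (≡.cong ℤ.suc (≡.sym du)) dy
                 x , Sx , u≰x , x≤y = nonzero-face-away u {i} { -1ℤ} i≡ f Zf u≤y dy dy′ nz
             in dy′ , u≤y , x , Sx , (λ u≡x → u≰x (≡.subst (u ≤_) u≡x ≼-refl)) , x≤y) ⟩
      massAbove u (λ y → dim y ≡ ℤ.suc i × u ≤ y × ∃ λ x → Support f x × u ≢ x × x ≤ y) ∎
      where
      i≡ : i ≡ ℤ.suc -1ℤ ℤ.+ dim u
      i≡ = ≡.trans (≡.sym du) (≡.sym (ℤₚ.+-identityˡ _))
      c : L.C u -1ℤ
      c = restrict u {i} { -1ℤ} i≡ f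
      1≤dist : ∀ {b} → L.B u b → 1# ≤ᴿ L.dist u (wᴸ u) c b
      1≤dist {b} (g , b≈dg) = begin
        1#
          ≈⟨ relWeight-total u ℤₚ.≤-refl (dim≤d u) ⟨
        massAbove u (λ x → dim x ≡ dim u × u ≤ x)
          ≤⟨ massAbove-mono proj₁ (λ (dx , u≤x) → u≤x , nonzero u≤x (≡.sym dx)) ⟩
        massAbove u (λ x → Σ (u ≤ x) λ u≤x → L.Support u (L._-ᶜ_ u c b) (x , [ u≤x ]))
          ≈⟨ norm-link u (L._-ᶜ_ u c b) ⟨
        L.dist u (wᴸ u) c b ∎
        where
        none : ∀ {x} → u ≤ x → ¬ dim x ℤ.- dim u ℤ.- 1ℤ ≡ ℤ.pred -1ℤ
        none u≤x eq = ℤₚ.<-irrefl ≡.refl (ℤₚ.≤-<-trans (≡.subst (dim u ℤ.≤_) (shift-dim ≡.refl eq) (dim-mono u≤x))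
                        (ℤₚ.i≤pred[j]⇒i<j ℤₚ.≤-refl))
        nonzero : ∀ {x} (u≤x : u ≤ x) → dim u ≡ dim x → L.Support u (L._-ᶜ_ u c b) (x , [ u≤x ])
        nonzero u≤x du≡dx with ≤∧dim≡⇒≡ u≤x du≡dx
        ... | ≡.refl = p , λ c-b≈0 → fu≢0 (S.≈ᴹ-trans u (S.≈ᴹ-sym u (S.≈ᴹ-trans u
                (S.+ᴹ-congˡ u (S.≈ᴹ-trans u (S.-ᴹ‿cong u (S.≈ᴹ-trans u (b≈dg (u , [ u≤x ]) p)
                  (L.d-0 u {ℤ.pred -1ℤ} {g} {u , [ u≤x ]} {p}
                    λ { {x , [ u≤x′ ]} _ q → ⊥-elim-irr (none u≤x′ q) })))
                  (GroupProperties.ε⁻¹≈ε (S.+ᴹ-group u))))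
                (S.+ᴹ-identityʳ u _))) c-b≈0)
          where
          p : dim u ℤ.- dim u ℤ.- 1ℤ ≡ -1ℤ
          p = unshift-dim {i} { -1ℤ} i≡ du

    coboundary-≤ : pos 2 ℤ.≤ pos d → ∀ {n₊} → 0# ≤ᴿ n₊ →
      (∀ {e} → dim e ≡ 1ℤ → fromℕ (# X (FacesOf e 0ℤ)) ≤ᴿ n₊) →
      (f g : C 0ℤ) → Z g → norm w (δ f) ≤ᴿ μ * n₊ * dist w f g
    coboundary-≤ 2≤d 0≤n₊ ≤n₊ f g Zg = ≤-resp (≈-sym (norm≈mass (δ f))) (ℝ.*-congˡ (≈-sym (norm≈mass (f -ᶜ g))))
      (mass-coboundary-≤ proj₁ (ℤₚ.≤-trans (ℤ.+≤+ (ℕ.s≤s ℕ.z≤n)) 2≤d) ≤n₊ 0≤n₊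
        λ {e} (de , nz) → de , by-contradiction λ ∄ → nz (S.≈ᴹ-trans e
          (d-cong {0ℤ} {f} {g} {e} {de} λ {v} v≤e q → GroupProperties.x∙y⁻¹≈ε⇒x≈y (S.+ᴹ-group v) _ _
            (by-contradiction λ nz′ → ∄ (v , (recompute (dim v ℤₚ.≟ 0ℤ) q , nz′) , v≤e)))
          (Zg e de)))

    module _ (f : C 1ℤ) (Zf : Z f) {u} (du : dim u ≡ 0ℤ) where

      private
        1≡ : 1ℤ ≡ ℤ.suc 0ℤ ℤ.+ dim u
        1≡ = ≡.cong ℤ.suc (≡.sym du)

        c : L.C u 0ℤ
        c = restrict u {1ℤ} {0ℤ} 1≡ f

        gᵘ : L.C u (0ℤ ℤ.- dim u ℤ.- 1ℤ) → C 0ℤ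
        gᵘ = extendByZero {R = R} X or 𝓕 {0ℤ} u

        At : Pred Carrier _
        At e = Support f e × u ≤ e

      -- The condition that no vertex correction at u gains q w(u).
      LocallyMinimal : Real → Set _
      LocallyMinimal q = ∀ (g : L.C u (0ℤ ℤ.- dim u ℤ.- 1ℤ)) → norm w f ≤ᴿ norm w (f +ᶜ δ (gᵘ g)) + q * w u

      module _ {q n₊ : Real} (minimal : LocallyMinimal q) (0<n₊ : 0# <ᴿ n₊)
               (≤n₊ : ∀ {e} → dim e ≡ 1ℤ → fromℕ (# X (FacesOf e 0ℤ)) ≤ᴿ n₊) where

        private
          module Minus (g : L.C u (ℤ.pred 0ℤ)) where
            index : 0ℤ ℤ.- dim u ℤ.- 1ℤ ≡ ℤ.pred 0ℤ
            index = ≡.cong (λ i → 0ℤ ℤ.- i ℤ.- 1ℤ) du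

            -g : L.C u (ℤ.pred 0ℤ)
            -g x p = S.-ᴹ_ (value x) (g x p)

            -g′ : L.C u (0ℤ ℤ.- dim u ℤ.- 1ℤ)
            -g′ x p = -g x (≡.trans p index)

            d-neg : ∀ {e} (u≤e : u ≤ e) .(p : dim e ℤ.- dim u ℤ.- 1ℤ ≡ 0ℤ) →
                    S._≈ᴹ_ e (L.d u -g (e , [ u≤e ]) p) (S.-ᴹ_ e (L.d u g (e , [ u≤e ]) p))
            d-neg {e} u≤e p = GroupProperties.inverseˡ-unique (S.+ᴹ-group e) _ _ (S.≈ᴹ-trans e
              (S.≈ᴹ-sym e (L.d-+ u {ℤ.pred 0ℤ} -g g {e , [ u≤e ]} {p}))
              (L.d-0 u {ℤ.pred 0ℤ} {L._+ᶜ_ u -g g} {e , [ u≤e ]} {p}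
                λ {x} _ q → S.-ᴹ‿inverseˡ (value x) _))

            agree : ∀ {e} (u≤e : u ≤ e) .(p : dim e ℤ.- dim u ℤ.- 1ℤ ≡ 0ℤ) .(q : dim e ≡ 1ℤ) →
                    S._≈ᴹ_ e (δ (gᵘ -g′) e q) (S.-ᴹ_ e (L.d u g (e , [ u≤e ]) p))
            agree {e} u≤e p q = S.≈ᴹ-trans e (S.≈ᴹ-sym e
              (d-extendByZero-above u {0ℤ} -g′ u≤e (≡.trans p (≡.sym (≡.cong ℤ.suc index))) q))
              (S.≈ᴹ-trans e (L.d-reindex u index { -g′} { -g} {e , [ u≤e ]} {≡.trans p (≡.sym (≡.cong ℤ.suc index))} {p}
                λ {x} _ _ _ → S.≈ᴹ-refl (value x)) (d-neg u≤e p))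

        mass-at-≤ : ∀ {b} → L.B u b → mass At ≤ᴿ q * w u + μ * n₊ * w u * L.dist u (wᴸ u) c b
        mass-at-≤ {b} (g , b≈dg) = +-cancelʳ-≤ (mass Away) (begin
          mass At + mass Away
            ≈⟨ sumOver-∙ faces _ _ ⟨
          Σᶠ X (λ e → χ (At e) * w e + χ (Away e) * w e)
            ≤⟨ sumOver-mono faces (λ e → ≤-resp (ℝ.distribʳ _ _ _) ≈-refl (*-monoˡ-≤ (0≤w e) (split e))) ⟩
          mass (Support f)
            ≈⟨ norm≈mass f ⟨
          norm w f
            ≤⟨ minimal -g′ ⟩
          norm w f′ + q * w u
            ≤⟨ +-monoˡ-≤ _ (≤-trans (≤-reflexive (norm≈mass f′))
                 (≤-trans (mass-⊎ cover′) (+-monoˡ-≤ _ near))) ⟩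
          (μ * n₊ * w u * L.dist u (wᴸ u) c b + mass Away) + q * w u
            ≈⟨ solve 3 (λ a b c → (a :+ b) :+ c := (c :+ a) :+ b) ≈-refl _ _ _ ⟩
          (q * w u + μ * n₊ * w u * L.dist u (wᴸ u) c b) + mass Away ∎)
          where
          open Minus g
          f′ : C 1ℤ
          f′ = f +ᶜ δ (gᵘ -g′)
          Away Near : Pred Carrier _
          Away e = Support f e × ¬ u ≤ e
          Near e = Support f′ e × u ≤ e

          split : ∀ e → χ (At e) + χ (Away e) ≤ᴿ χ (Support f e)
          split e with em {P = u ≤ e}
          ... | yes u≤e = ≤-trans (≤-reflexive (≈-trans (ℝ.+-congˡ (χ-no λ (_ , u≰e) → u≰e u≤e)) (ℝ.+-identityʳ _))) (χ-mono proj₁)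
          ... | no  u≰e = ≤-trans (≤-reflexive (≈-trans (ℝ.+-congʳ (χ-no λ (_ , u≤e) → u≰e u≤e)) (ℝ.+-identityˡ _))) (χ-mono proj₁)

          cover′ : ∀ {e} → Support f′ e → Near e ⊎ Away e
          cover′ {e} (de , nz) with em {P = u ≤ e}
          ... | yes u≤e = inj₁ ((de , nz) , u≤e)
          ... | no  u≰e = inj₂ ((de , λ fe≈0 → nz (S.≈ᴹ-trans e
                  (S.+ᴹ-cong e fe≈0 (d-extendByZero-away u {0ℤ} -g′ u≰e de)) (S.+ᴹ-identityˡ e _))) , u≰e)

          near : mass Near ≤ᴿ μ * n₊ * w u * L.dist u (wᴸ u) c b
          near = begin
            mass Near
              ≤⟨ ≤-massAbove proj₂ (λ ((de , _) , _) →
                   ≡.subst (λ i → fromℕ (# X (FacesOf _ i)) ≤ᴿ n₊) (≡.sym du) (≤n₊ de)) ⟩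
            μ * n₊ * (w u * massAbove u Near)
              ≈⟨ ℝ.*-assoc _ _ _ ⟨
            μ * n₊ * w u * massAbove u Near
              ≤⟨ *-monoʳ-≤ (ℝ.*-nonNeg (ℝ.*-nonNeg 0≤μ (<⇒≤ 0<n₊)) (0≤w u))
                   (massAbove-mono proj₁ inside) ⟩
            μ * n₊ * w u * (massAbove u (λ x → Σ (u ≤ x) λ u≤x → L.Support u (L._-ᶜ_ u c b) (x , [ u≤x ])))
              ≈⟨ ℝ.*-congˡ (norm-link u (L._-ᶜ_ u c b)) ⟨
            μ * n₊ * w u * L.dist u (wᴸ u) c b ∎
            where
            inside : ∀ {e} → Near e → Σ (u ≤ e) λ u≤e → L.Support u (L._-ᶜ_ u c b) (e , [ u≤e ])
            inside {e} ((de , nz) , u≤e) = u≤e , p , λ c-b≈0 → nz (S.≈ᴹ-trans e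
              (S.+ᴹ-cong e (S.≈ᴹ-refl e) (S.≈ᴹ-trans e (agree u≤e p de)
                (S.-ᴹ‿cong e (S.≈ᴹ-sym e (b≈dg (e , [ u≤e ]) p))))) c-b≈0)
              where
              p : dim e ℤ.- dim u ℤ.- 1ℤ ≡ 0ℤ
              p = unshift-dim {1ℤ} {0ℤ} 1≡ de

        expansion-at-vertex : ∀ {ε} → 0# ≤ᴿ ε → fin ε ≤± L.cbe u (wᴸ u) 0ℤ →
          ε * mass At ≤ᴿ ε * (q * w u) + μ * n₊ * (w u * (massAbove u λ z → dim z ≡ pos 2 × u ≤ z ×
            ∃₂ λ e e′ → Support f e × Support f e′ × u ≤ e × e ≤ z × ¬ u ≤ e′ × e′ ≤ z))
        expansion-at-vertex {ε} 0≤ε cbe≥ε = begin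
          ε * mass At
            ≤⟨ *-monoʳ-≤ 0≤ε (≤-resp ≈-refl (ℝ.+-comm _ _) (x-y≤z⇒x≤z+y (begin
                 mass At ℝ.- q * w u
                   ≈⟨ ≈-trans (ℝ.*-assoc _ _ _) (≈-trans (ℝ.*-congˡ (*-inverseˡ k-pos)) (ℝ.*-identityʳ _)) ⟨
                 t * k
                   ≤⟨ *-monoˡ-≤ (<⇒≤ k-pos) t≤dist ⟩
                 D * k ∎))) ⟩
          ε * (q * w u + D * k)
            ≈⟨ solve 4 (λ e q d k → e :* (q :+ d :* k) := e :* q :+ k :* (e :* d)) ≈-refl _ _ _ _ ⟩
          ε * (q * w u) + k * (ε * D)
            ≤⟨ ℝ.+-monoʳ-≤ _ (*-monoʳ-≤ (<⇒≤ k-pos) (≤-trans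
                 (L.cbe-inequality u cbe≥ε c)
                 (≤-trans (≤-reflexive (norm-link u (L.d u c)))
                   (massAbove-mono (proj₁ ∘ proj₂) seen)))) ⟩
          ε * (q * w u) + k * massAbove u Q
            ≈⟨ ℝ.+-congˡ (ℝ.*-assoc _ _ _) ⟩
          ε * (q * w u) + μ * n₊ * (w u * massAbove u Q) ∎
          where
          Q : Pred Carrier _
          Q z = dim z ≡ pos 2 × u ≤ z ×
            ∃₂ λ e e′ → Support f e × Support f e′ × u ≤ e × e ≤ z × ¬ u ≤ e′ × e′ ≤ z
          D k t : Real
          D = L.distTo u (wᴸ u) c (L.B u)
          k = μ * n₊ * w u
          t = (mass At ℝ.- q * w u) * k ⁻¹
          k-pos : 0# <ᴿ k
          k-pos = *-pos (*-pos (1≤⇒0< 1≤μ) 0<n₊) (IsProperWeight.positive isProper u)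
          t≤dist : t ≤ᴿ D
          t≤dist = L.distTo-greatest u c (L.B u)
            (L.∃B u) λ {b} Bb →
              x≤y*z⇒x*y⁻¹≤z k-pos (x≤z+y⇒x-y≤z (≤-resp ≈-refl
                (≈-trans (ℝ.+-comm _ _) (ℝ.+-congʳ (ℝ.*-comm _ _))) (mass-at-≤ {b} Bb)))
          seen : ∀ {z} → (Σ (u ≤ z) λ u≤z → L.Support u (L.d u c) (z , [ u≤z ])) → Q z
          seen {z} (u≤z , p , nz) =
            let dz = shift-dim {pos 2} {1ℤ} (≡.cong (λ i → pos 2 ℤ.+ i) (≡.sym du)) p
                e′ , Se′ , u≰e′ , e′≤z = nonzero-face-away u {1ℤ} {0ℤ} 1≡ f Zf u≤z p dz nz
                e , Se , u≤e , e≤z = some-edge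
            in dz , u≤z , e , e′ , Se , Se′ , u≤e , e≤z , u≰e′ , e′≤z
            where
            some-edge : ∃ λ e → Support f e × u ≤ e × e ≤ z
            some-edge = by-contradiction λ ∄ → nz (L.d-0 u {0ℤ} {c} {z , [ u≤z ]} {p}
              λ { {x , [ u≤x ]} x≤z q → by-contradiction λ cx≢0 → ⊥-elim-irr (∄
                  (x , (shift-dim {1ℤ} {0ℤ} 1≡ (recompute (_ ℤₚ.≟ 0ℤ) q) , cx≢0) , u≤x , x≤z)) })

module Cosystolic (em : ∀ {ℓ} → ExcludedMiddle ℓ) (ℝ : CompleteOrderedField) where
  open Classical em ℝ hiding (module ℝ)
  private module ℝ = CompleteOrderedField ℝ
  open OrderedField ℝ hiding (total)
  open Suprema em ℝ
  open Indicators em ℝ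
  open Weights em ℝ
  open Expansion em ℝ
  open SheafCochains em ℝ
  open LocalExpansion em ℝ
  open ListSum ℝ.+-commutativeMonoid

  -- n₋ and n₊ bound the number of vertices of an edge, V the numbers of vertices and edges
  -- of a 2-face.
  record Admissible (Λ n₋ n₊ V : Real) (c : Constants) : Set where
    open Constants c
    field
      {σ τ} : Real
      0<σ   : 0# <ᴿ σ
      0≤τ   : 0# ≤ᴿ τ
      σ+τ≈1 : σ + τ ≈ 1#
      0<n₋  : 0# <ᴿ n₋
      0<n₊  : 0# <ᴿ n₊
      1≤V   : 1# ≤ᴿ V
      0<E″  : 0# <ᴿ E″
      0<D′  : 0# <ᴿ D′
      0<D″  : 0# <ᴿ D″
      E-small  : E * (Λ * Λ * Λ) ≤ᴿ 1#
      E‴≤1     : E‴ ≤ᴿ 1#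
      D′-small : D′ * (Λ * Λ * Λ) ≤ᴿ τ * n₋
      E″-small : E″ * (Λ * Λ * Λ) ≤ᴿ τ * n₋
      E″-small₁ : E″ * (Λ * Λ * Λ) ≤ᴿ 1#
      E′-small : (σ + n₊) * V * ((Λ * Λ * Λ) * (Λ * Λ * Λ) * (Λ * Λ * Λ) * (Λ * Λ * Λ)) * E′ <ᴿ σ
      D-small  : (Λ * Λ * Λ) * n₊ * D * (Λ * Λ * Λ) ≤ᴿ 1#
      D″-small : D″ * ((Λ * Λ * Λ) * n₊) ≤ᴿ D′

  record FaceBounds (X : GradedPoset) (n₋ n₊ V : Real) : Set where
    open GradedPoset X
    field
      n₋≤ : ∀ {e} → dim e ≡ 1ℤ → n₋ ≤ᴿ fromℕ (# X (FacesOf e 0ℤ))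
      ≤n₊ : ∀ {e} → dim e ≡ 1ℤ → fromℕ (# X (FacesOf e 0ℤ)) ≤ᴿ n₊
      ≤V  : ∀ {z i} → dim z ≡ pos 2 → i ≡ 0ℤ ⊎ i ≡ 1ℤ → fromℕ (# X (FacesOf z i)) ≤ᴿ V

  ⌊_⌋ : ∀ {a p} {A : Set a} → Pred A p → Pred A 0ℓ
  ⌊ P ⌋ x = True (em {P = P x})

  module LocalToGlobal {r ℓr m ℓm} {R : CommutativeRing r ℓr} {d : ℕ} (2≤d : pos 2 ℤ.≤ pos d)
           {X : GradedPoset} (isDPoset : IsDPoset d X)
           {w : GradedPoset.Carrier X → Real} (isProper : IsProperWeight X d w)
           (or : Incidence R X) (isOrientation : IsOrientation R X or) (𝓕 : Sheaf R X m ℓm)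
           {Λ n₋ n₊ V : Real} (1≤Λ : 1# ≤ᴿ Λ) (comparable : Comparable X Λ) (bounds : FaceBounds X n₋ n₊ V)
           {c : Constants} (admissible : Admissible Λ n₋ n₊ V c) where
    open GradedPoset X renaming (≤-refl to ≼-refl; ≤-trans to ≼-trans)
    open Grading em X
    open IsDPoset isDPoset
    open IsProperWeight isProper
    open Sheaf 𝓕
    open Cochains {R = R} X or 𝓕 renaming (d to δ)
    open Coboundary {R = R} X or 𝓕
    open Restriction {R = R} X or 𝓕
    open ProperlyWeighted isDPoset isProper
    open Comparison 1≤Λ comparable
    open Masses isDPoset isProper 1≤Λ comparable
    open Distance {R = R} X or 𝓕 0≤w
    open AtFaces {R = R} isDPoset isProper or 𝓕 1≤Λ comparable
    open Constants c
    open Admissible admissible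
    open FaceBounds bounds
    private
      module S (x : Carrier) = Module (stalk x)
      module L (u : Carrier) = Cochains {R = R} (link X u) (linkIncidence X u {R = R} or) (linkSheaf X u 𝓕)

      0<μ : 0# <ᴿ μ
      0<μ = 1≤⇒0< 1≤μ

      _⟶[_]_ : C 0ℤ → Real → C 0ℤ → Set m
      f ⟶[ q ] g = Correction {R = R} X or 𝓕 w 0ℤ q f g

    weight-singleton : ∀ {p} {Q : Pred Carrier p} u → (∀ {x} → Q x → x ≡ u) → weight X w Q ≤ᴿ w u
    weight-singleton {Q = Q} u Q⇒≡u = ≤-trans (≤-reflexive (∑ℝ≈Σᶠ X Q w)) (go faces faces-unique)
      where
      go : ∀ xs → Unique xs → sumOver xs (λ x → χ (Q x) * w x) ≤ᴿ w u
      go [] [] = 0≤w u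
      go (x ∷ xs) (x∉ ∷ unique) with em {P = Q x}
      ... | no ¬q = ≤-trans (≤-reflexive (≈-trans (ℝ.+-congʳ (ℝ.zeroˡ _)) (ℝ.+-identityˡ _))) (go xs unique)
      ... | yes q = ≤-reflexive (≈-trans (ℝ.+-cong (≈-trans (ℝ.*-identityˡ _) (≈-reflexive (≡.cong w (Q⇒≡u q))))
                      (rest xs x∉)) (ℝ.+-identityʳ _))
        where
        rest : ∀ ys → All (x ≢_) ys → sumOver ys (λ y → χ (Q y) * w y) ≈ 0#
        rest []       []          = ≈-refl
        rest (y ∷ ys) (x≢y ∷ x≢s) = ≈-trans (ℝ.+-cong
          (≈-trans (ℝ.*-congʳ (χ-no λ q′ → x≢y (≡.trans (Q⇒≡u q) (≡.sym (Q⇒≡u q′))))) (ℝ.zeroˡ _))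
          (rest ys x≢s)) (ℝ.+-identityˡ _)

    dist-triangle : ∀ {i} (f g h : C i) → dist w f h ≤ᴿ dist w f g + dist w g h
    dist-triangle f g h = ≤-resp (≈-sym (∑ℝ≈Σᶠ X (Support (f -ᶜ h)) w))
      (ℝ.+-cong (≈-sym (∑ℝ≈Σᶠ X (Support (f -ᶜ g)) w)) (≈-sym (∑ℝ≈Σᶠ X (Support (g -ᶜ h)) w)))
      (mass-⊎ split)
      where
      split : ∀ {x} → Support (f -ᶜ h) x → Support (f -ᶜ g) x ⊎ Support (g -ᶜ h) x
      split {x} (dx , f≢h) with em {P = Support (f -ᶜ g) x} | em {P = Support (g -ᶜ h) x}
      ... | yes a | _     = inj₁ a
      ... | no _  | yes b = inj₂ b
      ... | no a  | no b  = ⊥-elim (f≢h (S.≈ᴹ-trans x (S.+ᴹ-congʳ x (S.≈ᴹ-trans x (eq {f x dx} {g x dx} a) (eq {g x dx} {h x dx} b))) (S.-ᴹ‿inverseʳ x _)))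
        where
        eq : ∀ {s t : S.Carrierᴹ x} → ¬ (Σ (dim x ≡ _) λ p → ¬ S._≈ᴹ_ x (S._+ᴹ_ x s (S.-ᴹ_ x t)) (S.0ᴹ x)) → S._≈ᴹ_ x s t
        eq ¬s = GroupProperties.x∙y⁻¹≈ε⇒x≈y (S.+ᴹ-group x) _ _ (by-contradiction λ nz → ¬s (dx , nz))

    module _ {q : Real} where

      correction-step : ∀ {f g} → f ⟶[ q ] g → ∃ λ u →
        norm w (δ g) + q * w u ≤ᴿ norm w (δ f) × dist w f g ≤ᴿ w u
      correction-step {f} (correct u g 0≤du du≤0 drop) = u , decrease , weight-singleton u only-u
        where
        gᵘ : C 0ℤ
        gᵘ = extendByZero {R = R} X or 𝓕 {0ℤ} u g
        decrease : norm w (δ (f +ᶜ gᵘ)) + q * w u ≤ᴿ norm w (δ f)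
        decrease = ≤-trans (+-monoˡ-≤ _ (≤-trans (≤-reflexive
          (norm-cong (δ (f +ᶜ gᵘ)) (δ f +ᶜ δ gᵘ) λ x p → d-+ {0ℤ} f gᵘ {x} {p})) (<⇒≤ drop)))
          (≤-reflexive (x-y+y≈x _ _))
        only-u : ∀ {x} → Support (f -ᶜ (f +ᶜ gᵘ)) x → x ≡ u
        only-u {x} (dx , nz) with em {P = u ≤ x}
        ... | yes u≤x = ≡.sym (≤∧dim≡⇒≡ u≤x (≡.trans (ℤₚ.≤-antisym du≤0 0≤du) (≡.sym dx)))
        ... | no  u≰x = ⊥-elim (nz (S.≈ᴹ-trans x (S.+ᴹ-congˡ x (S.-ᴹ‿cong x (S.+ᴹ-identityʳ x _)))
                                                 (S.-ᴹ‿inverseʳ x _)))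

      correction-path : 0# ≤ᴿ q → ∀ {f g} → Star _⟶[ q ]_ f g → norm w (δ g) + q * dist w f g ≤ᴿ norm w (δ f)
      correction-path 0≤q {f} ε⋆ = ≤-trans (ℝ.+-monoʳ-≤ _ (≤-trans (*-monoʳ-≤ 0≤q dist-refl) (≤-reflexive (ℝ.zeroʳ q))))
                                        (≤-reflexive (ℝ.+-identityʳ _))
        where
        dist-refl : dist w f f ≤ᴿ 0#
        dist-refl = ≤-trans (≤-reflexive (∑ℝ≈Σᶠ X (Support (f -ᶜ f)) w)) (≤-reflexive (sumOver-ε faces λ x →
          ≈-trans (ℝ.*-congʳ (χ-no λ (p , nz) → nz (S.-ᴹ‿inverseʳ x (f x p)))) (ℝ.zeroˡ _)))
      correction-path 0≤q {f} {h} (_◅_ {j = g} f⟶g g⟶*h) = let u , drop , near = correction-step f⟶g in begin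
        norm w (δ h) + q * dist w f h
          ≤⟨ ℝ.+-monoʳ-≤ _ (*-monoʳ-≤ 0≤q (≤-trans (dist-triangle f g h) (+-monoˡ-≤ _ near))) ⟩
        norm w (δ h) + q * (w u + dist w g h)
          ≈⟨ solve 4 (λ n q a b → n :+ q :* (a :+ b) := (n :+ q :* b) :+ q :* a) ≈-refl _ _ _ _ ⟩
        (norm w (δ h) + q * dist w g h) + q * w u
          ≤⟨ +-monoˡ-≤ _ (correction-path 0≤q g⟶*h) ⟩
        norm w (δ g) + q * w u
          ≤⟨ drop ⟩
        norm w (δ f) ∎

      correction-terminates : 0# <ᴿ q → ∀ f → Acc (flip _⟶[ q ]_) f
      correction-terminates 0<q = descent _⟶[ q ]_ (λ f → norm w (δ f)) (λ f → 0≤norm (δ f))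
        (*-pos 0<q (proj₁ (proj₂ least))) λ f⟶g → let u , drop , _ = correction-step f⟶g in
          ≤-trans (ℝ.+-monoʳ-≤ _ (*-monoʳ-≤ (<⇒≤ 0<q) (proj₂ (proj₂ least) (faces-complete u)))) drop
        where
        lower : ∀ xs → ∃ λ b → 0# <ᴿ b × (∀ {x} → x ∈ xs → b ≤ᴿ w x)
        lower []       = 1# , 0<1 , λ ()
        lower (x ∷ xs) with lower xs
        ... | b , 0<b , b≤ with OrderedField.total ℝ b (w x)
        ...   | inj₁ b≤wx = b , 0<b , λ { (here ≡.refl) → b≤wx ; (there x∈) → b≤ x∈ }
        ...   | inj₂ wx≤b = w x , positive x , λ { (here ≡.refl) → ≤-refl ; (there x∈) → ≤-trans wx≤b (b≤ x∈) }
        least = lower faces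

    module ExpandingLinks {ε ε′ : Real} (0<ε : 0# <ᴿ ε) (0<ε′ : 0# <ᴿ ε′)
      {α₀ β₀ α₋₁ β₋₁ α∥ β∥ : Real}
      (0≤α₀ : 0# ≤ᴿ α₀) (0≤β₀ : 0# ≤ᴿ β₀) (0≤α₋₁ : 0# ≤ᴿ α₋₁) (0≤β₋₁ : 0# ≤ᴿ β₋₁)
      (0≤α∥ : 0# ≤ᴿ α∥) (0≤β∥ : 0# ≤ᴿ β∥)
      (cbe-vertex₋₁ : ∀ v → Faces 0ℤ v → fin ε  ≤± L.cbe v (linkWeight X v d w) -1ℤ)
      (cbe-edge₋₁   : ∀ e → Faces 1ℤ e → fin ε′ ≤± L.cbe e (linkWeight X e d w) -1ℤ)
      (cbe-vertex₀  : ∀ v → Faces 0ℤ v → fin ε′ ≤± L.cbe v (linkWeight X v d w) 0ℤ)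
      (skeleton₀  : ∀ v → Faces 0ℤ v → IsSkeletonExpanderGr (link X v) (linkWeight X v d w) α₀ β₀)
      (skeleton₋₁ : IsSkeletonExpanderGr X w α₋₁ β₋₁)
      (skeleton∥  : IsSkeletonExpanderNIH X ∅ w α∥ β∥)
      where

      private
        skeleton₋₁-mass : ∀ {A : Pred Carrier 0ℓ} → (∀ {v} → A v → dim v ≡ 0ℤ) →
                          mass (Distinct₀ A) ≤ᴿ α₋₁ * mass A + β₋₁ * mass A ^ 2
        skeleton₋₁-mass {A} A⊆ = ≤-resp (∑ℝ≈Σᶠ X (Distinct₀ A) w)
          (ℝ.+-cong (ℝ.*-congˡ (∑ℝ≈Σᶠ X A w)) (ℝ.*-congˡ (ℝ.*-cong (∑ℝ≈Σᶠ X A w) (ℝ.*-congʳ (∑ℝ≈Σᶠ X A w)))))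
          (skeleton₋₁ A A⊆)

      module SmallParameters {h₋₁ h₀ h∥ : Real} (0<h₋₁ : 0# <ᴿ h₋₁) (0<h₀ : 0# <ᴿ h₀) (0<h∥ : 0# <ᴿ h∥)
        (small : (α₀ + β₀ * h₀) + (α∥ + β∥ * h∥) + (α₋₁ + β₋₁ * h₋₁) ÷ h₀ ≤ᴿ E′ * ε′) where

        normalForm-cocycle : ∀ {q} → q * μ ≤ᴿ τ * (n₋ * h₀) → ∀ f → IsNormalForm _⟶[ q ]_ f →
          norm w (δ f) ≤ᴿ h∥ → μ * norm w (δ f) ≤ᴿ h₀ * h₋₁ → Z f
        normalForm-cocycle {q} q-small f normal small₁ small₂ y p = by-contradiction λ nz →
          Core.support-empty edges vertices skeleton₀-mass (skeleton₋₁-mass proj₁) disjoint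
            (≤-trans (≤-reflexive mass≈) small₁) (≤-trans (*-monoʳ-≤ (<⇒≤ 0<μ) (≤-reflexive mass≈)) small₂)
            0<ε′ E′-small {y} (fromWitness (recompute (dim y ℤₚ.≟ 1ℤ) p , nz))
          where
          g : C 1ℤ
          g = δ f
          Zg : Z g
          Zg = d∘d≈0 {0ℤ} isOrientation f
          A : Pred Carrier 0ℓ
          A = ⌊ Support g ⌋
          A⊆ : ∀ {e} → A e → dim e ≡ 1ℤ
          A⊆ a = proj₁ (toWitness a)
          module Core = SmallCocycle {A} A⊆ 2≤d
            (<⇒≤ 0<n₊) 1≤V 0<n₋ n₋≤ ≤n₊ ≤V {ε′} {q} {σ} {τ} {h₋₁} {h₀} {h∥} {α₀} {β₀} {α₋₁} {β₋₁} {α∥} {β∥} {E′}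
            (<⇒≤ 0<ε′) 0<h₀ (<⇒≤ 0<σ) 0≤τ σ+τ≈1 0≤α₀ 0≤β₀ 0≤α₋₁ 0≤β₋₁ 0≤α∥ 0≤β∥ (<⇒≤ 0<h₋₁) (<⇒≤ 0<h∥) small q-small

          mass≈ : mass A ≈ norm w g
          mass≈ = ≈-trans (antisym (mass-mono toWitness) (mass-mono fromWitness)) (≈-sym (∑ℝ≈Σᶠ X (Support g) w))

          edges : ∀ {e} → A e → ε′ ≤ᴿ massAbove e (Core.AtEdge e)
          edges {e} a = let Se = toWitness a in ≤-trans
            (expansion-at-face e (proj₁ Se) (<⇒≤ 0<ε′) (cbe-edge₋₁ e (proj₁ Se)) g Se Zg)
            (massAbove-mono (proj₁ ∘ proj₂) λ (dz , e≤z , x , Sx , e≢x , x≤z) → dz , e≤z , x , fromWitness Sx , e≢x , x≤z)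

          vertices : ∀ {u} → dim u ≡ 0ℤ →
            ε′ * mass (Core.Aᵤ u) ≤ᴿ ε′ * (q * w u) + μ * n₊ * (w u * massAbove u (Core.AtVertex u))
          vertices {u} du = ≤-trans (*-monoʳ-≤ (<⇒≤ 0<ε′) (mass-mono λ (a , u≤e) → toWitness a , u≤e)) (≤-trans
            (expansion-at-vertex g Zg du
              (λ h → x-y≤z⇒x≤z+y (by-contradiction λ ≰ → normal (_ , correct u h
                (ℤₚ.≤-reflexive (≡.sym du)) (ℤₚ.≤-reflexive du) (≰⇒> ≰))))
              0<n₊ ≤n₊ (<⇒≤ 0<ε′) (cbe-vertex₀ u du))
            (ℝ.+-monoʳ-≤ _ (*-monoʳ-≤ (ℝ.*-nonNeg (<⇒≤ 0<μ) (<⇒≤ 0<n₊)) (*-monoʳ-≤ (0≤w u)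
              (massAbove-mono (proj₁ ∘ proj₂) λ (dz , u≤z , e , e′ , Se , Se′ , rest) →
                dz , u≤z , e , e′ , fromWitness Se , fromWitness Se′ , rest)))))

          skeleton₀-mass : ∀ {u} → dim u ≡ 0ℤ →
            massAbove u (Core.TwoAbove u) ≤ᴿ α₀ * massAbove u (Core.Aᵤ u) + β₀ * massAbove u (Core.Aᵤ u) ^ 2
          skeleton₀-mass {u} du = ≤-trans (massAbove-mono proj₁ λ { (dz , u≤z , e , e′ , a , a′ , e≢e′ , u≤e , u≤e′ , e≤z , e′≤z) →
              u≤z , unshift-dim {pos 2} {1ℤ} (≡.cong (λ i → pos 2 ℤ.+ i) (≡.sym du)) dz ,
              (e , [ u≤e ]) , (e′ , [ u≤e′ ]) , a , a′ , (e≢e′ ∘ ≡.cong value) , e≤z , e′≤z })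
            (≤-resp (weight-link X u Pairs (relWeight u))
              (ℝ.+-cong (ℝ.*-congˡ mass′) (ℝ.*-congˡ (ℝ.*-cong mass′ (ℝ.*-congʳ mass′))))
              (skeleton₀ u du A′ λ {x} a → unshift-dim {1ℤ} {0ℤ} (≡.cong ℤ.suc (≡.sym du)) (A⊆ a)))
            where
            A′ : Pred (LinkFace X u) 0ℓ
            A′ x = A (value x)
            Pairs : Pred (LinkFace X u) 0ℓ
            Pairs e = GradedPoset.Faces (link X u) 1ℤ e × ∃₂ λ x y → A′ x × A′ y × x ≢ y ×
              value x ≤ value e × value y ≤ value e
            mass′ : weight (link X u) (linkWeight X u d w) A′ ≈ massAbove u (Core.Aᵤ u)
            mass′ = ≈-trans (weight-link X u A′ (relWeight u)) (antisym
              (massAbove-mono proj₂ λ (u≤x , a) → a , u≤x) (massAbove-mono proj₁ λ (a , u≤x) → u≤x , a))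

          disjoint : mass Core.Disjoint ≤ᴿ α∥ * mass A + β∥ * mass A ^ 2
          disjoint = ≤-resp (∑ℝ≈Σᶠ X Core.Disjoint w)
            (ℝ.+-cong (ℝ.*-congˡ (∑ℝ≈Σᶠ X A w)) (ℝ.*-congˡ (ℝ.*-cong (∑ℝ≈Σᶠ X A w) (ℝ.*-congʳ (∑ℝ≈Σᶠ X A w)))))
            (skeleton∥ A A⊆)

        private
          H ρ : Real
          H = h₀ ⁻¹ * h₋₁ ⁻¹ + h∥ ⁻¹
          ρ = H ⁻¹

          0<h₀⁻¹h₋₁⁻¹ = *-pos (⁻¹-pos 0<h₀) (⁻¹-pos 0<h₋₁)
          0<h∥⁻¹ = ⁻¹-pos 0<h∥

          0<H : 0# <ᴿ H
          0<H = <-≤-trans 0<h∥⁻¹ (≤-resp (ℝ.+-identityˡ _) ≈-refl (+-monoˡ-≤ _ (<⇒≤ 0<h₀⁻¹h₋₁⁻¹)))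

          0<ρ : 0# <ᴿ ρ
          0<ρ = ⁻¹-pos 0<H

          ρ≤ : ∀ {h} → 0# ≤ᴿ h → 1# ≤ᴿ h * H → ρ ≤ᴿ h
          ρ≤ {h} 0≤h 1≤hH = ≤-resp (ℝ.*-identityˡ _)
            (≈-trans (ℝ.*-assoc _ _ _) (≈-trans (ℝ.*-congˡ (*-inverseʳ⁺ 0<H)) (ℝ.*-identityʳ _)))
            (*-monoˡ-≤ (<⇒≤ 0<ρ) 1≤hH)

          ρ≤h∥ : ρ ≤ᴿ h∥
          ρ≤h∥ = ρ≤ (<⇒≤ 0<h∥) (≤-resp (*-inverseʳ⁺ 0<h∥) ≈-refl (*-monoʳ-≤ (<⇒≤ 0<h∥)
            (≤-resp (ℝ.+-identityˡ _) ≈-refl (+-monoˡ-≤ _ (<⇒≤ 0<h₀⁻¹h₋₁⁻¹)))))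

          ρ≤h₀h₋₁ : ρ ≤ᴿ h₀ * h₋₁
          ρ≤h₀h₋₁ = ρ≤ (ℝ.*-nonNeg (<⇒≤ 0<h₀) (<⇒≤ 0<h₋₁)) (≤-resp
            (≈-trans (solve 4 (λ a b x y → (a :* b) :* (x :* y) := (a :* x) :* (b :* y)) ≈-refl h₀ h₋₁ (h₀ ⁻¹) (h₋₁ ⁻¹))
              (≈-trans (ℝ.*-cong (*-inverseʳ⁺ 0<h₀) (*-inverseʳ⁺ 0<h₋₁)) (ℝ.*-identityˡ _)))
            ≈-refl (*-monoʳ-≤ (ℝ.*-nonNeg (<⇒≤ 0<h₀) (<⇒≤ 0<h₋₁))
              (≤-resp (ℝ.+-identityʳ _) ≈-refl (ℝ.+-monoʳ-≤ _ (<⇒≤ 0<h∥⁻¹)))))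

          scale-h₀ : ∀ {q} → q * μ ≤ᴿ τ * n₋ → q * h₀ * μ ≤ᴿ τ * (n₋ * h₀)
          scale-h₀ {q} h = ≤-resp (solve 3 (λ q m h → (q :* m) :* h := (q :* h) :* m) ≈-refl q μ h₀) (ℝ.*-assoc τ n₋ h₀)
            (*-monoˡ-≤ (<⇒≤ 0<h₀) h)

        correction-output : ∀ {q} → 0# <ᴿ q → q * μ ≤ᴿ τ * n₋ → ∀ f → μ * norm w (δ f) ≤ᴿ ρ →
          ∀ f′ → Star _⟶[ q * h₀ ]_ f f′ → IsNormalForm _⟶[ q * h₀ ]_ f′ →
          Z f′ × q * h₀ * dist w f f′ ≤ᴿ norm w (δ f)
        correction-output {q} 0<q q-small f f-small f′ path normal =
          normalForm-cocycle (scale-h₀ q-small) f′ normal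
            (≤-trans (≤-resp ≈-refl (ℝ.*-comm _ _) (x≤x*y (0≤norm (δ f′)) 1≤μ)) (≤-trans f′-small ρ≤h∥))
            (≤-trans f′-small ρ≤h₀h₋₁) ,
          ≤-trans (≤-resp (ℝ.+-identityˡ _) ≈-refl (+-monoˡ-≤ _ (0≤norm (δ f′)))) total-drop
          where
          0≤qh₀ = <⇒≤ (*-pos 0<q 0<h₀)
          total-drop = correction-path 0≤qh₀ path
          f′-small : μ * norm w (δ f′) ≤ᴿ ρ
          f′-small = ≤-trans (*-monoʳ-≤ (<⇒≤ 0<μ) (≤-trans (≤-resp (ℝ.+-identityʳ _) ≈-refl
            (ℝ.+-monoʳ-≤ _ (ℝ.*-nonNeg 0≤qh₀ (0≤norm (f -ᶜ f′))))) total-drop)) f-small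

        private
          0≤distZ : ∀ f → 0# ≤ᴿ distTo w f (Z {0ℤ})
          0≤distZ f = 0≤distTo f Z (∃Z)

        cse-bound : h₋₁ ≤ᴿ 1# → fin (E″ ÷ H) ≤± cse w 0ℤ
        cse-bound h₋₁≤1 = ∈⇒≤sup (ℝ.*-nonNeg (<⇒≤ 0<E″) (<⇒≤ 0<ρ) , slope)
          where
          slope : ∀ f → E″ * ρ * distTo w f Z ≤ᴿ norm w (δ f)
          slope f with em {P = μ * norm w (δ f) ≤ᴿ ρ}
          ... | yes f-small =
            let f′ , path , normal = acc⇒normalForm _⟶[ E″ * h₀ ]_ (correction-terminates (*-pos 0<E″ 0<h₀) f)
                Zf′ , bound = correction-output 0<E″ E″-small f f-small f′ path normal
            in begin
              E″ * ρ * distTo w f Z    ≤⟨ *-monoˡ-≤ (0≤distZ f) (*-monoʳ-≤ (<⇒≤ 0<E″)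
                                            (≤-trans ρ≤h₀h₋₁ (x*y≤x (<⇒≤ 0<h₀) h₋₁≤1))) ⟩
              E″ * h₀ * distTo w f Z   ≤⟨ *-monoʳ-≤ (<⇒≤ (*-pos 0<E″ 0<h₀)) (distTo-≤ f Z {f′} Zf′) ⟩
              E″ * h₀ * dist w f f′    ≤⟨ bound ⟩
              norm w (δ f)             ∎
          ... | no f-large = begin
              E″ * ρ * distTo w f Z    ≤⟨ *-monoʳ-≤ (ℝ.*-nonNeg (<⇒≤ 0<E″) (<⇒≤ 0<ρ)) (≤-trans
                                            (distTo-≤ f Z {0ᶜ} (proj₂ (∃Z)))
                                            (≤-trans (weight-mono X 0≤w {P = Support (f -ᶜ 0ᶜ)} proj₁)
                                                     (weight≤1 0ℤ))) ⟩
              E″ * ρ * 1#              ≈⟨ ℝ.*-identityʳ _ ⟩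
              E″ * ρ                   ≤⟨ *-monoʳ-≤ (<⇒≤ 0<E″) (<⇒≤ (≰⇒> f-large)) ⟩
              E″ * (μ * norm w (δ f))  ≈⟨ ℝ.*-assoc _ _ _ ⟨
              E″ * μ * norm w (δ f)    ≤⟨ *-monoˡ-≤ (0≤norm (δ f)) E″-small₁ ⟩
              1# * norm w (δ f)        ≈⟨ ℝ.*-identityˡ _ ⟩
              norm w (δ f)             ∎

        private
          coboundary-≤-distTo : ∀ f → norm w (δ f) ≤ᴿ distTo w f Z * (μ * n₊)
          coboundary-≤-distTo f = begin
            norm w (δ f)                              ≈⟨ cancel ⟨
            norm w (δ f) * (μ * n₊) ⁻¹ * (μ * n₊)     ≤⟨ *-monoˡ-≤ (<⇒≤ 0<μn) (distTo-greatest f Z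
                                                           (∃Z) λ {g} Zg → x≤y*z⇒x*y⁻¹≤z 0<μn
                                                           (≤-resp ≈-refl (ℝ.*-comm _ _)
                                                             (coboundary-≤
                                                               2≤d (<⇒≤ 0<n₊) ≤n₊ f g Zg))) ⟩
            distTo w f Z * (μ * n₊)                   ∎
            where
            0<μn : 0# <ᴿ μ * n₊
            0<μn = *-pos 0<μ 0<n₊
            cancel : norm w (δ f) * (μ * n₊) ⁻¹ * (μ * n₊) ≈ norm w (δ f)
            cancel = ≈-trans (ℝ.*-assoc _ _ _) (≈-trans (ℝ.*-congˡ (*-inverseˡ 0<μn)) (ℝ.*-identityʳ _))

        correction-returns : ∀ f → distTo w f Z <ᴿ D ÷ H →
          CorrectionReturns {R = R} X or 𝓕 w 0ℤ (D′ * h₀) f (λ f′ →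
            Z f′ × dist w f f′ ≤ᴿ (1# ÷ (D″ * h₀)) * distTo w f Z)
        correction-returns f f-close = correction-terminates (*-pos 0<D′ 0<h₀) f , λ f′ path normal →
          let Zf′ , bound = correction-output 0<D′ D′-small f f-small f′ path normal
          in Zf′ , near f′ bound
          where
          t = distTo w f Z
          f-small : μ * norm w (δ f) ≤ᴿ ρ
          f-small = begin
            μ * norm w (δ f)          ≤⟨ *-monoʳ-≤ (<⇒≤ 0<μ) (coboundary-≤-distTo f) ⟩
            μ * (t * (μ * n₊))        ≤⟨ *-monoʳ-≤ (<⇒≤ 0<μ) (*-monoˡ-≤ (<⇒≤ (*-pos 0<μ 0<n₊)) (<⇒≤ f-close)) ⟩
            μ * (D * ρ * (μ * n₊))    ≈⟨ solve 4 (λ m d r n → m :* (d :* r :* (m :* n)) := (m :* n :* d :* m) :* r) ≈-refl μ D ρ n₊ ⟩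
            (μ * n₊ * D * μ) * ρ      ≤⟨ *-monoˡ-≤ (<⇒≤ 0<ρ) D-small ⟩
            1# * ρ                    ≈⟨ ℝ.*-identityˡ ρ ⟩
            ρ                         ∎
          0<D″h₀ : 0# <ᴿ D″ * h₀
          0<D″h₀ = *-pos 0<D″ 0<h₀
          near : ∀ f′ → D′ * h₀ * dist w f f′ ≤ᴿ norm w (δ f) → dist w f f′ ≤ᴿ (1# ÷ (D″ * h₀)) * t
          near f′ bound = ≤-resp ≈-refl
            (solve 2 (λ t i → t :* i := (con 1 :* i) :* t) ≈-refl t ((D″ * h₀) ⁻¹))
            (x*y≤z⇒x≤z*y⁻¹ 0<D″h₀ (*-cancelˡ-≤ (*-pos 0<μ 0<n₊) (begin
              μ * n₊ * (s * (D″ * h₀))   ≈⟨ solve 4 (λ k s d h → k :* (s :* (d :* h)) := (d :* k) :* (h :* s)) ≈-refl (μ * n₊) s D″ h₀ ⟩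
              D″ * (μ * n₊) * (h₀ * s)   ≤⟨ *-monoˡ-≤ (ℝ.*-nonNeg (<⇒≤ 0<h₀) (0≤norm (f -ᶜ f′))) D″-small ⟩
              D′ * (h₀ * s)              ≈⟨ ℝ.*-assoc _ _ _ ⟨
              D′ * h₀ * s                ≤⟨ bound ⟩
              norm w (δ f)               ≤⟨ coboundary-≤-distTo f ⟩
              t * (μ * n₊)               ≈⟨ ℝ.*-comm _ _ ⟩
              μ * n₊ * t                 ∎)))
            where s = dist w f f′

      private
        Eε≤ : ∀ (f : C 0ℤ) → Z f → ¬ B f → E * ε ≤ᴿ α₋₁ + β₋₁ * norm w f
        Eε≤ f Zf ¬Bf = *-cancelˡ-≤ 0<μ (begin
          μ * (E * ε)                     ≈⟨ solve 3 (λ m e x → m :* (e :* x) := (e :* m) :* x) ≈-refl μ E ε ⟩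
          E * μ * ε                       ≤⟨ *-monoˡ-≤ (<⇒≤ 0<ε) E-small ⟩
          1# * ε                          ≈⟨ ℝ.*-identityˡ ε ⟩
          ε                               ≤⟨ cocycle-support-large dimA expand
                                               (skeleton₋₁-mass dimA) nonempty ⟩
          μ * (α₋₁ + β₋₁ * mass A)           ≈⟨ ℝ.*-congˡ (ℝ.+-congˡ (ℝ.*-congˡ (≈-trans
                                               (antisym (mass-mono toWitness) (mass-mono fromWitness)) (≈-sym (∑ℝ≈Σᶠ X (Support f) w))))) ⟩
          μ * (α₋₁ + β₋₁ * norm w f)      ∎)
          where
          A : Pred Carrier 0ℓ
          A = ⌊ Support f ⌋
          dimA : ∀ {v} → A v → dim v ≡ 0ℤ
          dimA a = proj₁ (toWitness a)
          expand : ∀ {v} → A v → ε ≤ᴿ massAbove v λ e → dim e ≡ 1ℤ × v ≤ e × ∃ λ v′ → A v′ × v ≢ v′ × v′ ≤ e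
          expand {v} a = let Sv = toWitness a in ≤-trans
            (expansion-at-face v (proj₁ Sv) (<⇒≤ 0<ε) (cbe-vertex₋₁ v (proj₁ Sv)) f Sv Zf)
            (massAbove-mono (proj₁ ∘ proj₂) λ (de , v≤e , x , Sx , rest) → de , v≤e , x , fromWitness Sx , rest)
          nonempty : ∃ A
          nonempty = by-contradiction λ ∄ → ¬Bf (0ᶜ , λ y p → S.≈ᴹ-trans y
            (by-contradiction λ nz → ∄ (y , fromWitness (recompute (dim y ℤₚ.≟ 0ℤ) p , nz)))
            (S.≈ᴹ-sym y (d-0 {ℤ.pred 0ℤ} {0ᶜ} {y} {p} λ {x} _ _ → S.≈ᴹ-refl x)))

      ccd-bound : α₋₁ <ᴿ E * ε → ((E‴ * (E * ε ℝ.- α₋₁)) ÷∞ β₋₁) ≤± ccd w 0ℤ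
      ccd-bound α₋₁<Eε with em {P = β₋₁ ≈ 0#}
      ... | yes β≈0 = ⊤≤inf-∅ λ (f , Zf , ¬Bf , _) → <⇒≱ α₋₁<Eε (begin
              E * ε                            ≤⟨ Eε≤ f Zf ¬Bf ⟩
              α₋₁ + β₋₁ * norm w f             ≈⟨ ℝ.+-congˡ (≈-trans (ℝ.*-congʳ β≈0) (ℝ.zeroˡ _)) ⟩
              α₋₁ + 0#                         ≈⟨ ℝ.+-identityʳ _ ⟩
              α₋₁                              ∎)
      ... | no β≉0 = ∈⇒≤sup λ (f , Zf , ¬Bf , t≈) → ≤-resp ≈-refl (≈-sym t≈)
              (x≤y*z⇒x*y⁻¹≤z (0≤β₋₁ , β≉0 ∘ ≈-sym) (begin
                E‴ * (E * ε ℝ.- α₋₁)   ≤⟨ *-monoˡ-≤ (x≤y⇒0≤y-x (<⇒≤ α₋₁<Eε)) E‴≤1 ⟩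
                1# * (E * ε ℝ.- α₋₁)   ≈⟨ ℝ.*-identityˡ _ ⟩
                E * ε ℝ.- α₋₁          ≤⟨ x≤z+y⇒x-y≤z (≤-trans (Eε≤ f Zf ¬Bf) (≤-reflexive (≈-trans (ℝ.+-comm _ _) (ℝ.+-congʳ (ℝ.*-comm _ _))))) ⟩
                norm w f * β₋₁         ∎))

module FaceCounts (em : ∀ {ℓ} → ExcludedMiddle ℓ) (ℝ : CompleteOrderedField) where
  open Classical em ℝ hiding (module ℝ)
  private module ℝ = CompleteOrderedField ℝ
  open OrderedField ℝ hiding (total)
  open Indicators em ℝ
  open Weights em ℝ
  open Cosystolic em ℝ
  open ListSum ℝ.+-commutativeMonoid
  private
    module ℝ-Extrema = Extrema ℝ.totalOrder

  module _ {d : ℕ} {X : GradedPoset} (isDPoset : IsDPoset d X) where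
    open GradedPoset X renaming (≤-refl to ≼-refl; ≤-trans to ≼-trans)
    open IsDPoset isDPoset
    open Grading em X
    open DPosetDimensions isDPoset

    private
      Between : Carrier → ℤ → Carrier → Pred Carrier 0ℓ
      Between x j z y = Faces j y × x ≤ y × y ≤ z

    count∈faceCounts : ∀ {x z} j → x ≤ z → # X (Between x j z) ∈ faceCounts X (dim x) j (dim z)
    count∈faceCounts {x} {z} j x≤z = ∈-map⁺ _
      (∈-filter⁺ (λ (x′ , z′) → em {P = Faces (dim x) x′ × Faces (dim z) z′ × x′ ≤ z′})
        (∈-cartesianProduct⁺ (faces-complete x) (faces-complete z)) (≡.refl , ≡.refl , x≤z))

    count≤Fmax : ∀ {x z} j → x ≤ z → # X (Between x j z) ℕ.≤ Fmax X (dim x) j (dim z)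
    count≤Fmax {x} {z} j x≤z = All.lookup (ℕExtrema.xs≤max 0 (faceCounts X (dim x) j (dim z))) (count∈faceCounts j x≤z)

    Fmin≤count : ∀ {x z} j → x ≤ z → Fmin X (dim x) j (dim z) ℕ.≤ # X (Between x j z)
    Fmin≤count {x} {z} j x≤z = All.lookup (ℕExtrema.min≤xs (length faces) (faceCounts X (dim x) j (dim z))) (count∈faceCounts j x≤z)

    1≤Fmin : ∀ {i j k} → i ℤ.≤ j → j ℤ.≤ k → 1 ℕ.≤ Fmin X i j k
    1≤Fmin {i} {j} {k} i≤j j≤k = ℕExtrema.v≤min⁺ 1≤faces (All.tabulate positive)
      where
      1≤faces : 1 ℕ.≤ length faces
      1≤faces with faces | faces-complete ∅
      ... | _ ∷ _ | _ = ℕ.s≤s ℕ.z≤n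
      positive : ∀ {n} → n ∈ faceCounts X i j k → 1 ℕ.≤ n
      positive n∈ with ∈-map⁻ _ n∈
      ... | (x , z) , xz∈ , ≡.refl with ∈-filter⁻ (λ (x , z) → em {P = Faces i x × Faces k z × x ≤ z}) {xs = cartesianProduct faces faces} xz∈
      ...   | _ , ≡.refl , ≡.refl , x≤z = let y , between = face-between x≤z i≤j j≤k in #-pos X {P = Between x j z} between

    lowerIrregularity⇒Comparable : ∀ {Λ} → lowerIrregularity X d ≤ᴿ Λ → Comparable X Λ
    lowerIrregularity⇒Comparable {Λ} irr≤Λ {x} {x′} {z} {z′} j dx≡ dz≡ x≤z x′≤z′ dx≤j j≤dz = begin
      fromℕ (# X (Between x j z))               ≤⟨ fromℕ-mono (count≤Fmax j x≤z) ⟩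
      fromℕ (Fmax X (dim x) j (dim z))          ≈⟨ ≈-trans (ℝ.*-assoc _ _ _) (≈-trans (ℝ.*-congˡ (*-inverseˡ Fmin-pos)) (ℝ.*-identityʳ _)) ⟨
      irregularity X (dim x) j (dim z) * Fm     ≤⟨ *-monoˡ-≤ (<⇒≤ Fmin-pos) (≤-trans (All.lookup (ℝ-Extrema.xs≤max 0# (List.map (λ (i , j , k) → irregularity X i j k) triples))
                                                     (∈-map⁺ (λ (i , j , k) → irregularity X i j k) triple)) irr≤Λ) ⟩
      Λ * Fm                                    ≤⟨ *-monoʳ-≤ 0≤Λ (fromℕ-mono (≡.subst₂ (λ i k → Fmin X i j k ℕ.≤ # X (Between x′ j z′))
                                                     (≡.sym dx≡) (≡.sym dz≡) (Fmin≤count j x′≤z′))) ⟩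
      Λ * fromℕ (# X (Between x′ j z′))         ∎
      where
      Fm = fromℕ (Fmin X (dim x) j (dim z))
      Fmin-pos : 0# <ᴿ Fm
      Fmin-pos = fromℕ-pos (1≤Fmin dx≤j j≤dz)
      dims = List.map (λ n → pos n ℤ.- 1ℤ) (upTo (d ℕ.+ 2))
      dim∈ : ∀ {i} → -1ℤ ℤ.≤ i → i ℤ.≤ pos d → i ∈ dims
      dim∈ {i} -1≤i i≤d = ≡.subst (_∈ dims) ([i+1]-1≡i -1≤i) (∈-map⁺ (λ n → pos n ℤ.- 1ℤ) (∈-upTo⁺ n<))
        where
        n = ℤ.∣ i ℤ.+ 1ℤ ∣
        n≡ : pos n ≡ i ℤ.+ 1ℤ
        n≡ = ℤₚ.0≤i⇒+∣i∣≡i (ℤₚ.+-monoˡ-≤ 1ℤ -1≤i)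
        n< : n ℕ.< d ℕ.+ 2
        n< = ≡.subst (n ℕ.<_) (≡.sym (ℕₚ.+-suc d 1)) (ℕ.s≤s (ℤₚ.drop‿+≤+ (≡.subst (ℤ._≤ pos (d ℕ.+ 1)) (≡.sym n≡)
          (ℤₚ.+-monoˡ-≤ 1ℤ i≤d))))
      triples = filter (λ (i , j , k) → (i ℤₚ.≤? j) ×-dec (j ℤₚ.≤? k))
                  (cartesianProduct dims (cartesianProduct dims dims))
      triple : (dim x , j , dim z) ∈ triples
      triple = ∈-filter⁺ (λ (i , j , k) → (i ℤₚ.≤? j) ×-dec (j ℤₚ.≤? k))
        (∈-cartesianProduct⁺ (dim∈ (-1≤dim x) (dim≤d x)) (∈-cartesianProduct⁺
          (dim∈ (ℤₚ.≤-trans (-1≤dim x) dx≤j) (ℤₚ.≤-trans j≤dz (dim≤d z))) (dim∈ (-1≤dim z) (dim≤d z))))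
        (dx≤j , j≤dz)
      0≤Λ : 0# ≤ᴿ Λ
      0≤Λ = ≤-trans (ℝ-Extrema.⊥≤max 0# (List.map (λ (i , j , k) → irregularity X i j k) triples)) irr≤Λ

    module _ {F : ℕ} (2≤d : pos 2 ℤ.≤ pos d) (F₀ : Fmax X -1ℤ 0ℤ (pos 2) ℕ.≤ F) (F₁ : Fmax X -1ℤ 1ℤ (pos 2) ℕ.≤ F) where

      private
        between-∅≤F : ∀ {z i} → dim z ≡ pos 2 → i ≡ 0ℤ ⊎ i ≡ 1ℤ → # X (Between ∅ i z) ℕ.≤ F
        between-∅≤F {z} dz (inj₁ ≡.refl) = ℕₚ.≤-trans (≡.subst₂ (λ i k → # X (Between ∅ 0ℤ z) ℕ.≤ Fmax X i 0ℤ k) dim-∅ dz (count≤Fmax 0ℤ (∅-min z))) F₀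
        between-∅≤F {z} dz (inj₂ ≡.refl) = ℕₚ.≤-trans (≡.subst₂ (λ i k → # X (Between ∅ 1ℤ z) ℕ.≤ Fmax X i 1ℤ k) dim-∅ dz (count≤Fmax 1ℤ (∅-min z))) F₁

        face₂ : ∃ λ z → dim z ≡ pos 2
        face₂ = let y , dy , ∅≤y = pure ∅
                    z , dz , _ = face-between ∅≤y (≡.subst (ℤ._≤ pos 2) (≡.sym dim-∅) ℤ.-≤+) (≡.subst (pos 2 ℤ.≤_) (≡.sym dy) 2≤d)
                in z , dz

      1≤F : 1 ℕ.≤ F
      1≤F = let z , dz = face₂
                v , between = face-between (∅-min z) (≡.subst (ℤ._≤ 0ℤ) (≡.sym dim-∅) ℤ.-≤+) (≡.subst (0ℤ ℤ.≤_) (≡.sym dz) (ℤ.+≤+ ℕ.z≤n))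
            in ℕₚ.≤-trans (#-pos X {P = Between ∅ 0ℤ z} between) (between-∅≤F dz (inj₁ ≡.refl))

      faceBounds : FaceBounds X 1# (fromℕ F) (fromℕ F)
      faceBounds = record
        { n₋≤ = λ {e} de → let v , dv , _ , v≤e = face-between (∅-min e) (≡.subst (ℤ._≤ 0ℤ) (≡.sym dim-∅) ℤ.-≤+)
                                                    (≡.subst (0ℤ ℤ.≤_) (≡.sym de) (ℤ.+≤+ ℕ.z≤n))
                            in 1≤fromℕ (#-pos X {P = FacesOf e 0ℤ} (dv , v≤e))
        ; ≤n₊ = λ {e} de →
            let y , dy , e≤y = pure e
                z , dz , e≤z , _ = face-between e≤y (≡.subst (ℤ._≤ pos 2) (≡.sym de) (ℤ.+≤+ (ℕ.s≤s ℕ.z≤n))) (≡.subst (pos 2 ℤ.≤_) (≡.sym dy) 2≤d)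
            in ≤-trans (≤-resp (≈-sym (#≈Σᶠ X (FacesOf e 0ℤ))) (≈-sym (#≈Σᶠ X (FacesOf z 0ℤ)))
                 (sumOver-mono faces λ x → χ-mono λ (dx , x≤e) → dx , ≼-trans x≤e e≤z)) (≤V dz (inj₁ ≡.refl))
        ; ≤V  = ≤V
        }
        where
        ≤V : ∀ {z i} → dim z ≡ pos 2 → i ≡ 0ℤ ⊎ i ≡ 1ℤ → fromℕ (# X (FacesOf z i)) ≤ᴿ fromℕ F
        ≤V {z} {i} dz h = ≤-trans (≤-reflexive (#FacesOf≈ isDPoset z i)) (fromℕ-mono (between-∅≤F dz h))

    module Formula (N : ℤ → ℤ → ℤ → ℕ)
      (formula : ∀ {x z} j → x ≤ z → dim x ℤ.≤ j → j ℤ.≤ dim z → # X (Between x j z) ≡ N (dim x) j (dim z)) where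

      formula⇒Comparable : Comparable X 1#
      formula⇒Comparable {x} {x′} {z} {z′} j dx≡ dz≡ x≤z x′≤z′ dx≤j j≤dz = ≤-reflexive (≈-trans
        (≈-reflexive (≡.cong fromℕ (≡.trans (formula j x≤z dx≤j j≤dz) (≡.trans (≡.cong₂ (λ i k → N i j k) dx≡ dz≡)
          (≡.sym (formula j x′≤z′ (≡.subst (ℤ._≤ j) dx≡ dx≤j) (≡.subst (j ℤ.≤_) dz≡ j≤dz)))))))
        (≈-sym (ℝ.*-identityˡ _)))

      formula⇒FacesOf : ∀ {z j k} → dim z ≡ k → -1ℤ ℤ.≤ j → j ℤ.≤ k → fromℕ (# X (FacesOf z j)) ≈ fromℕ (N -1ℤ j k)
      formula⇒FacesOf {z} {j} ≡.refl -1≤j j≤k = ≈-trans (#FacesOf≈ isDPoset z j) (≈-reflexive (≡.cong fromℕ (≡.trans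
        (formula j (∅-min z) (≡.subst (ℤ._≤ j) (≡.sym dim-∅) -1≤j) j≤k) (≡.cong (λ i → N i j (dim z)) dim-∅))))

      formula⇒FaceBounds : FaceBounds X (fromℕ (N -1ℤ 0ℤ 1ℤ)) (fromℕ (N -1ℤ 0ℤ 1ℤ)) (fromℕ (N -1ℤ 0ℤ (pos 2) ℕ.⊔ N -1ℤ 1ℤ (pos 2)))
      formula⇒FaceBounds = record
        { n₋≤ = λ de → ≤-reflexive (≈-sym (formula⇒FacesOf de ℤ.-≤+ (ℤ.+≤+ ℕ.z≤n)))
        ; ≤n₊ = λ de → ≤-reflexive (formula⇒FacesOf de ℤ.-≤+ (ℤ.+≤+ ℕ.z≤n))
        ; ≤V  = λ { dz (inj₁ ≡.refl) → ≤-trans (≤-reflexive (formula⇒FacesOf dz ℤ.-≤+ (ℤ.+≤+ ℕ.z≤n))) (fromℕ-mono (ℕₚ.m≤m⊔n (N -1ℤ 0ℤ (pos 2)) (N -1ℤ 1ℤ (pos 2))))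
                  ; dz (inj₂ ≡.refl) → ≤-trans (≤-reflexive (formula⇒FacesOf dz ℤ.-≤+ (ℤ.+≤+ (ℕ.s≤s ℕ.z≤n)))) (fromℕ-mono (ℕₚ.m≤n⊔m (N -1ℤ 0ℤ (pos 2)) (N -1ℤ 1ℤ (pos 2)))) }
        }

  module _ {a} {A : Set a} (X : GradedPoset) {p} {P : Pred (GradedPoset.Carrier X) p} {xs : List A} (unique : Unique xs) where
    open GradedPoset X using (Carrier; faces; faces-complete; faces-unique)

    private
      P? : ∀ x → Dec (P x)
      P? x = em {P = P x}

      ∈-faces : ∀ {x} → P x → x ∈ filter P? faces
      ∈-faces {x} = ∈-filter⁺ P? (faces-complete x)

      faces-∈ : ∀ {x} → x ∈ filter P? faces → P x
      faces-∈ = proj₂ ∘ ∈-filter⁻ P? {xs = faces}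

    #≡length-to : (f : Carrier → A) → (∀ {x y} → f x ≡ f y → x ≡ y) →
      (∀ {x} → P x → f x ∈ xs) → (∀ {b} → b ∈ xs → ∃ λ x → P x × f x ≡ b) → # X P ≡ length xs
    #≡length-to f inj to from = ≡.trans (≡.sym (length-map f (filter P? faces)))
      (↭-length (∼bag⇒↭ (unique∧set⇒bag (Unique.map⁺ inj (Unique.filter⁺ P? faces-unique)) unique
        (mk⇔ (λ b∈ → let x , x∈ , b≡ = ∈-map⁻ f b∈ in ≡.subst (_∈ xs) (≡.sym b≡) (to (faces-∈ x∈)))
             (λ b∈ → let x , Px , fx≡b = from b∈ in ≡.subst (_∈ List.map f (filter P? faces)) fx≡b (∈-map⁺ f (∈-faces Px)))))))

    #≡length-from : (f : A → Carrier) → (∀ {a b} → f a ≡ f b → a ≡ b) →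
      (∀ {b} → b ∈ xs → P (f b)) → (∀ {x} → P x → ∃ λ b → b ∈ xs × f b ≡ x) → # X P ≡ length xs
    #≡length-from f inj to from = ≡.trans
      (↭-length (∼bag⇒↭ (unique∧set⇒bag (Unique.filter⁺ P? faces-unique) (Unique.map⁺ inj unique)
        (mk⇔ (λ x∈ → let b , b∈ , fb≡x = from (faces-∈ x∈) in ≡.subst (_∈ List.map f xs) fb≡x (∈-map⁺ f b∈))
             (λ x∈ → let b , b∈ , x≡ = ∈-map⁻ f x∈ in ≡.subst (_∈ filter P? faces) (≡.sym x≡) (∈-faces (to b∈)))))))
      (length-map f xs)

pascal : ℕ → ℕ → ℕ
pascal t       zero    = 1
pascal zero    (suc k) = 0
pascal (suc t) (suc k) = pascal t (suc k) ℕ.+ pascal t k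

-- The number of k-element sets between an s-element set and a set with t more elements.
intervals : ℕ → ℕ → ℕ → ℕ
intervals zero    t k       = pascal t k
intervals (suc s) t zero    = 0
intervals (suc s) t (suc k) = intervals s t k

intervals-zero : ∀ s t → intervals s (suc t) 0 ≡ intervals s t 0
intervals-zero zero    t = ≡.refl
intervals-zero (suc s) t = ≡.refl

intervals-suc : ∀ s t k → intervals s (suc t) (suc k) ≡ intervals s t (suc k) ℕ.+ intervals s t k
intervals-suc zero    t k       = ≡.refl
intervals-suc (suc s) t zero    = ≡.trans (intervals-zero s t) (≡.sym (ℕₚ.+-identityʳ _))
intervals-suc (suc s) t (suc k) = intervals-suc s t k

module _ {a} {A : Set a} where

  map-∷-disjoint : ∀ {n} {x y : A} → x ≢ y → {xs ys : List (Vec A n)} →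
                   DisjointLists (List.map (x Vecs.∷_) xs) (List.map (y Vecs.∷_) ys)
  map-∷-disjoint x≢y (u∈ , v∈) with ∈-map⁻ _ u∈ | ∈-map⁻ _ v∈
  ... | _ , _ , ≡.refl | _ , _ , ≡.refl = x≢y ≡.refl

  map-∷-unique : ∀ {n} (x : A) {xs : List (Vec A n)} → Unique xs → Unique (List.map (x Vecs.∷_) xs)
  map-∷-unique x = Unique.map⁺ (λ { ≡.refl → ≡.refl })

module _ where
  open Subset using (inside; outside; ∣_∣) renaming (_⊆_ to _⊆ˢ_)
  open Vecs using ([]; _∷_; here; there)

  subsetsBetween : ∀ {n} → Subset n → Subset n → ℕ → List (Subset n)
  subsetsBetween []            []            zero    = [] ∷ []
  subsetsBetween []            []            (suc k) = []
  subsetsBetween (inside  ∷ S) (inside  ∷ U) zero    = []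
  subsetsBetween (inside  ∷ S) (inside  ∷ U) (suc k) = List.map (inside ∷_) (subsetsBetween S U k)
  subsetsBetween (inside  ∷ S) (outside ∷ U) k       = []
  subsetsBetween (outside ∷ S) (inside  ∷ U) zero    = List.map (outside ∷_) (subsetsBetween S U zero)
  subsetsBetween (outside ∷ S) (inside  ∷ U) (suc k) =
    List.map (outside ∷_) (subsetsBetween S U (suc k)) ++ List.map (inside ∷_) (subsetsBetween S U k)
  subsetsBetween (outside ∷ S) (outside ∷ U) k       = List.map (outside ∷_) (subsetsBetween S U k)

  subsetsBetween-unique : ∀ {n} (S U : Subset n) k → Unique (subsetsBetween S U k)
  subsetsBetween-unique []            []            zero    = [] ∷ []
  subsetsBetween-unique []            []            (suc k) = []
  subsetsBetween-unique (inside  ∷ S) (inside  ∷ U) zero    = []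
  subsetsBetween-unique (inside  ∷ S) (inside  ∷ U) (suc k) = map-∷-unique inside (subsetsBetween-unique S U k)
  subsetsBetween-unique (inside  ∷ S) (outside ∷ U) k       = []
  subsetsBetween-unique (outside ∷ S) (inside  ∷ U) zero    = map-∷-unique outside (subsetsBetween-unique S U zero)
  subsetsBetween-unique (outside ∷ S) (inside  ∷ U) (suc k) =
    Unique.++⁺ (map-∷-unique outside (subsetsBetween-unique S U (suc k)))
               (map-∷-unique inside (subsetsBetween-unique S U k)) (map-∷-disjoint λ ())
  subsetsBetween-unique (outside ∷ S) (outside ∷ U) k       = map-∷-unique outside (subsetsBetween-unique S U k)

  ∈-subsetsBetween⁻ : ∀ {n} (S U : Subset n) k {T} → T ∈ subsetsBetween S U k → S ⊆ˢ T × T ⊆ˢ U × ∣ T ∣ ≡ k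
  ∈-subsetsBetween⁻ [] [] zero (here ≡.refl) = id , id , ≡.refl
  ∈-subsetsBetween⁻ (inside ∷ S) (inside ∷ U) (suc k) T∈ with ∈-map⁻ _ T∈
  ... | T , T∈′ , ≡.refl = let a , b , c = ∈-subsetsBetween⁻ S U k T∈′ in s⊆s a , s⊆s b , ≡.cong suc c
  ∈-subsetsBetween⁻ (outside ∷ S) (inside ∷ U) zero T∈ with ∈-map⁻ _ T∈
  ... | T , T∈′ , ≡.refl = let a , b , c = ∈-subsetsBetween⁻ S U zero T∈′ in s⊆s a , out⊆ b , c
  ∈-subsetsBetween⁻ (outside ∷ S) (inside ∷ U) (suc k) T∈
    with ∈-++⁻ (List.map (outside ∷_) (subsetsBetween S U (suc k))) T∈
  ... | inj₁ T∈ˡ with ∈-map⁻ _ T∈ˡ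
  ...   | T , T∈′ , ≡.refl = let a , b , c = ∈-subsetsBetween⁻ S U (suc k) T∈′ in s⊆s a , out⊆ b , c
  ∈-subsetsBetween⁻ (outside ∷ S) (inside ∷ U) (suc k) T∈ | inj₂ T∈ʳ with ∈-map⁻ _ T∈ʳ
  ...   | T , T∈′ , ≡.refl = let a , b , c = ∈-subsetsBetween⁻ S U k T∈′ in out⊆ a , s⊆s b , ≡.cong suc c
  ∈-subsetsBetween⁻ (outside ∷ S) (outside ∷ U) k T∈ with ∈-map⁻ _ T∈
  ... | T , T∈′ , ≡.refl = let a , b , c = ∈-subsetsBetween⁻ S U k T∈′ in s⊆s a , s⊆s b , c

  ∈-subsetsBetween⁺ : ∀ {n} (S T U : Subset n) {k} → S ⊆ˢ T → T ⊆ˢ U → ∣ T ∣ ≡ k → T ∈ subsetsBetween S U k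
  ∈-subsetsBetween⁺ [] [] [] S⊆T T⊆U ≡.refl = here ≡.refl
  ∈-subsetsBetween⁺ (inside  ∷ S) (inside  ∷ T) (inside  ∷ U) S⊆T T⊆U ≡.refl =
    ∈-map⁺ _ (∈-subsetsBetween⁺ S T U (drop-∷-⊆ S⊆T) (drop-∷-⊆ T⊆U) ≡.refl)
  ∈-subsetsBetween⁺ (s       ∷ S) (inside  ∷ T) (outside ∷ U) S⊆T T⊆U eq with () ← T⊆U here
  ∈-subsetsBetween⁺ (inside  ∷ S) (outside ∷ T) (u       ∷ U) S⊆T T⊆U eq with () ← S⊆T here
  ∈-subsetsBetween⁺ (outside ∷ S) (inside  ∷ T) (inside  ∷ U) S⊆T T⊆U ≡.refl =
    ∈-++⁺ʳ _ (∈-map⁺ _ (∈-subsetsBetween⁺ S T U (drop-∷-⊆ S⊆T) (drop-∷-⊆ T⊆U) ≡.refl))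
  ∈-subsetsBetween⁺ (outside ∷ S) (outside ∷ T) (inside  ∷ U) {zero} S⊆T T⊆U eq =
    ∈-map⁺ _ (∈-subsetsBetween⁺ S T U (drop-∷-⊆ S⊆T) (drop-∷-⊆ T⊆U) eq)
  ∈-subsetsBetween⁺ (outside ∷ S) (outside ∷ T) (inside  ∷ U) {suc k} S⊆T T⊆U eq =
    ∈-++⁺ˡ (∈-map⁺ _ (∈-subsetsBetween⁺ S T U (drop-∷-⊆ S⊆T) (drop-∷-⊆ T⊆U) eq))
  ∈-subsetsBetween⁺ (outside ∷ S) (outside ∷ T) (outside ∷ U) S⊆T T⊆U eq =
    ∈-map⁺ _ (∈-subsetsBetween⁺ S T U (drop-∷-⊆ S⊆T) (drop-∷-⊆ T⊆U) eq)

  length-subsetsBetween : ∀ {n} (S U : Subset n) t k → S ⊆ˢ U → ∣ S ∣ ℕ.+ t ≡ ∣ U ∣ →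
                          length (subsetsBetween S U k) ≡ intervals ∣ S ∣ t k
  length-subsetsBetween [] [] zero zero    S⊆U eq = ≡.refl
  length-subsetsBetween [] [] zero (suc k) S⊆U eq = ≡.refl
  length-subsetsBetween (inside  ∷ S) (inside  ∷ U) t zero    S⊆U eq = ≡.refl
  length-subsetsBetween (inside  ∷ S) (inside  ∷ U) t (suc k) S⊆U eq =
    ≡.trans (length-map _ (subsetsBetween S U k)) (length-subsetsBetween S U t k (drop-∷-⊆ S⊆U) (ℕₚ.suc-injective eq))
  length-subsetsBetween (inside  ∷ S) (outside ∷ U) t k       S⊆U eq with () ← S⊆U here
  length-subsetsBetween (outside ∷ S) (inside  ∷ U) zero    k S⊆U eq = ⊥-elim (ℕₚ.<-irrefl (≡.trans (≡.sym (ℕₚ.+-identityʳ _)) eq)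
    (ℕ.s≤s (p⊆q⇒∣p∣≤∣q∣ (drop-∷-⊆ S⊆U))))
  length-subsetsBetween (outside ∷ S) (inside  ∷ U) (suc t) zero S⊆U eq = ≡.trans (length-map _ (subsetsBetween S U zero))
    (≡.trans (length-subsetsBetween S U t zero (drop-∷-⊆ S⊆U) (ℕₚ.suc-injective (≡.trans (≡.sym (ℕₚ.+-suc _ t)) eq)))
             (≡.sym (intervals-zero ∣ S ∣ t)))
  length-subsetsBetween (outside ∷ S) (inside  ∷ U) (suc t) (suc k) S⊆U eq = ≡.trans
    (length-++ (List.map (outside ∷_) (subsetsBetween S U (suc k))))
    (≡.trans (≡.cong₂ ℕ._+_ (≡.trans (length-map _ (subsetsBetween S U (suc k))) (length-subsetsBetween S U t (suc k) S⊆U′ eq′))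
                            (≡.trans (length-map _ (subsetsBetween S U k)) (length-subsetsBetween S U t k S⊆U′ eq′)))
             (≡.sym (intervals-suc ∣ S ∣ t k)))
    where
    S⊆U′ : S ⊆ˢ U
    S⊆U′ = drop-∷-⊆ S⊆U
    eq′ = ℕₚ.suc-injective (≡.trans (≡.sym (ℕₚ.+-suc _ t)) eq)
  length-subsetsBetween (outside ∷ S) (outside ∷ U) t k S⊆U eq =
    ≡.trans (length-map _ (subsetsBetween S U k)) (length-subsetsBetween S U t k (drop-∷-⊆ S⊆U) eq)

module _ where
  open Vecs using ([]; _∷_)

  stars : ∀ {k} → CubeFace k → ℕ
  stars []            = 0
  stars (just _  ∷ a) = stars a
  stars (nothing ∷ a) = suc (stars a)

  stars≤ : ∀ {k} (a : CubeFace k) → stars a ℕ.≤ k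
  stars≤ []            = ℕ.z≤n
  stars≤ (just _  ∷ a) = ℕₚ.m≤n⇒m≤1+n (stars≤ a)
  stars≤ (nothing ∷ a) = ℕ.s≤s (stars≤ a)

  ⊑□-refl : ∀ {k} (a : CubeFace k) → a ⊑□ a
  ⊑□-refl []      = []
  ⊑□-refl (x ∷ a) = ⊑ᴵ-refl ∷ ⊑□-refl a

  facesAbove : ∀ {k} → CubeFace k → ℕ → List (CubeFace k)
  facesAbove []            zero    = [] ∷ []
  facesAbove []            (suc j) = []
  facesAbove (nothing ∷ a) zero    = []
  facesAbove (nothing ∷ a) (suc j) = List.map (nothing ∷_) (facesAbove a j)
  facesAbove (just b ∷ a)  zero    = List.map (just b ∷_) (facesAbove a zero)
  facesAbove (just b ∷ a)  (suc j) = List.map (just b ∷_) (facesAbove a (suc j)) ++ List.map (nothing ∷_) (facesAbove a j)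

  facesAbove-unique : ∀ {k} (a : CubeFace k) j → Unique (facesAbove a j)
  facesAbove-unique []            zero    = [] ∷ []
  facesAbove-unique []            (suc j) = []
  facesAbove-unique (nothing ∷ a) zero    = []
  facesAbove-unique (nothing ∷ a) (suc j) = map-∷-unique nothing (facesAbove-unique a j)
  facesAbove-unique (just b ∷ a)  zero    = map-∷-unique (just b) (facesAbove-unique a zero)
  facesAbove-unique (just b ∷ a)  (suc j) = Unique.++⁺ (map-∷-unique (just b) (facesAbove-unique a (suc j)))
    (map-∷-unique nothing (facesAbove-unique a j)) (map-∷-disjoint λ ())

  ∈-facesAbove⁻ : ∀ {k} (a : CubeFace k) j {c} → c ∈ facesAbove a j → a ⊑□ c × stars c ≡ j
  ∈-facesAbove⁻ [] zero (here ≡.refl) = [] , ≡.refl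
  ∈-facesAbove⁻ (nothing ∷ a) (suc j) c∈ with ∈-map⁻ _ c∈
  ... | c , c∈′ , ≡.refl = let a⊑c , eq = ∈-facesAbove⁻ a j c∈′ in ⊑ᴵ-refl ∷ a⊑c , ≡.cong suc eq
  ∈-facesAbove⁻ (just b ∷ a) zero c∈ with ∈-map⁻ _ c∈
  ... | c , c∈′ , ≡.refl = let a⊑c , eq = ∈-facesAbove⁻ a zero c∈′ in ⊑ᴵ-refl ∷ a⊑c , eq
  ∈-facesAbove⁻ (just b ∷ a) (suc j) c∈ with ∈-++⁻ (List.map (just b ∷_) (facesAbove a (suc j))) c∈
  ... | inj₁ c∈ˡ with ∈-map⁻ _ c∈ˡ
  ...   | c , c∈′ , ≡.refl = let a⊑c , eq = ∈-facesAbove⁻ a (suc j) c∈′ in ⊑ᴵ-refl ∷ a⊑c , eq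
  ∈-facesAbove⁻ (just b ∷ a) (suc j) c∈ | inj₂ c∈ʳ with ∈-map⁻ _ c∈ʳ
  ...   | c , c∈′ , ≡.refl = let a⊑c , eq = ∈-facesAbove⁻ a j c∈′ in ⊑ᴵ-free ∷ a⊑c , ≡.cong suc eq

  ∈-facesAbove⁺ : ∀ {k} {a c : CubeFace k} → a ⊑□ c → c ∈ facesAbove a (stars c)
  ∈-facesAbove⁺ [] = here ≡.refl
  ∈-facesAbove⁺ {a = nothing ∷ a} (⊑ᴵ-refl ∷ a⊑c) = ∈-map⁺ _ (∈-facesAbove⁺ a⊑c)
  ∈-facesAbove⁺ {a = nothing ∷ a} (⊑ᴵ-free ∷ a⊑c) = ∈-map⁺ _ (∈-facesAbove⁺ a⊑c)
  ∈-facesAbove⁺ {a = just b ∷ a} {just b ∷ c} (⊑ᴵ-refl ∷ a⊑c) with stars c | ∈-facesAbove⁺ a⊑c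
  ... | zero  | c∈ = ∈-map⁺ _ c∈
  ... | suc _ | c∈ = ∈-++⁺ˡ (∈-map⁺ _ c∈)
  ∈-facesAbove⁺ {a = just b ∷ a} (⊑ᴵ-free ∷ a⊑c) = ∈-++⁺ʳ _ (∈-map⁺ _ (∈-facesAbove⁺ a⊑c))

  length-facesAbove : ∀ {k} (a : CubeFace k) t j → stars a ℕ.+ t ≡ k → length (facesAbove a j) ≡ intervals (stars a) t j
  length-facesAbove []            zero    zero    eq = ≡.refl
  length-facesAbove []            zero    (suc j) eq = ≡.refl
  length-facesAbove (nothing ∷ a) t       zero    eq = ≡.refl
  length-facesAbove (nothing ∷ a) t       (suc j) eq =
    ≡.trans (length-map _ (facesAbove a j)) (length-facesAbove a t j (ℕₚ.suc-injective eq))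
  length-facesAbove (just b ∷ a)  zero    j       eq =
    ⊥-elim (ℕₚ.<-irrefl (≡.trans (≡.sym (ℕₚ.+-identityʳ _)) eq) (ℕ.s≤s (stars≤ a)))
  length-facesAbove (just b ∷ a)  (suc t) zero    eq = ≡.trans (length-map _ (facesAbove a zero))
    (≡.trans (length-facesAbove a t zero (ℕₚ.suc-injective (≡.trans (≡.sym (ℕₚ.+-suc _ t)) eq)))
             (≡.sym (intervals-zero (stars a) t)))
  length-facesAbove (just b ∷ a)  (suc t) (suc j) eq = ≡.trans
    (length-++ (List.map (just b ∷_) (facesAbove a (suc j))))
    (≡.trans (≡.cong₂ ℕ._+_ (≡.trans (length-map _ (facesAbove a (suc j))) (length-facesAbove a t (suc j) eq′))
                            (≡.trans (length-map _ (facesAbove a j)) (length-facesAbove a t j eq′)))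
             (≡.sym (intervals-suc (stars a) t j)))
    where eq′ = ℕₚ.suc-injective (≡.trans (≡.sym (ℕₚ.+-suc _ t)) eq)

  cubeFaces : ∀ k → ℕ → List (CubeFace k)
  cubeFaces zero    zero    = [] ∷ []
  cubeFaces zero    (suc j) = []
  cubeFaces (suc k) zero    = List.map (just false ∷_) (cubeFaces k zero) ++ List.map (just true ∷_) (cubeFaces k zero)
  cubeFaces (suc k) (suc j) = List.map (nothing ∷_) (cubeFaces k j) ++
    (List.map (just false ∷_) (cubeFaces k (suc j)) ++ List.map (just true ∷_) (cubeFaces k (suc j)))

  cubeFaces-unique : ∀ k j → Unique (cubeFaces k j)
  cubeFaces-unique zero    zero    = [] ∷ []
  cubeFaces-unique zero    (suc j) = []
  cubeFaces-unique (suc k) zero    = Unique.++⁺ (map-∷-unique _ (cubeFaces-unique k zero))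
    (map-∷-unique _ (cubeFaces-unique k zero)) (map-∷-disjoint λ ())
  cubeFaces-unique (suc k) (suc j) = Unique.++⁺ (map-∷-unique _ (cubeFaces-unique k j))
    (Unique.++⁺ (map-∷-unique _ (cubeFaces-unique k (suc j)))
                (map-∷-unique _ (cubeFaces-unique k (suc j))) (map-∷-disjoint λ ()))
    λ (c∈ , c∈′) → [ (λ h → map-∷-disjoint (λ ()) (c∈ , h)) , (λ h → map-∷-disjoint (λ ()) (c∈ , h)) ]′
                     (∈-++⁻ (List.map (just false ∷_) (cubeFaces k (suc j))) c∈′)

  ∈-cubeFaces⁻ : ∀ k j {c} → c ∈ cubeFaces k j → stars c ≡ j
  ∈-cubeFaces⁻ zero zero (here ≡.refl) = ≡.refl
  ∈-cubeFaces⁻ (suc k) zero c∈ with ∈-++⁻ (List.map (just false ∷_) (cubeFaces k zero)) c∈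
  ... | inj₁ c∈ˡ with ∈-map⁻ _ c∈ˡ
  ...   | c , c∈′ , ≡.refl = ∈-cubeFaces⁻ k zero c∈′
  ∈-cubeFaces⁻ (suc k) zero c∈ | inj₂ c∈ʳ with ∈-map⁻ _ c∈ʳ
  ...   | c , c∈′ , ≡.refl = ∈-cubeFaces⁻ k zero c∈′
  ∈-cubeFaces⁻ (suc k) (suc j) c∈ with ∈-++⁻ (List.map (nothing ∷_) (cubeFaces k j)) c∈
  ... | inj₁ c∈ˡ with ∈-map⁻ _ c∈ˡ
  ...   | c , c∈′ , ≡.refl = ≡.cong suc (∈-cubeFaces⁻ k j c∈′)
  ∈-cubeFaces⁻ (suc k) (suc j) c∈ | inj₂ c∈ʳ with ∈-++⁻ (List.map (just false ∷_) (cubeFaces k (suc j))) c∈ʳ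
  ...   | inj₁ c∈ˡ with ∈-map⁻ _ c∈ˡ
  ...     | c , c∈′ , ≡.refl = ∈-cubeFaces⁻ k (suc j) c∈′
  ∈-cubeFaces⁻ (suc k) (suc j) c∈ | inj₂ c∈ʳ | inj₂ c∈ʳʳ with ∈-map⁻ _ c∈ʳʳ
  ...     | c , c∈′ , ≡.refl = ∈-cubeFaces⁻ k (suc j) c∈′

  ∈-cubeFaces⁺ : ∀ {k} (c : CubeFace k) → c ∈ cubeFaces k (stars c)
  ∈-cubeFaces⁺ [] = here ≡.refl
  ∈-cubeFaces⁺ (nothing ∷ c) = ∈-++⁺ˡ (∈-map⁺ _ (∈-cubeFaces⁺ c))
  ∈-cubeFaces⁺ (just false ∷ c) with stars c | ∈-cubeFaces⁺ c
  ... | zero  | c∈ = ∈-++⁺ˡ (∈-map⁺ _ c∈)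
  ... | suc j | c∈ = ∈-++⁺ʳ (List.map (nothing ∷_) (cubeFaces _ j)) (∈-++⁺ˡ (∈-map⁺ _ c∈))
  ∈-cubeFaces⁺ (just true ∷ c) with stars c | ∈-cubeFaces⁺ c
  ... | zero  | c∈ = ∈-++⁺ʳ _ (∈-map⁺ _ c∈)
  ... | suc j | c∈ = ∈-++⁺ʳ (List.map (nothing ∷_) (cubeFaces _ j)) (∈-++⁺ʳ (List.map (just false ∷_) (cubeFaces _ (suc j))) (∈-map⁺ _ c∈))

  free : ∀ k → CubeFace k
  free zero    = []
  free (suc k) = nothing ∷ free k

  ⊑□-free : ∀ {k} (a : CubeFace k) → a ⊑□ free k
  ⊑□-free []      = []
  ⊑□-free (x ∷ a) = ⊑ᴵ-free ∷ ⊑□-free a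

  stars-free : ∀ k → stars (free k) ≡ k
  stars-free zero    = ≡.refl
  stars-free (suc k) = ≡.cong suc (stars-free k)

  data Frees : ∀ {k} → CubeFace k → CubeFace k → Set where
    here  : ∀ {k v} {a : CubeFace k} → Frees (just v ∷ a) (nothing ∷ a)
    there : ∀ {k x} {a b : CubeFace k} → Frees a b → Frees (x ∷ a) (x ∷ b)

  frees-⊑ : ∀ {k} {a b : CubeFace k} → Frees a b → a ⊑□ b
  frees-⊑ here      = ⊑ᴵ-free ∷ ⊑□-refl _
  frees-⊑ (there f) = ⊑ᴵ-refl ∷ frees-⊑ f

  frees-≢ : ∀ {k} {a b : CubeFace k} → Frees a b → a ≢ b
  frees-≢ (there f) ≡.refl = frees-≢ f ≡.refl

  frees-stars : ∀ {k} {a b : CubeFace k} → Frees a b → stars b ≡ suc (stars a)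
  frees-stars here = ≡.refl
  frees-stars (there {x = just _}  f) = frees-stars f
  frees-stars (there {x = nothing} f) = ≡.cong suc (frees-stars f)

  ⊑ᴵ-antisym : ∀ {x y} → x ⊑ᴵ y → y ⊑ᴵ x → x ≡ y
  ⊑ᴵ-antisym ⊑ᴵ-refl _        = ≡.refl
  ⊑ᴵ-antisym ⊑ᴵ-free ⊑ᴵ-refl = ≡.refl
  ⊑ᴵ-antisym ⊑ᴵ-free ⊑ᴵ-free = ≡.refl

  ⊑□-antisym : ∀ {k} {a b : CubeFace k} → a ⊑□ b → b ⊑□ a → a ≡ b
  ⊑□-antisym []       []       = ≡.refl
  ⊑□-antisym (p ∷ ps) (q ∷ qs) = ≡.cong₂ _∷_ (⊑ᴵ-antisym p q) (⊑□-antisym ps qs)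

  frees-cover : ∀ {k} {a b c : CubeFace k} → Frees a b → a ⊑□ c → c ⊑□ b → c ≡ a ⊎ c ≡ b
  frees-cover here (⊑ᴵ-refl ∷ ps) (_ ∷ qs) = inj₁ (≡.cong (_ ∷_) (⊑□-antisym qs ps))
  frees-cover here (⊑ᴵ-free ∷ ps) (_ ∷ qs) = inj₂ (≡.cong (_ ∷_) (⊑□-antisym qs ps))
  frees-cover (there f) (p ∷ ps) (q ∷ qs) with ⊑ᴵ-antisym q p | frees-cover f ps qs
  ... | ≡.refl | inj₁ ≡.refl = inj₁ ≡.refl
  ... | ≡.refl | inj₂ ≡.refl = inj₂ ≡.refl

  free-or-frees : ∀ {k} (a : CubeFace k) → a ≡ free k ⊎ ∃ λ b → Frees a b
  free-or-frees []            = inj₁ ≡.refl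
  free-or-frees (just v ∷ a)  = inj₂ (nothing ∷ a , here)
  free-or-frees (nothing ∷ a) with free-or-frees a
  ... | inj₁ ≡.refl  = inj₁ ≡.refl
  ... | inj₂ (b , f) = inj₂ (nothing ∷ b , there f)

module Cells (em : ∀ {ℓ} → ExcludedMiddle ℓ) (ℝ : CompleteOrderedField) where
  open Classical em ℝ hiding (module ℝ)
  open FaceCounts em ℝ
  open Weights em ℝ using (Comparable)
  open Cosystolic em ℝ using (FaceBounds)
  open OrderedField ℝ using (≤-reflexive; ≈-reflexive; ≈-sym)

  ∣[n-1]+1∣≡n : ∀ n → ℤ.∣ pos n ℤ.- 1ℤ ℤ.+ 1ℤ ∣ ≡ n
  ∣[n-1]+1∣≡n n = ≡.cong ℤ.∣_∣ (cancel (pos n))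
    where
    cancel : ∀ i → i ℤ.- 1ℤ ℤ.+ 1ℤ ≡ i
    cancel = ℤSolver.solve-∀

  module _ {d : ℕ} {X : GradedPoset} (isDPoset : IsDPoset d X) where
    open GradedPoset X renaming (≤-refl to ≼-refl; ≤-trans to ≼-trans)
    open IsDPoset isDPoset
    open Grading em X
    open DPosetDimensions isDPoset

    simplexCount : ℤ → ℤ → ℤ → ℕ
    simplexCount i j k = intervals ℤ.∣ i ℤ.+ 1ℤ ∣ (ℤ.∣ k ℤ.+ 1ℤ ∣ ℕ.∸ ℤ.∣ i ℤ.+ 1ℤ ∣) ℤ.∣ j ℤ.+ 1ℤ ∣

    simplicial-formula : IsSimplicialComplex X → ∀ {x z} j → x ≤ z → dim x ℤ.≤ j → j ℤ.≤ dim z →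
                         # X (λ y → Faces j y × x ≤ y × y ≤ z) ≡ simplexCount (dim x) j (dim z)
    simplicial-formula (n , φ , φ-≤ , φ-onto , φ-dim) {x} {z} j x≤z dx≤j j≤dz = begin
      # X (λ y → Faces j y × x ≤ y × y ≤ z)
        ≡⟨ #≡length-to X (subsetsBetween-unique (φ x) (φ z) k) φ φ-injective
             (λ {y} (dy , x≤y , y≤z) → ∈-subsetsBetween⁺ (φ x) (φ y) (φ z) (to x≤y) (to y≤z) (card dy))
             (λ T∈ → let S⊆T , T⊆U , ∣T∣≡k = ∈-subsetsBetween⁻ (φ x) (φ z) k T∈
                         y , φy≡T = φ-onto z _ T⊆U
                     in y , (≡.trans (φ-dim y) (≡.trans (≡.cong (λ T → pos Subset.∣ T ∣ ℤ.- 1ℤ) φy≡T)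
                                (≡.trans (≡.cong (λ n → pos n ℤ.- 1ℤ) ∣T∣≡k) ([i+1]-1≡i (ℤₚ.≤-trans (-1≤dim x) dx≤j)))) ,
                             from (≡.subst (φ x Subset.⊆_) (≡.sym φy≡T) S⊆T) ,
                             from (≡.subst (Subset._⊆ φ z) (≡.sym φy≡T) T⊆U)) , φy≡T) ⟩
      length (subsetsBetween (φ x) (φ z) k)
        ≡⟨ length-subsetsBetween (φ x) (φ z) _ k (to x≤z) (ℕₚ.m+[n∸m]≡n (p⊆q⇒∣p∣≤∣q∣ (to x≤z))) ⟩
      intervals Subset.∣ φ x ∣ (Subset.∣ φ z ∣ ℕ.∸ Subset.∣ φ x ∣) k
        ≡⟨ ≡.cong₂ (λ s u → intervals s (u ℕ.∸ s) k) (card′ x) (card′ z) ⟨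
      simplexCount (dim x) j (dim z) ∎
      where
      open ≡.≡-Reasoning
      k = ℤ.∣ j ℤ.+ 1ℤ ∣
      to : ∀ {a b} → a ≤ b → φ a Subset.⊆ φ b
      to {a} {b} = Equivalence.to (φ-≤ a b)
      from : ∀ {a b} → φ a Subset.⊆ φ b → a ≤ b
      from {a} {b} = Equivalence.from (φ-≤ a b)
      φ-injective : ∀ {a b} → φ a ≡ φ b → a ≡ b
      φ-injective eq = ≤-antisym (from (λ {i} → ≡.subst (i Subset.∈_) eq)) (from (λ {i} → ≡.subst (i Subset.∈_) (≡.sym eq)))
      card′ : ∀ y → ℤ.∣ dim y ℤ.+ 1ℤ ∣ ≡ Subset.∣ φ y ∣
      card′ y = ≡.trans (≡.cong (λ i → ℤ.∣ i ℤ.+ 1ℤ ∣) (φ-dim y)) (∣[n-1]+1∣≡n Subset.∣ φ y ∣)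
      card : ∀ {y} → dim y ≡ j → Subset.∣ φ y ∣ ≡ k
      card {y} dy = ≡.trans (≡.sym (card′ y)) (≡.cong (λ i → ℤ.∣ i ℤ.+ 1ℤ ∣) dy)

    module CubeCell {z k} (dz : dim z ≡ pos k) (cell : CellIso X z (_⊑□_ {k})) where
      private
        φ = proj₁ cell

        φ-≤ : ∀ {a b} → a ⊑□ b → φ a ≤ φ b
        φ-≤ {a} {b} = Equivalence.to (proj₁ (proj₂ cell) a b)

        φ-⊑ : ∀ {a b} → φ a ≤ φ b → a ⊑□ b
        φ-⊑ {a} {b} = Equivalence.from (proj₁ (proj₂ cell) a b)

        φ-onto : ∀ {y} → 0ℤ ℤ.≤ dim y → y ≤ z → ∃ λ a → φ a ≡ y
        φ-onto {y} 0≤dy y≤z = Equivalence.to (proj₂ (proj₂ cell) y) (0≤dy , y≤z)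

        φ-face : ∀ a → 0ℤ ℤ.≤ dim (φ a) × φ a ≤ z
        φ-face a = Equivalence.from (proj₂ (proj₂ cell) (φ a)) (a , ≡.refl)

        φ-injective : ∀ {a b} → φ a ≡ φ b → a ≡ b
        φ-injective {a} {b} eq = ⊑□-antisym (φ-⊑ (≡.subst (φ a ≤_) eq ≼-refl)) (φ-⊑ (≡.subst (_≤ φ a) eq ≼-refl))

        φ-free : φ (free k) ≡ z
        φ-free = let a , φa≡z = φ-onto (≡.subst (0ℤ ℤ.≤_) (≡.sym dz) (ℤ.+≤+ ℕ.z≤n)) ≼-refl in
          ≤-antisym (proj₂ (φ-face (free k))) (≡.subst (_≤ φ (free k)) φa≡z (φ-≤ (⊑□-free a)))

        φ-frees : ∀ {a b} → Frees a b → φ a ⋖ φ b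
        φ-frees {a} {b} f = (φ-≤ (frees-⊑ f) , frees-≢ f ∘ φ-injective) , none
          where
          none : ¬ ∃ λ t → φ a < t × t < φ b
          none (t , (a≤t , a≢t) , (t≤b , t≢b))
            with φ-onto {t} (ℤₚ.≤-trans (proj₁ (φ-face a)) (dim-mono a≤t)) (≼-trans t≤b (proj₂ (φ-face b)))
          ... | c , ≡.refl with frees-cover f (φ-⊑ a≤t) (φ-⊑ t≤b)
          ...   | inj₁ ≡.refl = a≢t ≡.refl
          ...   | inj₂ ≡.refl = t≢b ≡.refl

        dim-φ : ∀ a → dim (φ a) ≡ pos (stars a)
        dim-φ a = go (k ℕ.∸ stars a) a (ℕₚ.m+[n∸m]≡n (stars≤ a))
          where
          go : ∀ n a → stars a ℕ.+ n ≡ k → dim (φ a) ≡ pos (stars a)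
          go n a eq with free-or-frees a
          ... | inj₁ ≡.refl = ≡.trans (≡.cong dim φ-free) (≡.trans dz (≡.cong pos (≡.sym (stars-free k))))
          go zero a eq | inj₂ (b , f) = ⊥-elim (ℕₚ.<-irrefl (≡.trans (≡.sym (ℕₚ.+-identityʳ _)) eq)
            (≡.subst (ℕ._≤ k) (frees-stars f) (stars≤ b)))
          go (suc n) a eq | inj₂ (b , f) = ≡.trans (≡.sym (ℤₚ.pred-suc (dim (φ a)))) (≡.cong ℤ.pred
            (≡.trans (≡.sym (dim-⋖ (φ-frees f))) (≡.trans
              (go n b (≡.trans (≡.cong (ℕ._+ n) (frees-stars f)) (≡.trans (≡.sym (ℕₚ.+-suc (stars a) n)) eq)))
              (≡.cong pos (frees-stars f)))))

      cube-faces : ∀ {p} {P : Pred Carrier p} j → (∀ {y} → P y → dim y ≡ pos j × y ≤ z) →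
                   (∀ {y} → dim y ≡ pos j → y ≤ z → P y) → # X P ≡ length (cubeFaces k j)
      cube-faces j P⇒ ⇒P = #≡length-from X (cubeFaces-unique k j) φ φ-injective
        (λ {a} a∈ → ⇒P (≡.trans (dim-φ a) (≡.cong pos (∈-cubeFaces⁻ k j a∈))) (proj₂ (φ-face a)))
        λ {y} Py → let dy , y≤z = P⇒ Py
                       a , φa≡y = φ-onto (≡.subst (0ℤ ℤ.≤_) (≡.sym dy) (ℤ.+≤+ ℕ.z≤n)) y≤z
                       j≡ = ℤₚ.+-injective (≡.trans (≡.sym (dim-φ a)) (≡.trans (≡.cong dim φa≡y) dy))
                   in a , ≡.subst (λ j → a ∈ cubeFaces k j) j≡ (∈-cubeFaces⁺ a) , φa≡y

      cube-faces-above : ∀ {x i} j → dim x ≡ pos i → x ≤ z →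
                         # X (λ y → Faces (pos j) y × x ≤ y × y ≤ z) ≡ intervals i (k ℕ.∸ i) j
      cube-faces-above {x} {i} j dx x≤z with φ-onto (≡.subst (0ℤ ℤ.≤_) (≡.sym dx) (ℤ.+≤+ ℕ.z≤n)) x≤z
      ... | a , ≡.refl = ≡.trans
        (#≡length-from X (facesAbove-unique a j) φ φ-injective
          (λ {c} c∈ → let a⊑c , eq = ∈-facesAbove⁻ a j c∈
                      in ≡.trans (dim-φ c) (≡.cong pos eq) , φ-≤ a⊑c , proj₂ (φ-face c))
          λ {y} (dy , a≤y , y≤z) →
            let c , φc≡y = φ-onto (≡.subst (0ℤ ℤ.≤_) (≡.sym dy) (ℤ.+≤+ ℕ.z≤n)) y≤z
                j≡ = ℤₚ.+-injective (≡.trans (≡.sym (dim-φ c)) (≡.trans (≡.cong dim φc≡y) dy))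
            in c , ≡.subst (λ j → c ∈ facesAbove a j) j≡ (∈-facesAbove⁺ (φ-⊑ (≡.subst (φ a ≤_) (≡.sym φc≡y) a≤y))) , φc≡y)
        (≡.trans (length-facesAbove a _ j (ℕₚ.m+[n∸m]≡n (stars≤ a)))
          (≡.cong (λ s → intervals s (k ℕ.∸ s) j) (ℤₚ.+-injective (≡.trans (≡.sym (dim-φ a)) dx))))

    cubeCount : ℤ → ℤ → ℤ → ℕ
    cubeCount ℤ.-[1+ _ ] ℤ.-[1+ _ ] _       = 1
    cubeCount ℤ.-[1+ _ ] (pos j)    (pos k) = length (cubeFaces k j)
    cubeCount (pos i)    (pos j)    (pos k) = intervals i (k ℕ.∸ i) j
    cubeCount _          _          _       = 0

    cube-formula : IsCubeComplex X → ∀ {x z} j → x ≤ z → dim x ℤ.≤ j → j ℤ.≤ dim z →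
                   # X (λ y → Faces j y × x ≤ y × y ≤ z) ≡ cubeCount (dim x) j (dim z)
    cube-formula cube {x} {z} j x≤z dx≤j j≤dz = go (dim x) j (dim z) ≡.refl ≡.refl dx≤j j≤dz
      where
      ≡∅ : ∀ {y n} → dim y ≡ ℤ.-[1+ n ] → y ≡ ∅
      ≡∅ {y} dy = ≡.sym (≤∧dim≡⇒≡ (∅-min y) (≡.trans dim-∅ (ℤₚ.≤-antisym (-1≤dim y) (≡.subst (ℤ._≤ -1ℤ) (≡.sym dy) (ℤ.-≤- ℕ.z≤n)))))

      go : ∀ i j k → dim x ≡ i → dim z ≡ k → i ℤ.≤ j → j ℤ.≤ k →
           # X (λ y → Faces j y × x ≤ y × y ≤ z) ≡ cubeCount i j k
      go ℤ.-[1+ a ] ℤ.-[1+ b ] k dx dz i≤j j≤k = #≡length-from X {xs = tt ∷ []} ([] ∷ []) (λ _ → ∅) (λ _ → ≡.refl)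
        (λ _ → ≡.trans dim-∅ (ℤₚ.≤-antisym (ℤₚ.≤-trans (-1≤dim x) (≡.subst (ℤ._≤ ℤ.-[1+ b ]) (≡.sym dx) i≤j)) (ℤ.-≤- ℕ.z≤n)) ,
               ≡.subst (_≤ ∅) (≡.sym (≡∅ dx)) ≼-refl , ∅-min z)
        λ (dy , _) → tt , here ≡.refl , ≡.sym (≡∅ dy)
      go ℤ.-[1+ a ] (pos j) (pos k) dx dz i≤j j≤k = CubeCell.cube-faces dz (cube z k dz) j
        (λ (dy , _ , y≤z) → dy , y≤z) (λ {y} dy y≤z → dy , ≡.subst (_≤ y) (≡.sym (≡∅ dx)) (∅-min y) , y≤z)
      go (pos i) (pos j) (pos k) dx dz i≤j j≤k = CubeCell.cube-faces-above dz (cube z k dz) j dx x≤z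
      go (pos i) ℤ.-[1+ b ] k dx dz () j≤k
      go i (pos j) ℤ.-[1+ c ] dx dz i≤j ()

    module PolygonCell {z m} (dz : dim z ≡ pos 2) (cell : CellIso X z (_⊑ᴾ_ {m})) where
      private
        φ = proj₁ cell

        φ-≤ : ∀ {a b} → a ⊑ᴾ b → φ a ≤ φ b
        φ-≤ {a} {b} = Equivalence.to (proj₁ (proj₂ cell) a b)

        φ-⊑ : ∀ {a b} → φ a ≤ φ b → a ⊑ᴾ b
        φ-⊑ {a} {b} = Equivalence.from (proj₁ (proj₂ cell) a b)

        φ-onto : ∀ {y} → 0ℤ ℤ.≤ dim y → y ≤ z → ∃ λ a → φ a ≡ y
        φ-onto {y} 0≤dy y≤z = Equivalence.to (proj₂ (proj₂ cell) y) (0≤dy , y≤z)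

        φ-face : ∀ a → 0ℤ ℤ.≤ dim (φ a) × φ a ≤ z
        φ-face a = Equivalence.from (proj₂ (proj₂ cell) (φ a)) (a , ≡.refl)

        φ-⋖ : ∀ {a b} → a ⊑ᴾ b → ¬ b ⊑ᴾ a → (∀ {c} → a ⊑ᴾ c → c ⊑ᴾ b → c ≡ a ⊎ c ≡ b) → φ a ⋖ φ b
        φ-⋖ {a} {b} a⊑b b⋢a covers =
          (φ-≤ a⊑b , λ eq → b⋢a (φ-⊑ (≡.subst (φ b ≤_) (≡.sym eq) ≼-refl))) , none
          where
          none : ¬ ∃ λ t → φ a < t × t < φ b
          none (t , (a≤t , a≢t) , (t≤b , t≢b))
            with φ-onto {t} (ℤₚ.≤-trans (proj₁ (φ-face a)) (dim-mono a≤t)) (≼-trans t≤b (proj₂ (φ-face b)))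
          ... | c , ≡.refl with covers (φ-⊑ a≤t) (φ-⊑ t≤b)
          ...   | inj₁ ≡.refl = a≢t ≡.refl
          ...   | inj₂ ≡.refl = t≢b ≡.refl

        pred-dim : ∀ {a b n} → φ a ⋖ φ b → dim (φ b) ≡ pos (suc n) → dim (φ a) ≡ pos n
        pred-dim a⋖b db = ≡.trans (≡.sym (ℤₚ.pred-suc _)) (≡.cong ℤ.pred (≡.trans (≡.sym (dim-⋖ a⋖b)) db))

        dim-interior : dim (φ interior) ≡ pos 2
        dim-interior = let a , φa≡z = φ-onto (≡.subst (0ℤ ℤ.≤_) (≡.sym dz) (ℤ.+≤+ ℕ.z≤n)) ≼-refl in
          ≡.trans (≡.cong dim (≤-antisym (proj₂ (φ-face interior)) (≡.subst (_≤ φ interior) φa≡z (φ-≤ ⊑ᴾ-interior)))) dz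

        dim-edge : ∀ i → dim (φ (edge i)) ≡ 1ℤ
        dim-edge i = pred-dim (φ-⋖ ⊑ᴾ-interior (λ ()) λ { ⊑ᴾ-refl _ → inj₁ ≡.refl ; ⊑ᴾ-interior _ → inj₂ ≡.refl }) dim-interior

        dim-vertex : ∀ i → dim (φ (vertex i)) ≡ 0ℤ
        dim-vertex i = pred-dim (φ-⋖ (⊑ᴾ-source {i = i}) (λ ()) covers) (dim-edge i)
          where
          covers : ∀ {c} → vertex i ⊑ᴾ c → c ⊑ᴾ edge i → c ≡ vertex i ⊎ c ≡ edge i
          covers ⊑ᴾ-refl            _        = inj₁ ≡.refl
          covers ⊑ᴾ-source          ⊑ᴾ-refl = inj₂ ≡.refl
          covers (⊑ᴾ-target _)      ⊑ᴾ-refl = inj₂ ≡.refl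
          covers (⊑ᴾ-wrap _ _)      ⊑ᴾ-refl = inj₂ ≡.refl

        φ-injective : ∀ {a b} → φ a ≡ φ b → a ⊑ᴾ b
        φ-injective {a} eq = φ-⊑ (≡.subst (φ a ≤_) eq ≼-refl)

      polygon-vertices : # X (FacesOf z 0ℤ) ≡ m
      polygon-vertices = ≡.trans (#≡length-from X (Unique.allFin⁺ m) (φ ∘ vertex)
        (λ eq → case-refl (φ-injective eq)) (λ {i} _ → dim-vertex i , proj₂ (φ-face _)) onto) (length-tabulate id)
        where
        case-refl : ∀ {i j} → vertex i ⊑ᴾ vertex j → i ≡ j
        case-refl ⊑ᴾ-refl = ≡.refl
        onto : ∀ {y} → FacesOf z 0ℤ y → ∃ λ i → i ∈ List.allFin m × φ (vertex i) ≡ y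
        onto (dy , y≤z) with φ-onto (≡.subst (0ℤ ℤ.≤_) (≡.sym dy) ℤₚ.≤-refl) y≤z
        ... | vertex i , eq = i , ∈-allFin i , eq
        ... | edge i   , ≡.refl with () ← ≡.trans (≡.sym dy) (dim-edge i)
        ... | interior , ≡.refl with () ← ≡.trans (≡.sym dy) dim-interior

      polygon-edges : # X (FacesOf z 1ℤ) ≡ m
      polygon-edges = ≡.trans (#≡length-from X (Unique.allFin⁺ m) (φ ∘ edge)
        (λ eq → case-refl (φ-injective eq)) (λ {i} _ → dim-edge i , proj₂ (φ-face _)) onto) (length-tabulate id)
        where
        case-refl : ∀ {i j} → edge i ⊑ᴾ edge j → i ≡ j
        case-refl ⊑ᴾ-refl = ≡.refl
        onto : ∀ {y} → FacesOf z 1ℤ y → ∃ λ i → i ∈ List.allFin m × φ (edge i) ≡ y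
        onto (dy , y≤z) with φ-onto (≡.subst (0ℤ ℤ.≤_) (≡.sym dy) (ℤ.+≤+ ℕ.z≤n)) y≤z
        ... | edge i   , eq = i , ∈-allFin i , eq
        ... | vertex i , ≡.refl with () ← ≡.trans (≡.sym dy) (dim-vertex i)
        ... | interior , ≡.refl with () ← ≡.trans (≡.sym dy) dim-interior

    polygon-faceBounds : ∀ {m} → Is-gonComplex₂ m X → FaceBounds X (fromℕ 2) (fromℕ 2) (fromℕ m)
    polygon-faceBounds {m} (_ , edges , polygons) = record
      { n₋≤ = λ de → ≤-reflexive (≈-sym (≈-reflexive (≡.cong fromℕ (ends de))))
      ; ≤n₊ = λ de → ≤-reflexive (≈-reflexive (≡.cong fromℕ (ends de)))
      ; ≤V  = λ { {z} dz (inj₁ ≡.refl) → ≤-reflexive (≈-reflexive (≡.cong fromℕ (PolygonCell.polygon-vertices dz (polygons z dz))))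
                ; {z} dz (inj₂ ≡.refl) → ≤-reflexive (≈-reflexive (≡.cong fromℕ (PolygonCell.polygon-edges dz (polygons z dz)))) }
      }
      where
      ends : ∀ {e} → dim e ≡ 1ℤ → # X (FacesOf e 0ℤ) ≡ 2
      ends {e} de = CubeCell.cube-faces de (edges e de) 0 id _,_

module ExplicitConstants (em : ∀ {ℓ} → ExcludedMiddle ℓ) (ℝ : CompleteOrderedField) where
  open Classical em ℝ hiding (module ℝ)
  private module ℝ = CompleteOrderedField ℝ
  open OrderedField ℝ hiding (total)
  open Weights em ℝ
  open Cosystolic em ℝ
  open FaceCounts em ℝ
  open Cells em ℝ
  open SemiringExp ℝ.semiring using (^-homo-*)

  1≤^ : ∀ {x} → 1# ≤ᴿ x → ∀ n → 1# ≤ᴿ x ^ n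
  1≤^ 1≤x zero    = ≤-refl
  1≤^ 1≤x (suc n) = ≤-trans 1≤x (x≤x*y (≤-trans 0≤1 1≤x) (1≤^ 1≤x n))

  ⁻^-pos : ∀ {x} → 1# ≤ᴿ x → ∀ n → 0# <ᴿ x ⁻^ n
  ⁻^-pos 1≤x n = ⁻¹-pos (1≤⇒0< (1≤^ 1≤x n))

  ⁻^*^-≤ : ∀ {x} → 1# ≤ᴿ x → ∀ {m n} k → n ℕ.+ k ℕ.≤ m → x ⁻^ m * x ^ n ≤ᴿ x ⁻^ k
  ⁻^*^-≤ {x} 1≤x {m} {n} k n+k≤m = ≤-resp ≈-refl (ℝ.*-identityˡ _)
    (x*y≤z⇒x≤z*y⁻¹ (1≤⇒0< (1≤^ 1≤x k)) (begin
      x ⁻^ m * x ^ n * x ^ k      ≈⟨ ≈-trans (ℝ.*-assoc _ _ _) (ℝ.*-congˡ (≈-sym (^-homo-* x n k))) ⟩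
      x ⁻^ m * x ^ (n ℕ.+ k)      ≤⟨ x≤x*y (ℝ.*-nonNeg (<⇒≤ (⁻^-pos 1≤x m)) (≤-trans 0≤1 (1≤^ 1≤x (n ℕ.+ k)))) (1≤^ 1≤x r) ⟩
      x ⁻^ m * x ^ (n ℕ.+ k) * x ^ r ≈⟨ ≈-trans (ℝ.*-assoc _ _ _) (ℝ.*-congˡ (≈-sym (^-homo-* x (n ℕ.+ k) r))) ⟩
      x ⁻^ m * x ^ (n ℕ.+ k ℕ.+ r) ≡⟨ ≡.cong (λ j → x ⁻^ m * x ^ j) (ℕₚ.m+[n∸m]≡n n+k≤m) ⟩
      x ⁻^ m * x ^ m              ≈⟨ *-inverseˡ (1≤⇒0< (1≤^ 1≤x m)) ⟩
      1#                          ∎))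
    where r = m ℕ.∸ (n ℕ.+ k)

  1⁻¹≈1 : 1# ⁻¹ ≈ 1#
  1⁻¹≈1 = ≈-trans (≈-sym (ℝ.*-identityˡ _)) (*-inverseʳ⁺ 0<1)

  ⁻^-zero : ∀ x → x ⁻^ 0 ≈ 1#
  ⁻^-zero x = 1⁻¹≈1

  ⁻^*^-≤1 : ∀ {x} → 1# ≤ᴿ x → ∀ {m n} → n ℕ.≤ m → x ⁻^ m * x ^ n ≤ᴿ 1#
  ⁻^*^-≤1 {x} 1≤x {m} {n} n≤m = ≤-resp ≈-refl (⁻^-zero x) (⁻^*^-≤ 1≤x {m} {n} 0 (≡.subst (ℕ._≤ m) (≡.sym (ℕₚ.+-identityʳ n)) n≤m))

  ⁻^≤1 : ∀ {x} → 1# ≤ᴿ x → ∀ m → x ⁻^ m ≤ᴿ 1#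
  ⁻^≤1 1≤x m = ≤-resp (ℝ.*-identityʳ _) ≈-refl (⁻^*^-≤1 1≤x {m} {0} ℕ.z≤n)

  1^≈1 : ∀ n → 1# ^ n ≈ 1#
  1^≈1 zero    = ≈-refl
  1^≈1 (suc n) = ≈-trans (ℝ.*-identityˡ _) (1^≈1 n)

  1⁻^≈1 : ∀ n → 1# ⁻^ n ≈ 1#
  1⁻^≈1 n = ≈-trans (ℝ.⁻¹-cong (1^≈1 n)) 1⁻¹≈1

  -- The constants with the powers of L removed.
  record Base (n₋ n₊ V e′ e″ δ δ′ δ″ : Real) : Set where
    field
      {σ τ} : Real
      0<σ   : 0# <ᴿ σ
      0≤τ   : 0# ≤ᴿ τ
      σ+τ≈1 : σ + τ ≈ 1#
      0<n₋  : 0# <ᴿ n₋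
      0<n₊  : 0# <ᴿ n₊
      1≤V   : 1# ≤ᴿ V
      0<e′  : 0# <ᴿ e′
      0<e″  : 0# <ᴿ e″
      0<δ   : 0# <ᴿ δ
      0<δ′  : 0# <ᴿ δ′
      0<δ″  : 0# <ᴿ δ″
      e″≤   : e″ ≤ᴿ τ * n₋
      e″≤1  : e″ ≤ᴿ 1#
      δ′≤   : δ′ ≤ᴿ τ * n₋
      e′<   : (σ + n₊) * V * e′ <ᴿ σ
      n₊δ≤1 : n₊ * δ ≤ᴿ 1#
      δ″n₊≤ : δ″ * n₊ ≤ᴿ δ′

  module _ {L n₋ n₊ V e′ e″ δ δ′ δ″ : Real} (1≤L : 1# ≤ᴿ L) (base : Base n₋ n₊ V e′ e″ δ δ′ δ″) (c : Constants) where
    open Constants c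
    open Base base

    private
      M = L * L * L

      M≈ : M ≈ L ^ 3
      M≈ = solve 1 (λ l → l :* l :* l := l :* (l :* (l :* con 1))) ≈-refl L

      MM≈ : M * M ≈ L ^ 6
      MM≈ = ≈-trans (ℝ.*-cong M≈ M≈) (≈-sym (^-homo-* L 3 3))

      MMMM≈ : M * M * M * M ≈ L ^ 12
      MMMM≈ = ≈-trans (ℝ.*-assoc _ _ _) (≈-trans (ℝ.*-cong MM≈ MM≈) (≈-sym (^-homo-* L 6 6)))

      absorb : ∀ {a k x} m n → 0# ≤ᴿ a → x ≈ a * L ⁻^ m → k ≈ L ^ n → n ℕ.≤ m → x * k ≤ᴿ a
      absorb m n 0≤a x≈ k≈ n≤m = ≤-trans (≤-reflexive (≈-trans (ℝ.*-cong x≈ k≈) (ℝ.*-assoc _ _ _)))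
        (x*y≤x 0≤a (⁻^*^-≤1 1≤L {m} {n} n≤m))

      scaled-pos : ∀ {a x} m → 0# <ᴿ a → x ≈ a * L ⁻^ m → 0# <ᴿ x
      scaled-pos m 0<a x≈ = <-≤-trans (*-pos 0<a (⁻^-pos 1≤L m)) (≤-reflexive (≈-sym x≈))

    scaled-admissible : E ≈ 1# * L ⁻^ 8 → E′ ≈ e′ * L ⁻^ 18 → E″ ≈ e″ * L ⁻^ 13 → E‴ ≈ 1# * L ⁻^ 3 →
      D ≈ δ * L ⁻^ 15 → D′ ≈ δ′ * L ⁻^ 12 → D″ ≈ δ″ * L ⁻^ 16 →
      Admissible L n₋ n₊ V c × AllPositive c
    scaled-admissible E≈ E′≈ E″≈ E‴≈ D≈ D′≈ D″≈ = record
      { 0<σ = 0<σ ; 0≤τ = 0≤τ ; σ+τ≈1 = σ+τ≈1 ; 0<n₋ = 0<n₋ ; 0<n₊ = 0<n₊ ; 1≤V = 1≤V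
      ; 0<E″ = 0<E″ ; 0<D′ = 0<D′ ; 0<D″ = 0<D″
      ; E-small   = absorb 8 3 0≤1 E≈ M≈ (ℕₚ.m≤m+n 3 5)
      ; E‴≤1      = ≤-trans (≤-reflexive (≈-trans E‴≈ (ℝ.*-identityˡ _))) (⁻^≤1 1≤L 3)
      ; D′-small  = ≤-trans (absorb 12 3 (<⇒≤ 0<δ′) D′≈ M≈ (ℕₚ.m≤m+n 3 9)) δ′≤
      ; E″-small  = ≤-trans (absorb 13 3 (<⇒≤ 0<e″) E″≈ M≈ (ℕₚ.m≤m+n 3 10)) e″≤
      ; E″-small₁ = ≤-trans (absorb 13 3 (<⇒≤ 0<e″) E″≈ M≈ (ℕₚ.m≤m+n 3 10)) e″≤1
      ; E′-small  = ≤-<-trans (begin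
          (σ + n₊) * V * (M * M * M * M) * E′
            ≈⟨ solve 3 (λ a m e → a :* m :* e := e :* m :* a) ≈-refl _ _ _ ⟩
          E′ * (M * M * M * M) * ((σ + n₊) * V)
            ≤⟨ *-monoˡ-≤ (ℝ.*-nonNeg 0≤σ+n₊ (≤-trans 0≤1 1≤V)) (absorb 18 12 (<⇒≤ 0<e′) E′≈ MMMM≈ (ℕₚ.m≤m+n 12 6)) ⟩
          e′ * ((σ + n₊) * V)
            ≈⟨ ℝ.*-comm _ _ ⟩
          (σ + n₊) * V * e′ ∎) e′<
      ; D-small   = begin
          M * n₊ * D * M    ≈⟨ solve 3 (λ m n d → m :* n :* d :* m := n :* (d :* (m :* m))) ≈-refl _ _ _ ⟩
          n₊ * (D * (M * M)) ≤⟨ *-monoʳ-≤ (<⇒≤ 0<n₊) (absorb 15 6 (<⇒≤ 0<δ) D≈ MM≈ (ℕₚ.m≤m+n 6 9)) ⟩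
          n₊ * δ            ≤⟨ n₊δ≤1 ⟩
          1#                ∎
      ; D″-small  = begin
          D″ * (M * n₊)                      ≈⟨ ℝ.*-cong D″≈ (ℝ.*-congʳ M≈) ⟩
          δ″ * L ⁻^ 16 * (L ^ 3 * n₊)        ≈⟨ solve 4 (λ d i l n → d :* i :* (l :* n) := d :* n :* (i :* l)) ≈-refl _ _ _ _ ⟩
          δ″ * n₊ * (L ⁻^ 16 * L ^ 3)        ≤⟨ *-mono-≤ (ℝ.*-nonNeg (<⇒≤ 0<δ″) (<⇒≤ 0<n₊)) (<⇒≤ (⁻^-pos 1≤L 12))
                                                  δ″n₊≤ (⁻^*^-≤ 1≤L {16} {3} 12 (ℕₚ.m≤m+n 15 1)) ⟩
          δ′ * L ⁻^ 12                       ≈⟨ D′≈ ⟨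
          D′                                 ∎
      } , (scaled-pos 8 0<1 E≈ , scaled-pos 18 0<e′ E′≈ , 0<E″ , scaled-pos 3 0<1 E‴≈ , scaled-pos 15 0<δ D≈ , 0<D′ , 0<D″)
      where
      0<E″ = scaled-pos 13 0<e″ E″≈
      0<D′ = scaled-pos 12 0<δ′ D′≈
      0<D″ = scaled-pos 16 0<δ″ D″≈
      0≤σ+n₊ : 0# ≤ᴿ σ + n₊
      0≤σ+n₊ = ≤-resp (ℝ.+-identityˡ _) ≈-refl (+-mono-≤ (<⇒≤ 0<σ) (<⇒≤ 0<n₊))

  private
    n⁻¹-pos : ∀ n → 0# <ᴿ fromℕ (suc n) ⁻¹
    n⁻¹-pos n = ⁻¹-pos (0<fromℕ-suc n)

    [mn]⁻¹*m : ∀ m n → fromℕ (suc m ℕ.* suc n) ⁻¹ * fromℕ (suc m) ≈ fromℕ (suc n) ⁻¹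
    [mn]⁻¹*m m n = begin-equality
      k ⁻¹ * fromℕ (suc m)
        ≈⟨ ℝ.*-congˡ (≈-trans (ℝ.*-congˡ (*-inverseʳ⁺ b-pos)) (ℝ.*-identityʳ _)) ⟨
      k ⁻¹ * (fromℕ (suc m) * (b * b ⁻¹))
        ≈⟨ solve 4 (λ i m b j → i :* (m :* (b :* j)) := (i :* (m :* b)) :* j) ≈-refl _ _ _ _ ⟩
      k ⁻¹ * (fromℕ (suc m) * b) * b ⁻¹
        ≈⟨ ℝ.*-congʳ (ℝ.*-congˡ (fromℕ-* (suc m) (suc n))) ⟨
      k ⁻¹ * k * b ⁻¹
        ≈⟨ ≈-trans (ℝ.*-congʳ (*-inverseˡ (0<fromℕ-suc (n ℕ.+ m ℕ.* suc n)))) (ℝ.*-identityˡ _) ⟩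
      b ⁻¹ ∎
      where
      k = fromℕ (suc m ℕ.* suc n)
      b = fromℕ (suc n)
      b-pos : 0# <ᴿ b
      b-pos = 0<fromℕ-suc n

    x*2≈x+x : ∀ x → x * fromℕ 2 ≈ x + x
    x*2≈x+x x = ≈-trans (ℝ.*-congˡ (ℝ.+-congˡ fromℕ-1)) (≈-trans (ℝ.distribˡ x 1# 1#) (ℝ.+-cong (ℝ.*-identityʳ x) (ℝ.*-identityʳ x)))

    ½+½≈1 : ½ + ½ ≈ 1#
    ½+½≈1 = ≈-trans (≈-sym (x*2≈x+x ½)) (*-inverseˡ (0<fromℕ-suc 1))

    ¼*2≈½ : ¼ * fromℕ 2 ≈ ½
    ¼*2≈½ = [mn]⁻¹*m 1 1

    ⅛*2≈¼ : ⅛ * fromℕ 2 ≈ ¼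
    ⅛*2≈¼ = [mn]⁻¹*m 1 3

    ¼+¼≈½ : ¼ + ¼ ≈ ½
    ¼+¼≈½ = ≈-trans (≈-sym (x*2≈x+x ¼)) ¼*2≈½

    0<½ : 0# <ᴿ ½
    0<½ = n⁻¹-pos 1

    0<¼ : 0# <ᴿ ¼
    0<¼ = n⁻¹-pos 3

    x<x+y : ∀ {x y} → 0# <ᴿ y → x <ᴿ x + y
    x<x+y {x} 0<y = ≤-<-trans (≤-reflexive (≈-sym (ℝ.+-identityʳ x))) (+-monoʳ-< x 0<y)

    ¼≤½ : ¼ ≤ᴿ ½
    ¼≤½ = ≤-trans (<⇒≤ (x<x+y 0<¼)) (≤-reflexive ¼+¼≈½)

    ½≤1 : ½ ≤ᴿ 1#
    ½≤1 = ≤-trans (<⇒≤ (x<x+y 0<½)) (≤-reflexive ½+½≈1)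

  module _ {f : Real} (1≤f : 1# ≤ᴿ f) where
    private
      0<f = 1≤⇒0< 1≤f
      0≤f = <⇒≤ 0<f

    vertex-bound-base : ∀ m n k l → 2 ℕ.≤ m → 1 ℕ.+ k ℕ.≤ l → Base 1# f f (¼ * f ⁻^ m) (½ * f ⁻^ n) (f ⁻¹) (¼ * f ⁻^ k) (¼ * f ⁻^ l)
    vertex-bound-base m n k l 2≤m 1+k≤l = record
      { 0<σ = 0<½ ; 0≤τ = <⇒≤ 0<½ ; σ+τ≈1 = ½+½≈1 ; 0<n₋ = 0<1 ; 0<n₊ = 0<f ; 1≤V = 1≤f
      ; 0<e′ = *-pos 0<¼ (⁻^-pos 1≤f m)
      ; 0<e″ = *-pos 0<½ (⁻^-pos 1≤f n)
      ; 0<δ  = ⁻¹-pos 0<f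
      ; 0<δ′ = *-pos 0<¼ (⁻^-pos 1≤f k)
      ; 0<δ″ = *-pos 0<¼ (⁻^-pos 1≤f l)
      ; e″≤  = ≤-trans ½f⁻ⁿ≤½ (≤-reflexive (≈-sym (ℝ.*-identityʳ ½)))
      ; e″≤1 = ≤-trans ½f⁻ⁿ≤½ ½≤1
      ; δ′≤  = ≤-trans (x*y≤x (<⇒≤ 0<¼) (⁻^≤1 1≤f k)) (≤-trans ¼≤½ (≤-reflexive (≈-sym (ℝ.*-identityʳ ½))))
      ; e′<  = ≤-<-trans (begin
          (½ + f) * f * (¼ * f ⁻^ m)
            ≤⟨ *-monoˡ-≤ (ℝ.*-nonNeg (<⇒≤ 0<¼) (<⇒≤ (⁻^-pos 1≤f m))) (*-monoˡ-≤ 0≤f (begin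
                 ½ + f            ≤⟨ +-monoˡ-≤ f (x≤x*y (<⇒≤ 0<½) 1≤f) ⟩
                 ½ * f + f        ≈⟨ solve 2 (λ h f → h :* f :+ f := (h :+ con 1) :* f) ≈-refl ½ f ⟩
                 (½ + 1#) * f   ∎)) ⟩
          (½ + 1#) * f * f * (¼ * f ⁻^ m)
            ≈⟨ solve 4 (λ h f q i → h :* f :* f :* (q :* i) := h :* q :* (i :* (f :* (f :* con 1)))) ≈-refl (½ + 1#) f ¼ (f ⁻^ m) ⟩
          (½ + 1#) * ¼ * (f ⁻^ m * f ^ 2)
            ≤⟨ x*y≤x (ℝ.*-nonNeg 0≤½+1 (<⇒≤ 0<¼)) (⁻^*^-≤1 1≤f {m} {2} 2≤m) ⟩
          (½ + 1#) * ¼ ∎) (<-≤-trans (≤-<-trans (≤-reflexive (ℝ.*-comm _ _)) (*-monoʳ-< 0<¼ ½+1<2)) (≤-reflexive ¼*2≈½))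
      ; n₊δ≤1 = ≤-reflexive (*-inverseʳ⁺ 0<f)
      ; δ″n₊≤ = ≤-trans (≤-reflexive (≈-trans (ℝ.*-assoc _ _ _) (ℝ.*-congˡ (ℝ.*-congˡ (≈-sym (ℝ.*-identityʳ f))))))
                  (*-monoʳ-≤ (<⇒≤ 0<¼) (⁻^*^-≤ 1≤f {l} {1} k 1+k≤l))
      }
      where
      ½f⁻ⁿ≤½ = x*y≤x (<⇒≤ 0<½) (⁻^≤1 1≤f n)
      ½<1 : ½ <ᴿ 1#
      ½<1 = <-≤-trans (x<x+y 0<½) (≤-reflexive ½+½≈1)
      0≤½+1 : 0# ≤ᴿ ½ + 1#
      0≤½+1 = ≤-resp (ℝ.+-identityˡ _) ≈-refl (+-mono-≤ (<⇒≤ 0<½) 0≤1)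
      ½+1<2 : ½ + 1# <ᴿ fromℕ 2
      ½+1<2 = ≤-<-trans (≤-reflexive (ℝ.+-comm _ _)) (<-≤-trans (+-monoʳ-< 1# ½<1)
                   (≤-reflexive (ℝ.+-congˡ (≈-sym fromℕ-1))))

  two-vertex-base : ∀ {V e′} → 1# ≤ᴿ V → 0# <ᴿ e′ → V * e′ ≤ᴿ ¼ → Base (fromℕ 2) (fromℕ 2) V e′ ½ ½ ¼ ⅛
  two-vertex-base {V} {e′} 1≤V 0<e′ Ve′≤¼ = record
    { σ = ½ + ¼ ; τ = ¼
    ; 0<σ = 0<¾ ; 0≤τ = <⇒≤ 0<¼
    ; σ+τ≈1 = ≈-trans (ℝ.+-assoc _ _ _) (≈-trans (ℝ.+-congˡ ¼+¼≈½) ½+½≈1)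
    ; 0<n₋ = 0<2 ; 0<n₊ = 0<2 ; 1≤V = 1≤V
    ; 0<e′ = 0<e′ ; 0<e″ = 0<½ ; 0<δ = 0<½ ; 0<δ′ = 0<¼ ; 0<δ″ = n⁻¹-pos 7
    ; e″≤  = ≤-reflexive (≈-sym ¼*2≈½)
    ; e″≤1 = ½≤1
    ; δ′≤  = ≤-trans ¼≤½ (≤-reflexive (≈-sym ¼*2≈½))
    ; e′<  = ≤-<-trans (≤-trans (≤-reflexive (ℝ.*-assoc _ _ _)) (*-monoʳ-≤ (≤-resp (ℝ.+-identityˡ _) ≈-refl (+-mono-≤ (<⇒≤ 0<¾) (<⇒≤ 0<2))) Ve′≤¼))
        (≤-<-trans (≤-reflexive (ℝ.*-comm _ _)) (<-≤-trans (*-monoʳ-< 0<¼ (≤-<-trans (≤-reflexive (ℝ.+-comm _ _)) (+-monoʳ-< (fromℕ 2) ¾<1)))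
          (≤-reflexive (≈-trans (ℝ.distribˡ ¼ (fromℕ 2) 1#) (ℝ.+-cong ¼*2≈½ (ℝ.*-identityʳ ¼))))))
    ; n₊δ≤1 = ≤-reflexive (*-inverseʳ⁺ 0<2)
    ; δ″n₊≤ = ≤-reflexive ⅛*2≈¼
    }
    where
    0<2 : 0# <ᴿ fromℕ 2
    0<2 = 0<fromℕ-suc 1
    0<¾ : 0# <ᴿ ½ + ¼
    0<¾ = <-≤-trans 0<½ (<⇒≤ (x<x+y 0<¼))
    ¾<1 : ½ + ¼ <ᴿ 1#
    ¾<1 = <-≤-trans (x<x+y 0<¼) (≤-reflexive (≈-trans (ℝ.+-assoc _ _ _) (≈-trans (ℝ.+-congˡ ¼+¼≈½) ½+½≈1)))

  module _ {r ℓr m ℓm : Level} {F : ℕ} {L : Real} where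

    constantsWork : ∀ {c} {𝒦 : ℕ → GradedPoset → Set} →
      (∀ {d X} → pos 2 ℤ.≤ pos d → IsDPoset d X → 𝒦 d X → lowerIrregularity X d ≤ᴿ L →
         Fmax X -1ℤ 0ℤ (pos 2) ℕ.≤ F → Fmax X -1ℤ 1ℤ (pos 2) ℕ.≤ F →
         ∃ λ Λ → ∃₂ λ n₋ n₊ → ∃ λ V → 1# ≤ᴿ Λ × Comparable X Λ × FaceBounds X n₋ n₊ V × Admissible Λ n₋ n₊ V c) →
      ConstantsWork r ℓr m ℓm F L c 𝒦
    constantsWork {c} data-for R d 2≤d X isDPoset inClass w isProper or isOrientation irr≤L F₀ F₁ 𝓕
      ε ε′ 0<ε 0<ε′ α₀ β₀ α₋₁ β₋₁ α∥ β∥ 0≤α₀ 0≤β₀ 0≤α₋₁ 0≤β₋₁ 0≤α∥ 0≤β∥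
      cbe-vertex₋₁ cbe-edge₋₁ cbe-vertex₀ skeleton₀ skeleton₋₁ skeleton∥ α₋₁<Eε
      h₋₁ h₀ h∥ 0<h₋₁ h₋₁≤1 0<h₀ h₀≤1 0<h∥ h∥≤1 small
      with data-for (ℤ.+≤+ 2≤d) isDPoset inClass irr≤L F₀ F₁
    ... | Λ , n₋ , n₊ , V , 1≤Λ , comparable , bounds , admissible = cse-bound h₋₁≤1 , ccd-bound α₋₁<Eε , correction-returns
      where
      open LocalToGlobal {R = R} (ℤ.+≤+ 2≤d) isDPoset isProper or isOrientation 𝓕 1≤Λ comparable bounds {c} admissible
      open ExpandingLinks 0<ε 0<ε′ 0≤α₀ 0≤β₀ 0≤α₋₁ 0≤β₋₁ 0≤α∥ 0≤β∥
                          cbe-vertex₋₁ cbe-edge₋₁ cbe-vertex₀ skeleton₀ skeleton₋₁ skeleton∥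
      open SmallParameters 0<h₋₁ 0<h₀ 0<h∥ small

  private
    swap : ∀ a b c → a * b * c ≈ a * c * b
    swap a b c = solve 3 (λ a b c → a :* b :* c := a :* c :* b) ≈-refl a b c

    one-power : ∀ {x} k → x ≈ x * 1# ⁻^ k
    one-power {x} k = ≈-sym (≈-trans (ℝ.*-congˡ (1⁻^≈1 k)) (ℝ.*-identityʳ x))

  general-admissible : ∀ {L f} → 1# ≤ᴿ L → 1# ≤ᴿ f →
    Admissible L 1# f f (generalConstants L f) × AllPositive (generalConstants L f)
  general-admissible {L} {f} 1≤L 1≤f =
    scaled-admissible 1≤L (vertex-bound-base 1≤f 5 2 2 3 (ℕₚ.m≤m+n 2 3) ℕₚ.≤-refl) (generalConstants L f)
      (≈-sym (ℝ.*-identityˡ _)) (swap _ _ _) (swap _ _ _) (≈-sym (ℝ.*-identityˡ _)) (ℝ.*-comm _ _) (swap _ _ _) (swap _ _ _)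

  lowerRegular-admissible : ∀ {f} → 1# ≤ᴿ f → Admissible 1# 1# f f (lowerRegularConstants f)
  lowerRegular-admissible {f} 1≤f = proj₁ (scaled-admissible ≤-refl
    (vertex-bound-base 1≤f 2 1 1 2 ℕₚ.≤-refl ℕₚ.≤-refl) (lowerRegularConstants f)
    (one-power 8) (one-power 18) (≈-trans (ℝ.*-congˡ f⁻¹≈) (one-power 13)) (one-power 3) (one-power 15)
    (≈-trans (ℝ.*-congˡ f⁻¹≈) (one-power 12)) (one-power 16))
    where
    f⁻¹≈ : f ⁻¹ ≈ f ⁻^ 1
    f⁻¹≈ = ℝ.⁻¹-cong (≈-sym (ℝ.*-identityʳ f))

  simplicial-admissible : Admissible 1# (fromℕ 2) (fromℕ 2) (fromℕ 3) simplicialConstants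
  simplicial-admissible = proj₁ (scaled-admissible ≤-refl
    (two-vertex-base (1≤fromℕ-suc 2) (n⁻¹-pos 11) (≤-reflexive (≈-trans (ℝ.*-comm _ _) ([mn]⁻¹*m 2 3))))
    simplicialConstants (one-power 8) (one-power 18) (one-power 13) (one-power 3) (one-power 15) (one-power 12) (one-power 16))

  cube-admissible : Admissible 1# (fromℕ 2) (fromℕ 2) (fromℕ 4) cubeConstants
  cube-admissible = proj₁ (scaled-admissible ≤-refl
    (two-vertex-base (1≤fromℕ-suc 3) (n⁻¹-pos 15) (≤-reflexive (≈-trans (ℝ.*-comm _ _) ([mn]⁻¹*m 3 3))))
    cubeConstants (one-power 8) (one-power 18) (one-power 13) (one-power 3) (one-power 15) (one-power 12) (one-power 16))

  polygon-admissible : ∀ {L n} → 1# ≤ᴿ L → 1 ℕ.≤ n → Admissible L (fromℕ 2) (fromℕ 2) (fromℕ n) (polygonConstants L n)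
  polygon-admissible {L} {suc n} 1≤L _ = proj₁ (scaled-admissible 1≤L
    (two-vertex-base (1≤fromℕ-suc n) (⁻¹-pos (*-pos (0<fromℕ-suc 3) (0<fromℕ-suc n)))
      (≤-reflexive (begin-equality
        fromℕ (suc n) * (fromℕ 4 * fromℕ (suc n)) ⁻¹
          ≈⟨ ≈-trans (ℝ.*-congˡ (ℝ.⁻¹-cong (≈-trans (ℝ.*-comm _ _) (≈-sym (fromℕ-* (suc n) 4))))) (ℝ.*-comm _ _) ⟩
        fromℕ (suc n ℕ.* 4) ⁻¹ * fromℕ (suc n)
          ≈⟨ [mn]⁻¹*m n 3 ⟩
        ¼ ∎)))
    (polygonConstants L (suc n)) (≈-sym (ℝ.*-identityˡ _)) ≈-refl ≈-refl (≈-sym (ℝ.*-identityˡ _)) ≈-refl ≈-refl ≈-refl)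

theorem8p10 :
  ∀ {r ℓr m ℓm : Level} (em : ∀ {ℓ} → ExcludedMiddle ℓ) (ℝ : CompleteOrderedField) →
  let open Classical em ℝ in
  ∀ (F : ℕ) (L : Real) → 1# ≤ᴿ L →
  (∃ λ c → AllPositive c × ConstantsWork r ℓr m ℓm F L c (λ _ _ → ⊤)) ×
  ConstantsWork r ℓr m ℓm F L (generalConstants L (fromℕ F)) (λ _ _ → ⊤) ×
  ConstantsWork r ℓr m ℓm F L (lowerRegularConstants (fromℕ F)) (λ d X → IsLowerRegular X d) ×
  ConstantsWork r ℓr m ℓm F L simplicialConstants (λ _ X → IsSimplicialComplex X) ×
  ConstantsWork r ℓr m ℓm F L cubeConstants (λ _ X → IsCubeComplex X) ×
  (∀ n → ConstantsWork r ℓr m ℓm F L (polygonConstants L n) (λ _ X → Is-gonComplex₂ n X))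
theorem8p10 em ℝ F L 1≤L =
  -- For F = 0 the hypotheses cannot hold, but generalConstants L 0 need not be positive.
  (generalConstants L (fromℕ (suc F)) , proj₂ (general-admissible 1≤L (1≤fromℕ-suc F)) ,
    constantsWork λ 2≤d isDPoset _ irr F₀ F₁ → L , 1# , fromℕ (suc F) , fromℕ (suc F) , 1≤L ,
      lowerIrregularity⇒Comparable isDPoset irr ,
      faceBounds isDPoset 2≤d (ℕₚ.m≤n⇒m≤1+n F₀) (ℕₚ.m≤n⇒m≤1+n F₁) ,
      proj₁ (general-admissible 1≤L (1≤fromℕ-suc F))) ,
  (constantsWork λ 2≤d isDPoset _ irr F₀ F₁ → L , 1# , fromℕ F , fromℕ F , 1≤L ,
    lowerIrregularity⇒Comparable isDPoset irr , faceBounds isDPoset 2≤d F₀ F₁ ,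
    proj₁ (general-admissible 1≤L (1≤fromℕ (1≤F isDPoset 2≤d F₀ F₁)))) ,
  (constantsWork λ 2≤d isDPoset regular _ F₀ F₁ → 1# , 1# , fromℕ F , fromℕ F , ≤-refl ,
    lowerIrregularity⇒Comparable isDPoset (≤-reflexive regular) , faceBounds isDPoset 2≤d F₀ F₁ ,
    lowerRegular-admissible (1≤fromℕ (1≤F isDPoset 2≤d F₀ F₁))) ,
  (constantsWork λ _ isDPoset simplicial _ _ _ → 1# , fromℕ 2 , fromℕ 2 , fromℕ 3 , ≤-refl ,
    Formula.formula⇒Comparable isDPoset (simplexCount isDPoset) (simplicial-formula isDPoset simplicial) ,
    Formula.formula⇒FaceBounds isDPoset (simplexCount isDPoset) (simplicial-formula isDPoset simplicial) ,
    simplicial-admissible) ,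
  (constantsWork λ _ isDPoset cube _ _ _ → 1# , fromℕ 2 , fromℕ 2 , fromℕ 4 , ≤-refl ,
    Formula.formula⇒Comparable isDPoset (cubeCount isDPoset) (cube-formula isDPoset cube) ,
    Formula.formula⇒FaceBounds isDPoset (cubeCount isDPoset) (cube-formula isDPoset cube) ,
    cube-admissible) ,
  λ n → constantsWork λ _ isDPoset polygons irr _ _ → L , fromℕ 2 , fromℕ 2 , fromℕ n , 1≤L ,
    lowerIrregularity⇒Comparable isDPoset irr , polygon-faceBounds isDPoset polygons ,
    polygon-admissible 1≤L (ℕₚ.≤-trans (ℕ.s≤s ℕ.z≤n) (proj₁ polygons))
  where
  open Classical em ℝ
  open OrderedField ℝ using (≤-refl; ≤-reflexive; 1≤fromℕ; 1≤fromℕ-suc)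
  open FaceCounts em ℝ
  open Cells em ℝ
  open ExplicitConstants em ℝ
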